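{- Let $\phi=1/6$ and let $q_1,\dots,q_k$ be any probability distributions over a domain $\mathcal{X}$. Then the induced $\phi$-Scheffé graph on $q_1,\dots,q_k$ has domination number at most $4k^{3/2}\sqrt{\log k}$. Moreover, there exists a randomized preprocessing algorithm that, given $q_1,\dots,q_k$, finds a dominating set of this graph of size at most $4k^{3/2}\sqrt{\log k}$ in $O(k^{5/2}\sqrt{\log k})$ expected time.
   Context: Here $\log$ is the base-2 logarithm. Distributions over $\mathcal{X}$ are identified with their mass functions (or densities with respect to a common reference measure), $\|f\|_1=\sum_x|f(x)|$ and $\langle f,T\rangle=\sum_x f(x)T(x)$ for $T:\mathcal{X}\to\{ -1,1\}$ (integrals in the continuous setting). For $1\le j<j'\le k$ let $\delta_{jj'}:=q_j-q_{j'}$, and let the signed Scheffé set $S_{jj'}:\mathcal{X}\to\{ -1,1\}$ from $q_j$ to $q_{j'}$ be $S_{jj'}(x)=+1$ if $q_j(x)\ge q_{j'}(x)$ and $S_{jj'}(x)=-1$ if $q_j(x)<q_{j'}(x)$. The induced $\phi$-Scheffé graph is the digraph with vertex set $\binom{[k]}{2}=\{\{j,j'\}:1\le j<j'\le k\}$ and an edge $\{i,i'\}\to\{j,j'\}$ (with $i<i'$, $j<j'$) whenever $|\langle\delta_{jj'},S_{ii'}\rangle|\ge\phi\|\delta_{jj'}\|_1$. A dominating set of a digraph $G=(V,E)$ is a subset $D\subseteq V$ such that for every $w\in V$ either $w\in D$ or there is $v\in D$ with $(v,w)\in E$. The domination number of $G$ is the minimum size of a dominating set. Running-time convention: the time to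 check whether $|\langle q_j-q_{j'},S_{ii'}\rangle|\ge\phi\|q_j-q_{j'}\|_1$ counts as a single unit of computation. -}

module Defs where

open import Level using (Level; _⊔_) renaming (suc to lsuc)
open import Algebra.Bundles using (CommutativeRing)
import Algebra.Definitions.RawMonoid as RawMonoidDefs
import Algebra.Properties.Semiring.Sum as Sums
open import Data.Bool.Base using (Bool; true; false; if_then_else_)
open import Data.Fin.Base as Fin using (Fin; toℕ)
open import Data.Integer.Base as ℤ using ()
open import Data.List.Base using (List; []; _∷_; _++_; [_]; length; foldl; map)
open import Data.List.Membership.Propositional using (_∈_)
open import Data.List.Relation.Unary.Unique.Propositional using (Unique)
open import Data.Nat.Base as ℕ using (ℕ; zero; suc)
open import Data.Product.Base using (_×_; _,_; ∃-syntax)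
open import Data.Rational.Unnormalised.Base as ℚᵘ using (ℚᵘ; ↥_; ↧ₙ_; 0ℚᵘ; 1ℚᵘ; ½)
open import Data.Sign.Base using (Sign)
open import Data.Sum.Base using (_⊎_)
open import Data.Unit.Polymorphic.Base using (⊤)
open import Function.Base using (_∘_)
open import Relation.Binary.Core using (Rel)
open import Relation.Binary.PropositionalEquality.Core using (_≡_)
open import Relation.Binary.Structures using (IsDecTotalOrder)
open import Relation.Nullary.Decidable.Core using (does)
open import Relation.Nullary.Reflects using (Reflects)

------------------------------------------------------------------------
-- Scalars

-- The order is decidable, as that of ℝ is classically; completeness is
-- not needed, so ℝ is replaced by an arbitrary totally ordered field.

record OrderedField (c ℓ₁ ℓ₂ : Level) : Set (lsuc (c ⊔ ℓ₁ ⊔ ℓ₂)) where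
  field
    commutativeRing : CommutativeRing c ℓ₁

  open CommutativeRing commutativeRing public

  infix 4 _≤_
  infix 8 _⁻¹

  field
    _≤_             : Rel Carrier ℓ₂
    isDecTotalOrder : IsDecTotalOrder _≈_ _≤_
    +-monoˡ-≤       : ∀ {x y} z → x ≤ y → x + z ≤ y + z
    *-nonneg        : ∀ {x y} → 0# ≤ x → 0# ≤ y → 0# ≤ x * y
    0≉1             : 0# ≉ 1#
    -- total, with an unspecified value at 0#
    _⁻¹             : Carrier → Carrier
    ⁻¹-cong         : ∀ {x y} → x ≈ y → x ⁻¹ ≈ y ⁻¹
    ⁻¹-inverseʳ     : ∀ {x} → x ≉ 0# → x * x ⁻¹ ≈ 1#

  open IsDecTotalOrder isDecTotalOrder public using (_≤?_)

  ∣_∣ : Carrier → Carrier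
  ∣ x ∣ = if does (0# ≤? x) then x else - x

  fromℕ : ℕ → Carrier
  fromℕ n = n ×ⁿ 1#
    where open RawMonoidDefs +-rawMonoid renaming (_×_ to _×ⁿ_)

  1/6 : Carrier
  1/6 = fromℕ 6 ⁻¹

  ⟦_⟧ : Sign → Carrier
  ⟦ Sign.+ ⟧ = 1#
  ⟦ Sign.- ⟧ = - 1#

------------------------------------------------------------------------
-- Integration on a domain X

module _ {c ℓ₁ ℓ₂} (F : OrderedField c ℓ₁ ℓ₂) where
  open OrderedField F

  scheffé : ∀ {x} {X : Set x} → (X → Carrier) → (X → Carrier) → X → Sign
  scheffé f g x = if does (g x ≤? f x) then Sign.+ else Sign.-

  -- The properties of integration against a reference measure that are
  -- used: linearity and monotonicity on a space of integrable functions,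
  -- together with measurability of { f ≥ g } for integrable f and g.
  -- Summable functions with ∑, and Lebesgue integrable functions on any
  -- measure space, are instances.  The value of ∫ off the integrable
  -- functions is unspecified.
  record Integration {x} (X : Set x) (p : Level) :
         Set (lsuc p ⊔ x ⊔ c ⊔ ℓ₁ ⊔ ℓ₂) where
    field
      Integrable : (X → Carrier) → Set p
      ∫          : (X → Carrier) → Carrier

      integrable-resp-≈ : ∀ {f g} → (∀ x → f x ≈ g x) →
                          Integrable f → Integrable g
      integrable-+      : ∀ {f g} → Integrable f → Integrable g →
                          Integrable (λ x → f x + g x)
      integrable-*      : ∀ a {f} → Integrable f →
                          Integrable (λ x → a * f x)
      integrable-sign   : ∀ {f g h} → Integrable f → Integrable g →
                          Integrable h →
                          Integrable (λ x → h x * ⟦ scheffé f g x ⟧)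

      ∫-+    : ∀ {f g} → Integrable f → Integrable g →
               ∫ (λ x → f x + g x) ≈ ∫ f + ∫ g
      ∫-*    : ∀ a {f} → Integrable f → ∫ (λ x → a * f x) ≈ a * ∫ f
      ∫-mono : ∀ {f g} → Integrable f → Integrable g →
               (∀ x → f x ≤ g x) → ∫ f ≤ ∫ g

  -- Mass functions on an n-point domain.
  counting : ∀ n → Integration (Fin n) c
  counting n = record
    { Integrable        = λ _ → ⊤
    ; ∫                 = sum
    ; integrable-resp-≈ = _
    ; integrable-+      = _
    ; integrable-*      = _
    ; integrable-sign   = _
    ; ∫-+               = λ {f} {g} _ _ → ∑-distrib-+ f g
    ; ∫-*               = λ a {f} _ → sym (*-distribˡ-sum a f)
    ; ∫-mono            = λ {f} {g} _ _ → sum-mono f g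
    }
    where
    open Sums semiring using (sum; ∑-distrib-+; *-distribˡ-sum)
    open IsDecTotalOrder isDecTotalOrder using (≤-respˡ-≈; ≤-respʳ-≈)
      renaming (refl to ≤-refl; trans to ≤-trans)

    sum-mono : ∀ {n} (f g : Fin n → Carrier) →
               (∀ i → f i ≤ g i) → sum f ≤ sum g
    sum-mono {zero}  f g f≤g = ≤-refl
    sum-mono {suc n} f g f≤g = ≤-trans
      (+-monoˡ-≤ _ (f≤g Fin.zero))
      (≤-respˡ-≈ (+-comm _ _) (≤-respʳ-≈ (+-comm _ _)
        (+-monoˡ-≤ _ (sum-mono (f ∘ Fin.suc) (g ∘ Fin.suc) (f≤g ∘ Fin.suc)))))

------------------------------------------------------------------------
-- Digraphs and domination

record Digraph (v e : Level) : Set (lsuc (v ⊔ e)) where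
  field
    V   : Set v
    _⟶_ : Rel V e

module _ {v e} (G : Digraph v e) where
  open Digraph G

  -- Finite sets of vertices are duplicate-free lists.
  IsDominatingSet : List V → Set (v ⊔ e)
  IsDominatingSet D =
    Unique D × (∀ w → w ∈ D ⊎ ∃[ u ] (u ∈ D × u ⟶ w))

  IsDominationNumber : ℕ → Set (v ⊔ e)
  IsDominationNumber n =
    (∃[ D ] (IsDominatingSet D × length D ≡ n)) ×
    (∀ D → IsDominatingSet D → n ℕ.≤ length D)

------------------------------------------------------------------------
-- The Scheffé graph

record Pair (k : ℕ) : Set where
  constructor pair
  field
    lo hi : Fin k
    lo<hi : lo Fin.< hi

  code : ℕ × ℕ
  code = toℕ lo , toℕ hi

module _ {c ℓ₁ ℓ₂} {F : OrderedField c ℓ₁ ℓ₂}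
         {x p} {X : Set x} (I : Integration F X p) where
  open OrderedField F
  open Integration I

  record Distribution : Set (x ⊔ p ⊔ c ⊔ ℓ₁ ⊔ ℓ₂) where
    field
      mass       : X → Carrier
      integrable : Integrable mass
      nonneg     : ∀ y → 0# ≤ mass y
      total      : ∫ mass ≈ 1#

  open Distribution

  ∥_∥₁ : (X → Carrier) → Carrier
  ∥ f ∥₁ = ∫ (λ y → ∣ f y ∣)

  ⟨_,_⟩ : (X → Carrier) → (X → Sign) → Carrier
  ⟨ f , T ⟩ = ∫ (λ y → f y * ⟦ T y ⟧)

  module _ {k} (q : Fin k → Distribution) where
    open Pair

    δ : Pair k → X → Carrier
    δ v y = mass (q (lo v)) y - mass (q (hi v)) y

    S : Pair k → X → Sign
    S v = scheffé F (mass (q (lo v))) (mass (q (hi v)))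

    scheffé-graph : Carrier → Digraph Level.zero ℓ₂
    scheffé-graph φ = record
      { V   = Pair k
      ; _⟶_ = λ v w → φ * ∥ δ w ∥₁ ≤ ∣ ⟨ δ w , S v ⟩ ∣
      }

------------------------------------------------------------------------
-- Bounds of the form c · k^{m/2} · √(log₂ k)

-- For x = r/d ≥ 0 and n ≥ 1:  r/d ≤ a log₂ n  iff  2 ^ r ≤ n ^ (a d).
infix 4 _≤_·log₂_ _≤_·√[_^_·log₂_]

_≤_·log₂_ : ℚᵘ → ℕ → ℕ → Set
x ≤ a ·log₂ n = 2 ℕ.^ ℤ.∣ ↥ x ∣ ℕ.≤ n ℕ.^ (a ℕ.* ↧ₙ x)

-- x ≤ c √(k ^ m · log₂ n), for x ≥ 0 and n ≥ 1, by squaring.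
_≤_·√[_^_·log₂_] : ℚᵘ → ℕ → ℕ → ℕ → ℕ → Set
x ≤ c ·√[ k ^ m ·log₂ n ] =
  (x ℚᵘ.* x) ≤ (c ℕ.^ 2 ℕ.* k ℕ.^ m) ·log₂ n

fromNat : ℕ → ℚᵘ
fromNat n = ℤ.+ n ℚᵘ./ 1

------------------------------------------------------------------------
-- Randomized algorithms: structured programs for a random access machine
-- with a fair coin and an oracle, all elementary operations costing 1

-- Names of memory cells occurring in a program.
Reg : Set
Reg = ℕ

data Instr : Set where
  const : (x : Reg) (n : ℕ)    → Instr   -- x := n
  copy  : (x y : Reg)          → Instr   -- x := y
  add   : (x y z : Reg)        → Instr   -- x := y + z
  sub   : (x y z : Reg)        → Instr   -- x := y ∸ z
  load  : (x y : Reg)          → Instr   -- x := M[y]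
  store : (x y : Reg)          → Instr   -- M[x] := y
  flip  : (x : Reg)            → Instr   -- x := fair coin in {0 , 1}
  query : (x i i′ j j′ : Reg)  → Instr   -- x := is {i , i′} ⟶ {j , j′} an edge?
  emit  : (i i′ : Reg)         → Instr   -- output (i , i′)
  ifnz  : (x : Reg) (P Q : List Instr) → Instr   -- if x ≠ 0 then P else Q
  while : (x : Reg) (P : List Instr)   → Instr   -- while x ≠ 0 do P

Program : Set
Program = List Instr

Memory : Set
Memory = ℕ → ℕ

_[_≔_] : Memory → ℕ → ℕ → Memory
(M [ a ≔ n ]) b = if b ℕ.≡ᵇ a then n else M b

Oracle : Set
Oracle = ℕ → ℕ → ℕ → ℕ → Bool

bit : Bool → ℕ
bit b = if b then 1 else 0

record Config : Set where
  constructor config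
  field
    prog   : Program
    memory : Memory
    output : List (ℕ × ℕ)

open Config public

Halted : Config → Set
Halted C = prog C ≡ []

-- The Boolean is the coin available to this step; it is used by flip only.
step : Oracle → Bool → Config → Config
step o b (config []                       M out) = config [] M out
step o b (config (const x n        ∷ P)   M out) = config P (M [ x ≔ n ]) out
step o b (config (copy x y         ∷ P)   M out) = config P (M [ x ≔ M y ]) out
step o b (config (add x y z        ∷ P)   M out) = config P (M [ x ≔ M y ℕ.+ M z ]) out
step o b (config (sub x y z        ∷ P)   M out) = config P (M [ x ≔ M y ℕ.∸ M z ]) out
step o b (config (load x y         ∷ P)   M out) = config P (M [ x ≔ M (M y) ]) out
step o b (config (store x y        ∷ P)   M out) = config P (M [ M x ≔ M y ]) out
step o b (config (flip x           ∷ P)   M out) = config P (M [ x ≔ bit b ]) out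
step o b (config (query x i i′ j j′ ∷ P)  M out) =
  config P (M [ x ≔ bit (o (M i) (M i′) (M j) (M j′)) ]) out
step o b (config (emit i i′        ∷ P)   M out) = config P M (out ++ [ M i , M i′ ])
step o b (config (ifnz x Q R       ∷ P)   M out) with M x
... | zero  = config (R ++ P) M out
... | suc _ = config (Q ++ P) M out
step o b (config (while x Q        ∷ P)   M out) with M x
... | zero  = config P M out
... | suc _ = config (Q ++ while x Q ∷ P) M out

run : Oracle → List Bool → Config → Config
run o coins C = foldl (λ C′ b → step o b C′) C coins

start : Program → ℕ → Config
start P k = config P (λ { zero → k ; (suc _) → 0 }) []

-- E[ min (T , N) ], T being the number of steps before halting.
truncatedTime : Oracle → ℕ → Config → ℚᵘ
truncatedTime o zero    C = 0ℚᵘ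
truncatedTime o (suc N) C@(config []      _ _) = 0ℚᵘ
truncatedTime o (suc N) C@(config (_ ∷ _) _ _) =
  1ℚᵘ ℚᵘ.+ ½ ℚᵘ.* (truncatedTime o N (step o true C) ℚᵘ.+
                    truncatedTime o N (step o false C))

-- E[ T ] ≤ β, stated as a condition on the truncated expectations, whose
-- supremum is E[ T ] by monotone convergence; ≤β x stands for x ≤ β.
ExpectedTime : Oracle → Program → ℕ → (ℚᵘ → Set) → Set
ExpectedTime o P k ≤β = ∀ N → ≤β (truncatedTime o N (start P k))

-- Every halting run lists the pairs of some D with Good D.  If the expected
-- time is finite, runs halt with probability 1.
Outputs : ∀ {ℓ} → Oracle → Program → (k : ℕ) → (List (Pair k) → Set ℓ) → Set ℓ
Outputs o P k Good = ∀ coins → Halted (run o coins (start P k)) →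
  ∃[ D ] (output (run o coins (start P k)) ≡ map Pair.code D × Good D)

-- The oracle decides adjacency of vertices; its answers to ill-formed
-- queries (not i < i′ < k and j < j′ < k) are arbitrary.
Answers : ∀ {k e} → Rel (Pair k) e → Oracle → Set e
Answers _⟶_ o = ∀ v w → Reflects (v ⟶ w)
    (o (toℕ (lo v)) (toℕ (hi v)) (toℕ (lo w)) (toℕ (hi w)))
  where open Pair

{-# OPTIONS --safe #-}

-- For x < i < j the identity δ_{xj} = δ_{xi} + δ_{ij} and the triangle
-- inequality force one of {x,i} → {x,j}, {x,j} → {x,i}, {i,j} → {x,i},
-- {i,j} → {x,j}.  This already gives a deterministic algorithm.  Let
-- L = ⌊log₂ k⌋ and split [k] into intervals B of length b ≈ √(k L).  Take all
-- pairs inside the intervals.  For x to the left of B, let A consist of those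
-- j ∈ B for which {x,j} has no in-edge from a pair inside B; on A the relation
-- {x,i} → {x,j} is semicomplete, so some {x,u} dominates at least half of the
-- {x,j}, and after at most L + 1 such choices all of them are dominated.  About
-- k b + (k² / b) L pairs are taken, in time O(k² b), since the greedy rounds
-- for one x and B cost b² + (b / 2)² + ⋯.

module Submission where

open import Defs
open import Level using (Level)
open import Data.Nat.Base as ℕ using (ℕ; suc; zero)
open import Data.Fin.Base as Fin using (Fin; toℕ; fromℕ<)
open import Data.Product.Base using (_×_; _,_; ∃-syntax; proj₁; proj₂)
open import Data.Sign.Base using (Sign)
open import Data.Sum.Base using (_⊎_; inj₁; inj₂)
open import Relation.Nullary using (¬_; Dec; yes; no; does; proof; contradiction)
open import Relation.Binary.Structures using (IsDecTotalOrder)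
open import Algebra.Bundles using (CommutativeMonoid)
import Algebra.Properties.Ring as RingProperties
import Algebra.Properties.CommutativeSemigroup as CommutativeSemigroupProperties

-- Let `a`, `b`, `d` be the norms of δ_{xi}, δ_{xj}, δ_{ij}. If all four edges fail at threshold φ,
-- testing the identity against the Scheffé set of each pair gives a ≤ φb + d, b ≤ φa + d and d ≤
-- φ(a + b), hence a + b ≤ 3φ(a + b). For φ = 1/6 the factor is 1/2, so a = b = 0; but an edge into
-- a zero difference always holds.
--
-- The obstacle to a direct greedy choice is the third pair {i,j}: edges out of it do not compare
-- {x,i} with {x,j}. Taking all pairs inside an interval disposes of it at a cost growing with b,
-- while every interval costs up to L + 1 further pairs for each x; the choice of b balances the
-- two.
--
-- No real logarithm or root is computed. With σ = ⌊√(kL)⌋ and b = σ + 1, the facts σ² ≤ kL and 2^L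
-- ≤ k turn a bound c k^m σ into c √(k^(2m+1) log k). The size is at most 4kσ: one σ per index for
-- the interval pairs and three for the greedy choices, as k(L + 1) ≤ 3σb.
--
-- The program flips no coin, so its expected time is its number of steps. The domination number is
-- bounded by the same set, computed with an oracle that the decidable order provides.

-- Inequalities in an ordered field

module FieldProperties {c ℓ₁ ℓ₂} (F : OrderedField c ℓ₁ ℓ₂) where
  open OrderedField F
  open IsDecTotalOrder isDecTotalOrder public
    using (antisym; total; ≤-respˡ-≈; ≤-respʳ-≈)
    renaming (refl to ≤-refl; trans to ≤-trans; reflexive to ≤-reflexive)
  open RingProperties ring public
    using (-‿involutive; -0#≈0#; -‿distribʳ-*)
  open CommutativeSemigroupProperties (CommutativeMonoid.commutativeSemigroup +-commutativeMonoid)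
    public using (interchange)

  +-mono-≤ : ∀ {x y u v} → x ≤ y → u ≤ v → x + u ≤ y + v
  +-mono-≤ {x} {y} {u} {v} x≤y u≤v = ≤-trans (+-monoˡ-≤ u x≤y)
    (≤-respˡ-≈ (+-comm u y) (≤-respʳ-≈ (+-comm v y) (+-monoˡ-≤ y u≤v)))

  neg-antimono : ∀ {x y} → x ≤ y → - y ≤ - x
  neg-antimono {x} {y} x≤y =
    ≤-respˡ-≈ lhs (≤-respʳ-≈ rhs (+-monoˡ-≤ (- x + - y) x≤y))
    where
    lhs : x + (- x + - y) ≈ - y
    lhs = trans (sym (+-assoc x (- x) (- y)))
            (trans (+-congʳ (-‿inverseʳ x)) (+-identityˡ (- y)))
    rhs : y + (- x + - y) ≈ - x
    rhs = trans (+-congˡ (+-comm (- x) (- y)))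
            (trans (sym (+-assoc y (- y) (- x)))
              (trans (+-congʳ (-‿inverseʳ y)) (+-identityˡ (- x))))

  x≤0⇒0≤-x : ∀ {x} → x ≤ 0# → 0# ≤ - x
  x≤0⇒0≤-x x≤0 = ≤-respˡ-≈ -0#≈0# (neg-antimono x≤0)

  0≤x⇒-x≤0 : ∀ {x} → 0# ≤ x → - x ≤ 0#
  0≤x⇒-x≤0 0≤x = ≤-respʳ-≈ -0#≈0# (neg-antimono 0≤x)

  x≤y⇒0≤y-x : ∀ {x y} → x ≤ y → 0# ≤ y - x
  x≤y⇒0≤y-x {x} x≤y = ≤-respˡ-≈ (-‿inverseʳ x) (+-monoˡ-≤ (- x) x≤y)

  x≤y⇒x-y≤0 : ∀ {x y} → x ≤ y → x - y ≤ 0#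
  x≤y⇒x-y≤0 {x} {y} x≤y = ≤-respʳ-≈ (-‿inverseʳ y) (+-monoˡ-≤ (- y) x≤y)

  x≤x+y : ∀ {x y} → 0# ≤ y → x ≤ x + y
  x≤x+y {x} 0≤y = ≤-respˡ-≈ (+-identityʳ x) (+-mono-≤ ≤-refl 0≤y)

  x+x≤x⇒x≤0 : ∀ {x} → x + x ≤ x → x ≤ 0#
  x+x≤x⇒x≤0 {x} le = ≤-respˡ-≈
    (trans (+-assoc x x (- x)) (trans (+-congˡ (-‿inverseʳ x)) (+-identityʳ x)))
    (≤-respʳ-≈ (-‿inverseʳ x) (+-monoˡ-≤ (- x) le))

  0≤x⇒∣x∣≈x : ∀ {x} → 0# ≤ x → ∣ x ∣ ≈ x
  0≤x⇒∣x∣≈x {x} 0≤x with 0# ≤? x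
  ... | yes _  = refl
  ... | no 0≰x = contradiction 0≤x 0≰x

  x≤0⇒∣x∣≈-x : ∀ {x} → x ≤ 0# → ∣ x ∣ ≈ - x
  x≤0⇒∣x∣≈-x {x} x≤0 with 0# ≤? x
  ... | no _    = refl
  ... | yes 0≤x = trans x≈0 (trans (sym -0#≈0#) (-‿cong (sym x≈0)))
    where x≈0 = antisym x≤0 0≤x

  0≤∣x∣ : ∀ x → 0# ≤ ∣ x ∣
  0≤∣x∣ x with total 0# x
  ... | inj₁ 0≤x = ≤-respʳ-≈ (sym (0≤x⇒∣x∣≈x 0≤x)) 0≤x
  ... | inj₂ x≤0 = ≤-respʳ-≈ (sym (x≤0⇒∣x∣≈-x x≤0)) (x≤0⇒0≤-x x≤0)

  x≤∣x∣ : ∀ x → x ≤ ∣ x ∣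
  x≤∣x∣ x with total 0# x
  ... | inj₁ 0≤x = ≤-reflexive (sym (0≤x⇒∣x∣≈x 0≤x))
  ... | inj₂ x≤0 = ≤-trans x≤0 (0≤∣x∣ x)

  -x≤∣x∣ : ∀ x → - x ≤ ∣ x ∣
  -x≤∣x∣ x with total 0# x
  ... | inj₁ 0≤x = ≤-trans (0≤x⇒-x≤0 0≤x) (0≤∣x∣ x)
  ... | inj₂ x≤0 = ≤-reflexive (sym (x≤0⇒∣x∣≈-x x≤0))

  x*-1≈-x : ∀ x → x * - 1# ≈ - x
  x*-1≈-x x = trans (sym (-‿distribʳ-* x 1#)) (-‿cong (*-identityʳ x))

  x*⟦s⟧≤∣x∣ : ∀ x s → x * ⟦ s ⟧ ≤ ∣ x ∣
  x*⟦s⟧≤∣x∣ x Sign.+ = ≤-respˡ-≈ (sym (*-identityʳ x)) (x≤∣x∣ x)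
  x*⟦s⟧≤∣x∣ x Sign.- = ≤-respˡ-≈ (sym (x*-1≈-x x)) (-x≤∣x∣ x)

  -x*⟦s⟧≤∣x∣ : ∀ x s → - (x * ⟦ s ⟧) ≤ ∣ x ∣
  -x*⟦s⟧≤∣x∣ x Sign.+ = ≤-respˡ-≈ (-‿cong (sym (*-identityʳ x))) (-x≤∣x∣ x)
  -x*⟦s⟧≤∣x∣ x Sign.- = ≤-respˡ-≈
    (trans (sym (-‿involutive x)) (-‿cong (sym (x*-1≈-x x)))) (x≤∣x∣ x)

  -- Pointwise form of the optimality of the Scheffé set: the pairing of a difference with its own
  -- set is the full norm.
  scheffé-attains-∣∣ : ∀ {a} {X : Set a} (f g : X → Carrier) y →
    (f y - g y) * ⟦ scheffé F f g y ⟧ ≈ ∣ f y - g y ∣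
  scheffé-attains-∣∣ f g y with g y ≤? f y
  ... | yes g≤f = trans (*-identityʳ _) (sym (0≤x⇒∣x∣≈x (x≤y⇒0≤y-x g≤f)))
  ... | no g≰f with total (f y) (g y)
  ...   | inj₁ f≤g = trans (x*-1≈-x _) (sym (x≤0⇒∣x∣≈-x (x≤y⇒x-y≤0 f≤g)))
  ...   | inj₂ g≤f = contradiction g≤f g≰f

  0≤1 : 0# ≤ 1#
  0≤1 with total 0# 1#
  ... | inj₁ 0≤1 = 0≤1
  ... | inj₂ 1≤0 = ≤-respʳ-≈ (trans (x*-1≈-x (- 1#)) (-‿involutive 1#))
                     (*-nonneg 0≤-1 0≤-1)
    where 0≤-1 = x≤0⇒0≤-x 1≤0

  0≤fromℕ : ∀ n → 0# ≤ fromℕ n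
  0≤fromℕ zero    = ≤-refl
  0≤fromℕ (suc n) = ≤-trans 0≤1 (x≤x+y (0≤fromℕ n))

  fromℕ-suc≉0 : ∀ n → fromℕ (suc n) ≉ 0#
  fromℕ-suc≉0 n eq = 0≉1 (antisym 0≤1 (≤-respʳ-≈ eq (x≤x+y (0≤fromℕ n))))

  -- With 1/6 turned into a sixfold sum, the later inequalities need only monotonicity of addition.
  six-sixths : ∀ x → let y = 1/6 * x in
               y + (y + (y + (y + (y + y)))) ≈ x
  six-sixths x = sym (trans (sym 6*y≈x) expand)
    where
    y = 1/6 * x
    6*y≈x : fromℕ 6 * y ≈ x
    6*y≈x = trans (sym (*-assoc _ _ _))
      (trans (*-congʳ (⁻¹-inverseʳ (fromℕ-suc≉0 5))) (*-identityˡ x))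
    unfold : ∀ n → fromℕ (suc n) * y ≈ y + fromℕ n * y
    unfold n = trans (distribʳ y 1# (fromℕ n)) (+-congʳ (*-identityˡ y))
    last : fromℕ 1 * y ≈ y
    last = trans (unfold 0) (trans (+-congˡ (zeroˡ y)) (+-identityʳ y))
    expand : fromℕ 6 * y ≈ y + (y + (y + (y + (y + y))))
    expand = trans (unfold 5) (+-congˡ (trans (unfold 4) (+-congˡ (trans (unfold 3)
      (+-congˡ (trans (unfold 2) (+-congˡ (trans (unfold 1) (+-congˡ last)))))))))

  -- If 1/6 were at most 0, so would be the sum of six copies, which is 1.
  0≤1/6 : 0# ≤ 1/6
  0≤1/6 with total 0# 1/6
  ... | inj₁ h = h
  ... | inj₂ h = contradiction (antisym 0≤1 1≤0) 0≉1
    where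
    y = 1/6 * 1#
    y≤0 : y ≤ 0#
    y≤0 = ≤-respˡ-≈ (sym (*-identityʳ 1/6)) h
    +0 : ∀ {z} → z ≤ 0# → y + z ≤ 0#
    +0 z≤0 = ≤-respʳ-≈ (+-identityʳ 0#) (+-mono-≤ y≤0 z≤0)
    1≤0 : 1# ≤ 0#
    1≤0 = ≤-respˡ-≈ (six-sixths 1#) (+0 (+0 (+0 (+0 (+0 y≤0)))))

  1/6*x≤x : ∀ {x} → 0# ≤ x → 1/6 * x ≤ x
  1/6*x≤x {x} 0≤x = ≤-respʳ-≈ (six-sixths x) (x≤x+y (+0 (+0 (+0 (+0 0≤y)))))
    where
    y = 1/6 * x
    0≤y : 0# ≤ y
    0≤y = *-nonneg 0≤1/6 0≤x
    +0 : ∀ {z} → 0# ≤ z → 0# ≤ y + z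
    +0 0≤z = ≤-trans 0≤y (x≤x+y 0≤z)

  -- The conclusion comes from a + b ≤ 3 (a + b) / 6.
  cherry-arithmetic : ∀ {a b d} → a ≤ 1/6 * b + d → b ≤ 1/6 * a + d →
    d ≤ 1/6 * a + 1/6 * b → a + b ≤ 0#
  cherry-arithmetic {a} {b} {d} a≤ b≤ d≤ = x+x≤x⇒x≤0
    (≤-respʳ-≈ (trans regroup (six-sixths x)) (+-mono-≤ x≤3y x≤3y))
    where
    x = a + b
    y = 1/6 * x
    split : 1/6 * a + 1/6 * b ≈ y
    split = sym (distribˡ 1/6 a b)
    d≤y : d ≤ y
    d≤y = ≤-respʳ-≈ split d≤
    x≤3y : x ≤ y + (y + y)
    x≤3y = ≤-trans (+-mono-≤ a≤ b≤) (≤-respˡ-≈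
      (sym (trans (interchange _ _ _ _)
        (+-congʳ (trans (+-comm _ _) split))))
      (+-mono-≤ ≤-refl (+-mono-≤ d≤y d≤y)))
    regroup : (y + (y + y)) + (y + (y + y)) ≈ y + (y + (y + (y + (y + y))))
    regroup = trans (+-assoc _ _ _) (+-congˡ (+-assoc _ _ _))

-- Edges of the Scheffé graph among three distributions

module ScheffeGraphProperties {c ℓ₁ ℓ₂} {F : OrderedField c ℓ₁ ℓ₂}
         {x p} {X : Set x} (I : Integration F X p) {k} (q : Fin k → Distribution I) where
  open OrderedField F
  open FieldProperties F
  open Integration I
  open Distribution using (mass; integrable)
  open Pair
  open Digraph (scheffé-graph I q 1/6) using (_⟶_)

  private
    N : Pair k → Carrier
    N v = ∥_∥₁ I (δ I q v)

    _∙_ : Pair k → Pair k → Carrier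
    w ∙ v = ⟨_,_⟩ I (δ I q w) (S I q v)

  -- Obtained from monotonicity in both directions and antisymmetry.
  ∫-cong : ∀ {f g} → Integrable f → (∀ y → f y ≈ g y) → ∫ f ≈ ∫ g
  ∫-cong hf f≈g = antisym (∫-mono hf hg (λ y → ≤-reflexive (f≈g y)))
                          (∫-mono hg hf (λ y → ≤-reflexive (sym (f≈g y))))
    where hg = integrable-resp-≈ f≈g hf

  integrable-neg : ∀ {f} → Integrable f → Integrable (λ y → - f y)
  integrable-neg hf = integrable-resp-≈
    (λ y → trans (*-comm _ _) (x*-1≈-x _)) (integrable-* (- 1#) hf)

  ∫-neg : ∀ {f} → Integrable f → ∫ (λ y → - f y) ≈ - ∫ f
  ∫-neg hf = trans
    (sym (∫-cong (integrable-* (- 1#) hf) (λ y → trans (*-comm _ _) (x*-1≈-x _))))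
    (trans (∫-* (- 1#) hf) (trans (*-comm _ _) (x*-1≈-x _)))

  integrable-δ : ∀ v → Integrable (δ I q v)
  integrable-δ v = integrable-+ (integrable (q (lo v)))
                     (integrable-neg (integrable (q (hi v))))

  integrable-δS : ∀ w v → Integrable (λ y → δ I q w y * ⟦ S I q v y ⟧)
  integrable-δS w v = integrable-sign (integrable (q (lo v)))
                        (integrable (q (hi v))) (integrable-δ w)

  -- The absolute value is the difference times its own Scheffé sign, and `integrable-sign` covers
  -- such products.
  integrable-∣δ∣ : ∀ v → Integrable (λ y → ∣ δ I q v y ∣)
  integrable-∣δ∣ v = integrable-resp-≈
    (scheffé-attains-∣∣ (mass (q (lo v))) (mass (q (hi v)))) (integrable-δS v v)

  v∙v≈N : ∀ v → v ∙ v ≈ N v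
  v∙v≈N v = ∫-cong (integrable-δS v v)
    (scheffé-attains-∣∣ (mass (q (lo v))) (mass (q (hi v))))

  ∙≤N : ∀ w v → w ∙ v ≤ N w
  ∙≤N w v = ∫-mono (integrable-δS w v) (integrable-∣δ∣ w) (λ y → x*⟦s⟧≤∣x∣ _ (S I q v y))

  -∙≤N : ∀ w v → - (w ∙ v) ≤ N w
  -∙≤N w v = ≤-respˡ-≈ (∫-neg (integrable-δS w v))
    (∫-mono (integrable-neg (integrable-δS w v)) (integrable-∣δ∣ w)
            (λ y → -x*⟦s⟧≤∣x∣ _ (S I q v y)))

  -- The zero function is written as `0#` times `δ`, which makes it integrable with integral zero,
  -- and then compared with the absolute value.
  0≤N : ∀ v → 0# ≤ N v
  0≤N v = ≤-respˡ-≈ (trans (∫-* 0# (integrable-δ v)) (zeroˡ _))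
    (∫-mono (integrable-* 0# (integrable-δ v)) (integrable-∣δ∣ v)
            (λ y → ≤-respˡ-≈ (sym (zeroˡ _)) (0≤∣x∣ _)))

  ⟶-refl : ∀ v → v ⟶ v
  ⟶-refl v = ≤-trans (1/6*x≤x (0≤N v))
    (≤-respˡ-≈ (v∙v≈N v) (x≤∣x∣ _))

  module _ {a b c : Fin k} (a<b : a Fin.< b) (a<c : a Fin.< c) (b<c : b Fin.< c) where
    private
      u v w : Pair k
      u = pair a b a<b
      v = pair a c a<c
      w = pair b c b<c

    δ-split : ∀ y → δ I q v y ≈ δ I q w y + δ I q u y
    δ-split y = sym (trans (+-comm _ _) (trans (+-assoc _ _ _) (+-congˡ
      (trans (sym (+-assoc _ _ _)) (trans (+-congʳ (-‿inverseˡ _)) (+-identityˡ _))))))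

    ∙-split : ∀ z → v ∙ z ≈ w ∙ z + u ∙ z
    ∙-split z = trans
      (∫-cong (integrable-δS v z)
              (λ y → trans (*-congʳ (δ-split y)) (distribʳ _ _ _)))
      (∫-+ (integrable-δS w z) (integrable-δS u z))

    ↛⇒≤ : ∀ {x y} → ¬ (x ≤ y) → y ≤ x
    ↛⇒≤ {x} {y} x≰y with total x y
    ... | inj₁ x≤y = contradiction x≤y x≰y
    ... | inj₂ y≤x = y≤x

    move : ∀ {x y z} → x ≈ y + z → y ≈ - z + x
    move {x} {y} {z} eq = sym (trans (+-congˡ (trans eq (+-comm y z)))
      (trans (sym (+-assoc _ _ _)) (trans (+-congʳ (-‿inverseˡ z)) (+-identityˡ y))))

    -- By `∙-split`, `N u` is v∙u - w∙u, `N v` is w∙v + u∙v, and `N w` is v∙w - u∙w. A failed edge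
    -- makes the corresponding term at most a sixth of a norm; the terms w∙u and w∙v are bounded by
    -- `N w`. If w → v failed as well, `cherry-arithmetic` would make the norm of `v` vanish, and
    -- then u → v would hold trivially.
    cherry : ¬ u ⟶ v → ¬ v ⟶ u → ¬ w ⟶ u → w ⟶ v
    cherry u↛v v↛u w↛u with 1/6 * N v ≤? ∣ v ∙ w ∣
    ... | yes w→v = w→v
    ... | no w↛v  = contradiction (≤-trans 1/6*Nv≤0 (0≤∣x∣ _)) u↛v
      where
      Nu≤ : N u ≤ 1/6 * N v + N w
      Nu≤ = ≤-respˡ-≈ (sym (trans (sym (v∙v≈N u)) (trans (move (trans (∙-split u) (+-comm _ _)))
                        (+-comm _ _))))
        (+-mono-≤ (≤-trans (x≤∣x∣ _) (↛⇒≤ u↛v)) (-∙≤N w u))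

      Nv≤ : N v ≤ 1/6 * N u + N w
      Nv≤ = ≤-respˡ-≈ (sym (trans (sym (v∙v≈N v)) (trans (∙-split v) (+-comm _ _))))
        (+-mono-≤ (≤-trans (x≤∣x∣ _) (↛⇒≤ v↛u)) (∙≤N w v))

      Nw≤ : N w ≤ 1/6 * N u + 1/6 * N v
      Nw≤ = ≤-respˡ-≈ (sym (trans (sym (v∙v≈N w)) (move (∙-split w))))
        (+-mono-≤ (≤-trans (-x≤∣x∣ _) (↛⇒≤ w↛u)) (≤-trans (x≤∣x∣ _) (↛⇒≤ w↛v)))

      1/6*Nv≤0 : 1/6 * N v ≤ 0#
      1/6*Nv≤0 = ≤-trans (1/6*x≤x (0≤N v)) (≤-trans (x≤x+y (0≤N u))
        (≤-respˡ-≈ (+-comm _ _) (cherry-arithmetic Nu≤ Nv≤ Nw≤)))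

open import Data.Bool.Base using (Bool; true; false; not; T; _∨_)
open import Data.Bool.Properties using () renaming (_≟_ to _≟ᵇ_)
open import Data.Fin.Properties using (toℕ<n; toℕ-fromℕ<; toℕ-injective)
open import Data.Integer.Base as ℤ using (-[1+_])
import Data.Integer.Properties as ℤₚ
open import Data.List.Base
  using (List; []; _∷_; _++_; [_]; length; map; filterᵇ; cartesianProductWith)
open import Data.List.Membership.Propositional using (_∈_; find; lose)
open import Data.List.Membership.Propositional.Properties
  using (∈-filter⁺; ∈-filter⁻; ∈-map⁺; ∈-map⁻; ∈-++⁺ˡ; ∈-++⁺ʳ; ∈-++⁻; ∈-cartesianProductWith⁺;
  ∈-cartesianProductWith⁻)
import Data.List.Membership.DecPropositional as DecMembership
open import Data.List.Properties
  using (length-++; length-map; length-filter; ++-assoc; ++-identityʳ; map-++)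
open import Data.List.Relation.Binary.Disjoint.Propositional using (Disjoint)
open import Data.List.Relation.Unary.All as All using (All; []; _∷_)
open import Data.List.Relation.Unary.All.Properties using (¬Any⇒All¬)
open import Data.List.Relation.Unary.Any as Any using (Any; here; there)
open import Data.List.Relation.Unary.Unique.Propositional using (Unique; []; _∷_)
import Data.List.Relation.Unary.Unique.Propositional.Properties as Unique
import Data.List.Relation.Unary.Unique.DecPropositional as DecUnique
open import Data.Nat.Base
open import Data.Nat.ListAction using (sum)
open import Data.Nat.Properties
open import Data.Nat.Tactic.RingSolver using (solve-∀)
open import Data.Product.Properties using () renaming (≡-dec to ×-≡-dec)
open import Data.Rational.Unnormalised.Base as ℚᵘ
  using (ℚᵘ; mkℚᵘ; 0ℚᵘ; 1ℚᵘ; ½; *≤*; *≡*) renaming (_≤_ to _≤ℚ_; _≃_ to _≃ℚ_)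
import Data.Rational.Unnormalised.Properties as ℚₚ
open import Data.Unit.Base using (⊤; tt)
open import Function.Base using (_∘_)
open import Relation.Binary.Core using (Rel)
open import Relation.Binary.Definitions using (DecidableEquality; Decidable; tri<; tri≈; tri>)
open import Relation.Binary.PropositionalEquality hiding ([_])
open import Relation.Nullary.Decidable using (map′; _×-dec_; _⊎-dec_)
open import Relation.Nullary.Decidable.Core using (T?)
open import Relation.Nullary.Reflects using (Reflects; ofʸ; ofⁿ)

-- A small imperative language and its compilation

infixr 5 _⨾_

-- Registers are separate from the heap, which only fetch (x := heap[y]) and
-- put (heap[y] := z) access; repeat reads its count once.
data Cmd : Set where
  skip   : Cmd
  set    : (x : Reg) (n : ℕ)  → Cmd
  mov    : (x y : Reg)        → Cmd
  plus   : (x y z : Reg)      → Cmd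
  minus  : (x y z : Reg)      → Cmd
  fetch  : (x y : Reg)        → Cmd
  put    : (y z : Reg)        → Cmd
  ask    : (x i i′ j j′ : Reg) → Cmd
  say    : (i i′ : Reg)       → Cmd
  _⨾_    : (P Q : Cmd)        → Cmd
  cond   : (x : Reg) (P Q : Cmd) → Cmd
  repeat : (x : Reg) (P : Cmd)   → Cmd

record State : Set where
  constructor state
  field
    reg   : Memory
    heap  : Memory
    out   : List (ℕ × ℕ)
    clock : ℕ

open State public

tick : ℕ → State → State
tick n (state ρ h w t) = state ρ h w (n + t)

-- A function instead of a `with`, so that a branch taken by the machine can be projected and
-- rewritten by lemmas such as `unless0-map`.
unless0 : ∀ {a} {A : Set a} → ℕ → A → A → A
unless0 (suc _) p q = p
unless0 zero    p q = q

loop : ∀ {a} {A : Set a} → ℕ → (A → A) → A → A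
loop zero    f s = s
loop (suc n) f s = loop n f (f s)

-- clock counts the steps of the compiled program.
exec : Oracle → Cmd → State → State
exec o skip            s = s
exec o (set x n)       (state ρ h w t) = state (ρ [ x ≔ n ]) h w (1 + t)
exec o (mov x y)       (state ρ h w t) = state (ρ [ x ≔ ρ y ]) h w (1 + t)
exec o (plus x y z)    (state ρ h w t) = state (ρ [ x ≔ ρ y + ρ z ]) h w (1 + t)
exec o (minus x y z)   (state ρ h w t) = state (ρ [ x ≔ ρ y ∸ ρ z ]) h w (1 + t)
exec o (fetch x y)     (state ρ h w t) = state (ρ [ x ≔ h (ρ y) ]) h w (5 + t)
exec o (put y z)       (state ρ h w t) = state ρ (h [ ρ y ≔ ρ z ]) w (5 + t)
exec o (ask x i i′ j j′) (state ρ h w t) =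
  state (ρ [ x ≔ bit (o (ρ i) (ρ i′) (ρ j) (ρ j′)) ]) h w (1 + t)
exec o (say i i′)      (state ρ h w t) = state ρ h (w ++ [ ρ i , ρ i′ ]) (1 + t)
exec o (P ⨾ Q)         s = exec o Q (exec o P s)
exec o (cond x P Q)    s = unless0 (reg s x) (exec o P (tick 1 s)) (exec o Q (tick 1 s))
-- Copying the count and the final failing test cost 1 each; every iteration costs 3 for the test,
-- the constant 1 and the decrement.
exec o (repeat x P)    s = tick 1 (loop (reg s x) (λ s′ → exec o P (tick 3 s′)) (tick 1 s))

-- Registers, loop counters (by nesting depth) and heap cells are stored at the
-- addresses 3x, 3d + 1 and 3a + 2; a command at depth d may also use the
-- counters d and d + 1 as scratch cells.
varAt ctrAt heapAt : ℕ → ℕ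
varAt zero    = 0
varAt (suc x) = 3 + varAt x
ctrAt d  = 1 + varAt d
heapAt a = 2 + varAt a

compile : ℕ → Cmd → Program
compile d skip              = []
compile d (set x n)         = [ const (varAt x) n ]
compile d (mov x y)         = [ copy (varAt x) (varAt y) ]
compile d (plus x y z)      = [ add (varAt x) (varAt y) (varAt z) ]
compile d (minus x y z)     = [ sub (varAt x) (varAt y) (varAt z) ]
-- The heap address 3 y + 2 is built in the counter cell `d` by additions.
compile d (fetch x y)       = add (ctrAt d) (varAt y) (varAt y)
                            ∷ add (ctrAt d) (ctrAt d) (varAt y)
                            ∷ const (ctrAt (suc d)) 2
                            ∷ add (ctrAt d) (ctrAt d) (ctrAt (suc d))
                            ∷ load (varAt x) (ctrAt d) ∷ []
compile d (put y z)         = add (ctrAt d) (varAt y) (varAt y)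
                            ∷ add (ctrAt d) (ctrAt d) (varAt y)
                            ∷ const (ctrAt (suc d)) 2
                            ∷ add (ctrAt d) (ctrAt d) (ctrAt (suc d))
                            ∷ store (ctrAt d) (varAt z) ∷ []
compile d (ask x i i′ j j′) =
  [ query (varAt x) (varAt i) (varAt i′) (varAt j) (varAt j′) ]
compile d (say i i′)        = [ emit (varAt i) (varAt i′) ]
compile d (P ⨾ Q)           = compile d P ++ compile d Q
compile d (cond x P Q)      = [ ifnz (varAt x) (compile d P) (compile d Q) ]
-- The body is compiled one level deeper and so leaves counter `d` intact. Counter `suc d` is free
-- again after the body and holds the decrement.
compile d (repeat x P)      = copy (ctrAt d) (varAt x) ∷ [ while (ctrAt d)
  (compile (suc d) P ++ const (ctrAt (suc d)) 1
                      ∷ sub (ctrAt d) (ctrAt d) (ctrAt (suc d)) ∷ []) ]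

-- Memory layout of compiled programs

≡ᵇ-refl : ∀ n → (n ≡ᵇ n) ≡ true
≡ᵇ-refl zero    = refl
≡ᵇ-refl (suc n) = ≡ᵇ-refl n

≢⇒≡ᵇ-false : ∀ {m n} → m ≢ n → (m ≡ᵇ n) ≡ false
≢⇒≡ᵇ-false {m} {n} m≢n with m ≡ᵇ n in eq
... | false = refl
... | true with () ← m≢n (≡ᵇ⇒≡ m n (subst T (sym eq) _))

update-same : ∀ M a v → (M [ a ≔ v ]) a ≡ v
update-same M a v rewrite ≡ᵇ-refl a = refl

update-other : ∀ M a v b → (b ≡ᵇ a) ≡ false → (M [ a ≔ v ]) b ≡ M b
update-other M a v b eq rewrite eq = refl

varAt-≡ᵇ : ∀ x y → (varAt x ≡ᵇ varAt y) ≡ (x ≡ᵇ y)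
varAt-≡ᵇ zero    zero    = refl
varAt-≡ᵇ zero    (suc y) = refl
varAt-≡ᵇ (suc x) zero    = refl
varAt-≡ᵇ (suc x) (suc y) = varAt-≡ᵇ x y

varAt≢ctrAt : ∀ x y → (varAt x ≡ᵇ ctrAt y) ≡ false
varAt≢ctrAt zero    y       = refl
varAt≢ctrAt (suc x) zero    = refl
varAt≢ctrAt (suc x) (suc y) = varAt≢ctrAt x y

varAt≢heapAt : ∀ x y → (varAt x ≡ᵇ heapAt y) ≡ false
varAt≢heapAt zero    y       = refl
varAt≢heapAt (suc x) zero    = refl
varAt≢heapAt (suc x) (suc y) = varAt≢heapAt x y

ctrAt≢varAt : ∀ x y → (ctrAt x ≡ᵇ varAt y) ≡ false
ctrAt≢varAt x       zero    = refl
ctrAt≢varAt zero    (suc y) = refl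
ctrAt≢varAt (suc x) (suc y) = ctrAt≢varAt x y

ctrAt≢heapAt : ∀ x y → (ctrAt x ≡ᵇ heapAt y) ≡ false
ctrAt≢heapAt zero    zero    = refl
ctrAt≢heapAt zero    (suc y) = refl
ctrAt≢heapAt (suc x) zero    = refl
ctrAt≢heapAt (suc x) (suc y) = ctrAt≢heapAt x y

heapAt≢varAt : ∀ x y → (heapAt x ≡ᵇ varAt y) ≡ false
heapAt≢varAt x       zero    = refl
heapAt≢varAt zero    (suc y) = refl
heapAt≢varAt (suc x) (suc y) = heapAt≢varAt x y

heapAt≢ctrAt : ∀ x y → (heapAt x ≡ᵇ ctrAt y) ≡ false
heapAt≢ctrAt zero    zero    = refl
heapAt≢ctrAt zero    (suc y) = refl
heapAt≢ctrAt (suc x) zero    = refl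
heapAt≢ctrAt (suc x) (suc y) = heapAt≢ctrAt x y

ctrAt≢ctrAt : ∀ {d e} → e < d → (ctrAt e ≡ᵇ ctrAt d) ≡ false
ctrAt≢ctrAt {d} {e} e<d = trans (varAt-≡ᵇ e d) (≢⇒≡ᵇ-false (<⇒≢ e<d))

heapAt-formula : ∀ a → ((a + a) + a) + 2 ≡ heapAt a
heapAt-formula zero    = refl
heapAt-formula (suc a) = trans (shift a) (cong (3 +_) (heapAt-formula a))
  where
  shift : ∀ a → ((suc a + suc a) + suc a) + 2 ≡ 3 + (((a + a) + a) + 2)
  shift = solve-∀

-- Counter cells are left unconstrained, so compiled code may use them as scratch space.
record Represents (M : Memory) (ρ h : Memory) : Set where
  constructor represents
  field
    vars  : ∀ x → M (varAt x) ≡ ρ x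
    cells : ∀ a → M (heapAt a) ≡ h a

open Represents

represents-var : ∀ {M ρ h} x {v v′} → v ≡ v′ → Represents M ρ h →
                 Represents (M [ varAt x ≔ v ]) (ρ [ x ≔ v′ ]) h
represents-var {M} {ρ} x {v} refl r = represents vs
  (λ a → trans (update-other M (varAt x) v (heapAt a) (heapAt≢varAt a x)) (cells r a))
  where
  vs : ∀ y → (M [ varAt x ≔ v ]) (varAt y) ≡ (ρ [ x ≔ v ]) y
  vs y rewrite varAt-≡ᵇ y x | vars r y = refl

represents-ctr : ∀ {M ρ h} d {v} → Represents M ρ h → Represents (M [ ctrAt d ≔ v ]) ρ h
represents-ctr {M} d {v} r = represents
  (λ y → trans (update-other M (ctrAt d) v (varAt y) (varAt≢ctrAt y d)) (vars r y))
  (λ a → trans (update-other M (ctrAt d) v (heapAt a) (heapAt≢ctrAt a d)) (cells r a))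

represents-cell : ∀ {M ρ h} a {c v v′} → c ≡ heapAt a → v ≡ v′ → Represents M ρ h →
                  Represents (M [ c ≔ v ]) ρ (h [ a ≔ v′ ])
represents-cell {M} {h = h} a {v = v} refl refl r = represents
  (λ y → trans (update-other M (heapAt a) v (varAt y) (varAt≢heapAt y a)) (vars r y)) cs
  where
  cs : ∀ b → (M [ heapAt a ≔ v ]) (heapAt b) ≡ (h [ a ≔ v ]) b
  cs b rewrite varAt-≡ᵇ b a | cells r b = refl

-- Simulation of commands by compiled programs

module Execution (o : Oracle) where

  infix 4 _⟶[_]_

  -- A run independent of the coins: `next` requires the same successor for both outcomes.
  data _⟶[_]_ : Config → ℕ → Config → Set where
    done : ∀ {C} → C ⟶[ 0 ] C
    next : ∀ {C C′ C″ n} → (∀ b → step o b C ≡ C′) → C′ ⟶[ n ] C″ → C ⟶[ suc n ] C″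

  infixr 5 _▷_

  _▷_ : ∀ {C C′ C″ m n} → C ⟶[ m ] C′ → C′ ⟶[ n ] C″ → C ⟶[ m + n ] C″
  done     ▷ s = s
  next e r ▷ s = next e (r ▷ s)

  run-halted : ∀ coins C → Halted C → run o coins C ≡ C
  run-halted []       C h = refl
  run-halted (b ∷ cs) (config [] M w) refl = run-halted cs (config [] M w) refl

  -- A halted configuration is fixed by further steps, so a coin sequence of any length that reaches
  -- a halt ends in the same place.
  run-unique : ∀ {C C′ n} → C ⟶[ n ] C′ → Halted C′ →
               ∀ coins → Halted (run o coins C) → run o coins C ≡ C′
  run-unique done         h′ coins    h = run-halted coins _ h′
  run-unique (next e r)   h′ (b ∷ cs) h rewrite e b = run-unique r h′ cs h
  run-unique {config [] M w} (next e r) h′ [] h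
    with refl ← e true = run-unique r h′ [] h

  if-true : ∀ {x P Q R M w n} → M x ≡ suc n →
            ∀ b → step o b (config (ifnz x P Q ∷ R) M w) ≡ config (P ++ R) M w
  if-true eq b rewrite eq = refl

  if-false : ∀ {x P Q R M w} → M x ≡ zero →
             ∀ b → step o b (config (ifnz x P Q ∷ R) M w) ≡ config (Q ++ R) M w
  if-false eq b rewrite eq = refl

  while-true : ∀ {x P R M w n} → M x ≡ suc n →
    ∀ b → step o b (config (while x P ∷ R) M w) ≡ config (P ++ while x P ∷ R) M w
  while-true eq b rewrite eq = refl

  while-false : ∀ {x P R M w} → M x ≡ zero →
    ∀ b → step o b (config (while x P ∷ R) M w) ≡ config R M w
  while-false eq b rewrite eq = refl

  -- Carrying the pending code `rest` makes simulations composable. The field `kept` protects the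
  -- counters of all enclosing loops.
  record Simulation (d : ℕ) (P rest : Program) (M : Memory) (s s′ : State) : Set where
    constructor simulation
    field
      {steps}  : ℕ
      {memory′} : Memory
      reaches  : config (P ++ rest) M (out s) ⟶[ steps ] config rest memory′ (out s′)
      timed    : clock s′ ≡ steps + clock s
      related  : Represents memory′ (reg s′) (heap s′)
      kept     : ∀ e → e < d → memory′ (ctrAt e) ≡ M (ctrAt e)

  keep-var : ∀ M x v {d} → ∀ e → e < d → (M [ varAt x ≔ v ]) (ctrAt e) ≡ M (ctrAt e)
  keep-var M x v e _ = update-other M (varAt x) v (ctrAt e) (ctrAt≢varAt e x)

  module Address (d y : ℕ) {M ρ h} (r : Represents M ρ h) where
    t = ctrAt d
    M₁ M₂ M₃ M₄ : Memory
    M₁ = M  [ t ≔ M (varAt y) + M (varAt y) ]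
    M₂ = M₁ [ t ≔ M₁ t + M₁ (varAt y) ]
    M₃ = M₂ [ ctrAt (suc d) ≔ 2 ]
    M₄ = M₃ [ t ≔ M₃ t + M₃ (ctrAt (suc d)) ]

    address : M₄ t ≡ heapAt (ρ y)
    address = begin
      M₄ t                            ≡⟨ update-same M₃ t _ ⟩
      M₃ t + M₃ (ctrAt (suc d))       ≡⟨ cong₂ _+_ (update-other M₂ (ctrAt (suc d)) 2 t (ctrAt≢ctrAt (n<1+n d)))
                                                   (update-same M₂ (ctrAt (suc d)) 2) ⟩
      M₂ t + 2                        ≡⟨ cong (_+ 2) (update-same M₁ t _) ⟩
      (M₁ t + M₁ (varAt y)) + 2       ≡⟨ cong₂ (λ a b → (a + b) + 2) (update-same M t _)
                                           (vars (represents-ctr {M} d r) y) ⟩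
      ((M (varAt y) + M (varAt y)) + ρ y) + 2
                                      ≡⟨ cong (λ a → ((a + a) + ρ y) + 2) (vars r y) ⟩
      ((ρ y + ρ y) + ρ y) + 2         ≡⟨ heapAt-formula (ρ y) ⟩
      heapAt (ρ y)                    ∎
      where open ≡-Reasoning

    represents₄ : Represents M₄ ρ h
    represents₄ = represents-ctr {M₃} d (represents-ctr {M₂} (suc d) (represents-ctr {M₁} d (represents-ctr {M} d r)))

    kept₄ : ∀ e → e < d → M₄ (ctrAt e) ≡ M (ctrAt e)
    kept₄ e e<d = trans (update-other M₃ t _ (ctrAt e) e≢d) (trans
      (update-other M₂ (ctrAt (suc d)) 2 (ctrAt e) (ctrAt≢ctrAt (m≤n⇒m≤1+n e<d)))
      (trans (update-other M₁ t _ (ctrAt e) e≢d) (update-other M t _ (ctrAt e) e≢d)))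
      where
      e≢d : (ctrAt e ≡ᵇ t) ≡ false
      e≢d = ctrAt≢ctrAt e<d

  simulate : ∀ d P rest {M} s → Represents M (reg s) (heap s) →
             Simulation d (compile d P) rest M s (exec o P s)

  -- Induction on the remaining count. It survives in counter `d` because the body, compiled at
  -- depth `suc d`, keeps every counter below that depth.
  simulate-loop : ∀ d P rest {M} n s → M (ctrAt d) ≡ n → Represents M (reg s) (heap s) →
    Simulation d [ while (ctrAt d) (compile (suc d) P ++ const (ctrAt (suc d)) 1
                      ∷ sub (ctrAt d) (ctrAt d) (ctrAt (suc d)) ∷ []) ] rest M
      s (tick 1 (loop n (λ s′ → exec o P (tick 3 s′)) s))

  simulate d skip rest s r = simulation done refl r (λ _ _ → refl)
  simulate d (set x n) rest {M} s r =
    simulation (next (λ _ → refl) done) refl (represents-var {M} x refl r) (keep-var M x _)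
  simulate d (mov x y) rest {M} s r =
    simulation (next (λ _ → refl) done) refl (represents-var {M} x (vars r y) r) (keep-var M x _)
  simulate d (plus x y z) rest {M} s r =
    simulation (next (λ _ → refl) done) refl
      (represents-var {M} x (cong₂ _+_ (vars r y) (vars r z)) r) (keep-var M x _)
  simulate d (minus x y z) rest {M} s r =
    simulation (next (λ _ → refl) done) refl
      (represents-var {M} x (cong₂ _∸_ (vars r y) (vars r z)) r) (keep-var M x _)
  simulate d (fetch x y) rest {M} s r = simulation
    (next (λ _ → refl) (next (λ _ → refl) (next (λ _ → refl) (next (λ _ → refl)
      (next (λ _ → refl) done))))) refl
    (represents-var {M₄} x (trans (cong M₄ address) (cells represents₄ _)) represents₄)
    (λ e e<d → trans (keep-var M₄ x _ e e<d) (kept₄ e e<d))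
    where open Address d y r
  simulate d (put y z) rest {M} s r = simulation
    (next (λ _ → refl) (next (λ _ → refl) (next (λ _ → refl) (next (λ _ → refl)
      (next (λ _ → refl) done))))) refl
    (represents-cell {M₄} (reg s y) address (vars represents₄ z) represents₄)
    (λ e e<d → trans (update-other M₄ (M₄ t) _ (ctrAt e)
        (trans (cong (ctrAt e ≡ᵇ_) address) (ctrAt≢heapAt e (reg s y))))
                     (kept₄ e e<d))
    where open Address d y r
  simulate d (ask x i i′ j j′) rest {M} s r =
    simulation (next (λ _ → refl) done) refl (represents-var {M} x eq r) (keep-var M x _)
    where
    eq = cong bit (trans (cong₂ (λ a b → o a b _ _) (vars r i) (vars r i′))
                         (cong₂ (o (reg s i) (reg s i′)) (vars r j) (vars r j′)))
  simulate d (say i i′) rest s r = simulation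
    (next (λ _ → cong (config rest _) (cong₂ (λ a b → out s ++ [ a , b ]) (vars r i) (vars r i′))) done)
    refl r (λ _ _ → refl)
  simulate d (P ⨾ Q) rest {M} s r
    with simulate d P (compile d Q ++ rest) s r
  ... | simulation {m} reaches₁ timed₁ related₁ kept₁
    with simulate d Q rest (exec o P s) related₁
  ... | simulation {n} reaches₂ timed₂ related₂ kept₂ = simulation
    (subst (λ R → config R M (out s) ⟶[ m + n ] _)
      (sym (++-assoc (compile d P) (compile d Q) rest)) (reaches₁ ▷ reaches₂))
    (trans timed₂ (trans (cong (n +_) timed₁)
      (trans (sym (+-assoc n m _)) (cong (_+ clock s) (+-comm n m)))))
    related₂
    (λ e e<d → trans (kept₂ e e<d) (kept₁ e e<d))
  simulate d (cond x P Q) rest s r with reg s x in eq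
  ... | suc _ with simulate d P rest (tick 1 s) r
  ...   | simulation {n} reaches timed related kept = simulation
    (next (if-true {Q = compile d Q} (trans (vars r x) eq)) reaches)
    (trans timed (+-suc n _)) related kept
  simulate d (cond x P Q) rest s r | zero with simulate d Q rest (tick 1 s) r
  ...   | simulation {n} reaches timed related kept = simulation
    (next (if-false {P = compile d P} (trans (vars r x) eq)) reaches)
    (trans timed (+-suc n _)) related kept
  simulate d (repeat x P) rest {M} s r
    with simulate-loop d P rest (reg s x) (tick 1 s)
           (trans (update-same M (ctrAt d) (M (varAt x))) (vars r x)) (represents-ctr {M} d r)
  ... | simulation {n} reaches timed related kept = simulation
    (next (λ _ → refl) reaches)
    (trans timed (+-suc n _))
    related
    (λ e e<d → trans (kept e e<d) (update-other M (ctrAt d) _ (ctrAt e) (ctrAt≢ctrAt e<d)))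

  simulate-loop d P rest zero s eq r =
    simulation (next (while-false eq) done) refl r (λ _ _ → refl)
  simulate-loop d P rest {M} (suc n) s eq r
    with simulate (suc d) P _ (tick 3 s) r
  ... | simulation {m₁} {M₁} reaches₁ timed₁ related₁ kept₁
    with simulate-loop d P rest n (exec o P (tick 3 s)) decremented
           (represents-ctr {M₂} d (represents-ctr {M₁} (suc d) related₁))
    where
    one = ctrAt (suc d)
    M₂ = M₁ [ one ≔ 1 ]
    decremented : (M₂ [ ctrAt d ≔ M₂ (ctrAt d) ∸ M₂ one ]) (ctrAt d) ≡ n
    decremented = trans (update-same M₂ (ctrAt d) _) (cong₂ _∸_
      (trans (update-other M₁ one 1 (ctrAt d) (ctrAt≢ctrAt (n<1+n d))) (trans (kept₁ d (n<1+n d)) eq))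
      (update-same M₁ one 1))
  ... | simulation {m₂} reaches₂ timed₂ related₂ kept₂ = simulation
    (next (while-true eq)
      (subst (λ R → config R M (out s) ⟶[ m₁ + (2 + m₂) ] _)
        (sym (++-assoc (compile (suc d) P) _ _))
        (reaches₁ ▷ next (λ _ → refl) (next (λ _ → refl) reaches₂))))
    (trans timed₂ (trans (cong (m₂ +_) timed₁) (arith m₁ m₂ (clock s))))
    related₂
    (λ e e<d → trans (kept₂ e e<d)
      (trans (update-other (M₁ [ ctrAt (suc d) ≔ 1 ]) (ctrAt d) _ (ctrAt e) (ctrAt≢ctrAt e<d))
        (trans (update-other M₁ (ctrAt (suc d)) 1 (ctrAt e) (ctrAt≢ctrAt (m≤n⇒m≤1+n e<d)))
          (kept₁ e (m≤n⇒m≤1+n e<d)))))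
    where
    arith : ∀ a b c → b + (a + (3 + c)) ≡ (1 + (a + (2 + b))) + c
    arith = solve-∀

-- Expected time of coin-free runs

½*[p+p]≃p : ∀ p → ½ ℚᵘ.* (p ℚᵘ.+ p) ≃ℚ p
½*[p+p]≃p p = ℚₚ.≃-trans (ℚₚ.*-distribˡ-+ ½ p p)
  (ℚₚ.≃-trans (ℚₚ.≃-sym (ℚₚ.*-distribʳ-+ p ½ ½))
    (ℚₚ.≃-trans (ℚₚ.*-congʳ {p} {½ ℚᵘ.+ ½} {1ℚᵘ} (*≡* refl)) (ℚₚ.*-identityˡ p)))

fromNat-suc : ∀ n → 1ℚᵘ ℚᵘ.+ fromNat n ≃ℚ fromNat (suc n)
fromNat-suc n rewrite ℤₚ.*-identityʳ (ℤ.+ n) = ℚₚ.≃-refl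

0≤fromNat : ∀ n → 0ℚᵘ ≤ℚ fromNat n
0≤fromNat n = *≤* (subst₂ ℤ._≤_ (sym (ℤₚ.*-zeroˡ (ℤ.+ 1))) (sym (ℤₚ.*-identityʳ (ℤ.+ n))) (ℤ.+≤+ z≤n))

truncatedTime≥0 : ∀ o N C → 0ℚᵘ ≤ℚ truncatedTime o N C
truncatedTime≥0 o zero    C = ℚₚ.≤-refl
truncatedTime≥0 o (suc N) (config [] _ _) = ℚₚ.≤-refl
truncatedTime≥0 o (suc N) C@(config (_ ∷ _) _ _) =
  ℚₚ.+-mono-≤ {0ℚᵘ} {1ℚᵘ} {0ℚᵘ} (*≤* (ℤ.+≤+ z≤n))
    (ℚₚ.≤-trans {0ℚᵘ} {½ ℚᵘ.* 0ℚᵘ} (*≤* (ℤ.+≤+ z≤n)) (ℚₚ.*-monoʳ-≤-nonNeg ½ (ℚₚ.+-mono-≤ {0ℚᵘ} {_} {0ℚᵘ}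
      (truncatedTime≥0 o N (step o true C)) (truncatedTime≥0 o N (step o false C)))))

module _ (o : Oracle) where
  open Execution o

  -- Both coin outcomes lead to the same configuration, so the average is over two equal values and
  -- every step adds exactly 1.
  truncatedTime≤steps : ∀ {C C′ n} → C ⟶[ n ] C′ → Halted C′ →
                        ∀ N → truncatedTime o N C ≤ℚ fromNat n
  truncatedTime≤steps {n = n} r h zero = 0≤fromNat n
  truncatedTime≤steps {config [] _ _} {n = n} r h (suc N) = 0≤fromNat n
  truncatedTime≤steps {config (_ ∷ _) _ _} done () (suc N)
  truncatedTime≤steps {C@(config (_ ∷ _) _ _)} (next {n = n} e r) h (suc N)
    rewrite e true | e false = ℚₚ.≤-trans
      (ℚₚ.+-mono-≤ {1ℚᵘ} ℚₚ.≤-refl (ℚₚ.≤-trans (ℚₚ.≤-reflexive (½*[p+p]≃p _))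
                                      (truncatedTime≤steps r h N)))
      (ℚₚ.≤-reflexive (fromNat-suc n))

-- `L` is an integer lower bound for log₂ k. For y = r/d the hypotheses give r ≤ L a d, and then 2^r
-- ≤ (2^L)^(a d) ≤ k^(a d).
≤-·log₂ : ∀ {y} a L {k m} → 0ℚᵘ ≤ℚ y → y ≤ℚ fromNat m → m ≤ a * L → 2 ^ L ≤ k →
          y ≤ a ·log₂ k
-- The encoded bound reads the absolute value of the numerator, so a negative `y` has to be
-- excluded.
≤-·log₂ {mkℚᵘ (-[1+ _ ]) _} a L (*≤* ()) _ _ _
≤-·log₂ {mkℚᵘ (ℤ.+ r) d-1} a L {k} {m} _ (*≤* y≤m) m≤aL 2^L≤k = begin
  2 ^ r              ≤⟨ ^-monoʳ-≤ 2 r≤ ⟩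
  2 ^ (L * (a * d))  ≡⟨ sym (^-*-assoc 2 L (a * d)) ⟩
  (2 ^ L) ^ (a * d)  ≤⟨ ^-monoˡ-≤ (a * d) 2^L≤k ⟩
  k ^ (a * d)        ∎
  where
  open ≤-Reasoning
  d = suc d-1
  r≤ : r ≤ L * (a * d)
  r≤ = begin
    r            ≤⟨ ℤₚ.drop‿+≤+ (subst₂ ℤ._≤_ (ℤₚ.*-identityʳ (ℤ.+ r)) (sym (ℤₚ.pos-* m d)) y≤m) ⟩
    m * d        ≤⟨ *-monoˡ-≤ d m≤aL ⟩
    (a * L) * d  ≡⟨ cong (_* d) (*-comm a L) ⟩
    (L * a) * d  ≡⟨ *-assoc L a d ⟩
    L * (a * d)  ∎

fromNat-* : ∀ m n → fromNat m ℚᵘ.* fromNat n ≤ℚ fromNat (m * n)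
fromNat-* m n = ℚₚ.≤-reflexive (*≡* (cong (ℤ._* ℤ.+ 1) (sym (ℤₚ.pos-* m n))))

≤-·√log₂ : ∀ {y} c k e L {n l} → 0ℚᵘ ≤ℚ y → y ≤ℚ fromNat n →
           n * n ≤ c ^ 2 * k ^ e * L → 2 ^ L ≤ l → y ≤ c ·√[ k ^ e ·log₂ l ]
≤-·√log₂ {y} c k e L {n} 0≤y y≤n nn≤ 2^L≤l = ≤-·log₂ (c ^ 2 * k ^ e) L
  (ℚₚ.≤-trans (ℚₚ.≤-reflexive (ℚₚ.≃-sym (ℚₚ.*-zeroˡ 0ℚᵘ)))
    (ℚₚ.*-mono-≤-nonNeg {0ℚᵘ} {y} {0ℚᵘ} 0≤y 0≤y))
  (ℚₚ.≤-trans (ℚₚ.*-mono-≤-nonNeg {{nn}} {{nn}} y≤n y≤n) (fromNat-* n n))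
  nn≤ 2^L≤l
  where nn = ℚᵘ.nonNegative 0≤y

inputs : ℕ → Memory
inputs k zero    = k
inputs k (suc _) = 0

initial : ℕ → State
initial k = state (inputs k) (λ _ → 0) [] 0

module _ (o : Oracle) (P : Cmd) (k : ℕ) where
  open Execution o

  private final = exec o P (initial k)

  compile-correct : ∃[ M ] start (compile 0 P) k ⟶[ clock final ] config [] M (out final)
  compile-correct
    with simulate 0 P [] {memory (start (compile 0 P) k)} (initial k)
           (represents (λ { zero → refl ; (suc _) → refl }) (λ { zero → refl ; (suc _) → refl }))
  ... | simulation {n} {M} reaches timed _ _ = M ,
    subst₂ (λ R m → config R (memory (start (compile 0 P) k)) [] ⟶[ m ] config [] M (out final))
      (++-identityʳ (compile 0 P)) (sym (trans timed (+-identityʳ n))) reaches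

-- Greedy domination of semicomplete digraphs

module Greedy (R : ℕ → ℕ → Bool) where

  outdeg indeg : ℕ → List ℕ → ℕ
  outdeg u []       = 0
  outdeg u (v ∷ vs) = bit (R u v) + outdeg u vs
  indeg v []        = 0
  indeg v (u ∷ us)  = bit (R u v) + indeg v us

  arcs : List ℕ → List ℕ → ℕ
  arcs us vs = sum (map (λ u → outdeg u vs) us)

  Semicomplete : List ℕ → Set
  Semicomplete xs = ∀ {u v} → u ∈ xs → v ∈ xs → R u v ≡ true ⊎ R v u ≡ true

  Popular : List ℕ → ℕ → Set
  Popular xs u = length xs ≤ outdeg u xs + outdeg u xs

  -- Keeps the last popular vertex of the scan, or `u` if there is none. Popularity is all that
  -- halving needs, so the machine stores no degree and looks for no maximum.
  choose : List ℕ → ℕ → List ℕ → ℕ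
  choose xs u []       = u
  choose xs u (j ∷ js) =
    choose xs (unless0 (length xs ∸ (outdeg j xs + outdeg j xs)) u j) js

  prune : ℕ → List ℕ → List ℕ
  prune u = filterᵇ (λ v → not (R u v))

  dominators : ℕ → List ℕ → List ℕ
  dominators zero    xs         = []
  dominators (suc m) []         = []
  dominators (suc m) xs@(_ ∷ _) = u ∷ dominators m (prune u xs)
    where u = choose xs 0 xs

  arcs-∷ʳ : ∀ us v vs → arcs us (v ∷ vs) ≡ indeg v us + arcs us vs
  arcs-∷ʳ []       v vs = refl
  arcs-∷ʳ (u ∷ us) v vs rewrite arcs-∷ʳ us v vs =
    shuffle (bit (R u v)) (outdeg u vs) (indeg v us) (arcs us vs)
    where
    shuffle : ∀ a b c d → a + b + (c + d) ≡ a + c + (b + d)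
    shuffle = solve-∀

  degree-sum : ∀ u vs → (∀ {v} → v ∈ vs → R u v ≡ true ⊎ R v u ≡ true) →
               length vs ≤ outdeg u vs + indeg u vs
  degree-sum u []       h = z≤n
  degree-sum u (v ∷ vs) h = begin
    1 + length vs                         ≤⟨ +-mono-≤ (one (h (here refl))) (degree-sum u vs (h ∘ there)) ⟩
    (a + b) + (outdeg u vs + indeg u vs)  ≡⟨ shuffle a b _ _ ⟩
    (a + outdeg u vs) + (b + indeg u vs)  ∎
    where
    open ≤-Reasoning
    a = bit (R u v)
    b = bit (R v u)
    shuffle : ∀ a b c d → (a + b) + (c + d) ≡ (a + c) + (b + d)
    shuffle = solve-∀
    one : R u v ≡ true ⊎ R v u ≡ true → 1 ≤ bit (R u v) + bit (R v u)
    one (inj₁ e) rewrite e = s≤s z≤n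
    one (inj₂ e) rewrite e = m≤n+m 1 _

  -- Each of the n² ordered pairs, those on the diagonal included, is an arc in one direction or the
  -- other. The induction peels off the first row and the first column together.
  square≤2arcs : ∀ xs → Semicomplete xs → length xs * length xs ≤ arcs xs xs + arcs xs xs
  square≤2arcs []       h = z≤n
  square≤2arcs (x ∷ xs) h = begin
    suc n * suc n              ≡⟨ expand n ⟩
    1 + (n + n) + n * n        ≤⟨ +-mono-≤ (+-mono-≤ one (+-mono-≤ deg deg))
                                           (square≤2arcs xs (λ p q → h (there p) (there q))) ⟩
    (r + r) + ((d + i) + (d + i)) + (t + t) ≡⟨ collect r d i t ⟩
    (r + d + (i + t)) + (r + d + (i + t))   ≡⟨ cong (λ a → r + d + a + (r + d + a)) (sym (arcs-∷ʳ xs x xs)) ⟩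
    arcs (x ∷ xs) (x ∷ xs) + arcs (x ∷ xs) (x ∷ xs) ∎
    where
    open ≤-Reasoning
    n = length xs
    r = bit (R x x)
    d = outdeg x xs
    i = indeg x xs
    t = arcs xs xs
    deg = degree-sum x xs (λ p → h (here refl) (there p))
    one : 1 ≤ r + r
    one with h (here refl) (here refl)
    ... | inj₁ e rewrite e = s≤s z≤n
    ... | inj₂ e rewrite e = s≤s z≤n
    expand : ∀ n → suc n * suc n ≡ 1 + (n + n) + n * n
    expand = solve-∀
    collect : ∀ r d i t → (r + r) + ((d + i) + (d + i)) + (t + t) ≡ (r + d + (i + t)) + (r + d + (i + t))
    collect = solve-∀

  -- An unpopular `u` has 2 outdeg(u) + 1 ≤ n; the ones add up to `length us`.
  unpopular-arcs : ∀ n vs us → All (λ u → ¬ n ≤ outdeg u vs + outdeg u vs) us →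
                   (arcs us vs + arcs us vs) + length us ≤ length us * n
  unpopular-arcs n vs []       []       = z≤n
  unpopular-arcs n vs (u ∷ us) (p ∷ ps) = begin
    (d + a + (d + a)) + suc l   ≡⟨ shuffle d a l ⟩
    suc (d + d) + ((a + a) + l) ≤⟨ +-mono-≤ (≰⇒> p) (unpopular-arcs n vs us ps) ⟩
    n + l * n                   ∎
    where
    open ≤-Reasoning
    d = outdeg u vs
    a = arcs us vs
    l = length us
    shuffle : ∀ d a l → (d + a + (d + a)) + suc l ≡ suc (d + d) + ((a + a) + l)
    shuffle = solve-∀

  -- Averaging: if all n ≥ 1 vertices were unpopular, n² + n ≤ 2 arcs + n ≤ n².
  exists-popular : ∀ x xs → Semicomplete (x ∷ xs) → Any (Popular (x ∷ xs)) (x ∷ xs)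
  exists-popular x xs h with Any.any? (λ u → length ys ≤? outdeg u ys + outdeg u ys) ys
    where ys = x ∷ xs
  ... | yes p = p
  ... | no ¬p = contradiction
    (≤-trans (+-monoˡ-≤ n (square≤2arcs ys h)) (unpopular-arcs n ys ys (¬Any⇒All¬ ys ¬p)))
    (<⇒≱ (m<m+n (n * n) (s≤s z≤n)))
    where
    ys = x ∷ xs
    n = length ys

  choose-keeps : ∀ xs u js → Popular xs u →
    Popular xs (choose xs u js) × (choose xs u js ≡ u ⊎ choose xs u js ∈ js)
  -- The initial `u` need not be a vertex. A popular member of `js` displaces it, and from then on
  -- `choose-keeps` applies.
  choose-finds : ∀ xs u js → Any (Popular xs) js →
    Popular xs (choose xs u js) × choose xs u js ∈ js

  choose-keeps xs u []       p = p , inj₁ refl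
  choose-keeps xs u (j ∷ js) p with length xs ∸ (outdeg j xs + outdeg j xs) in eq
  ... | suc _ with choose-keeps xs u js p
  ...   | q , inj₁ e = q , inj₁ e
  ...   | q , inj₂ e = q , inj₂ (there e)
  choose-keeps xs u (j ∷ js) p | zero with choose-keeps xs j js (m∸n≡0⇒m≤n eq)
  ...   | q , inj₁ e = q , inj₂ (here e)
  ...   | q , inj₂ e = q , inj₂ (there e)

  choose-finds xs u (j ∷ js) p with length xs ∸ (outdeg j xs + outdeg j xs) in eq
  ... | zero with choose-keeps xs j js (m∸n≡0⇒m≤n eq)
  ...   | q , inj₁ e = q , here e
  ...   | q , inj₂ e = q , there e
  choose-finds xs u (j ∷ js) (here p) | suc _ =
    contradiction (trans (sym eq) (m≤n⇒m∸n≡0 p)) (λ ())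
  choose-finds xs u (j ∷ js) (there p) | suc _ with choose-finds xs u js p
  ...   | q , e = q , there e

  choose-popular : ∀ x xs → Semicomplete (x ∷ xs) →
    Popular (x ∷ xs) (choose (x ∷ xs) 0 (x ∷ xs)) × choose (x ∷ xs) 0 (x ∷ xs) ∈ x ∷ xs
  choose-popular x xs h = choose-finds (x ∷ xs) 0 (x ∷ xs) (exists-popular x xs h)

  length-prune : ∀ u vs → length (prune u vs) + outdeg u vs ≡ length vs
  length-prune u []       = refl
  length-prune u (v ∷ vs) with R u v
  ... | true  = trans (+-suc _ _) (cong suc (length-prune u vs))
  ... | false = cong suc (length-prune u vs)

  length-prune-popular : ∀ xs u → Popular xs u →
    length (prune u xs) + length (prune u xs) ≤ length xs
  length-prune-popular xs u p = +-cancelʳ-≤ (d + d) (l + l) n (begin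
    (l + l) + (d + d) ≡⟨ shuffle l d ⟩
    (l + d) + (l + d) ≡⟨ cong₂ _+_ (length-prune u xs) (length-prune u xs) ⟩
    n + n             ≤⟨ +-monoʳ-≤ n p ⟩
    n + (d + d)       ∎)
    where
    open ≤-Reasoning
    l = length (prune u xs)
    d = outdeg u xs
    n = length xs
    shuffle : ∀ l d → (l + l) + (d + d) ≡ (l + d) + (l + d)
    shuffle = solve-∀

  prune-⊆ : ∀ {u v} xs → v ∈ prune u xs → v ∈ xs
  prune-⊆ {u} xs p = proj₁ (∈-filter⁻ (T? ∘ (λ v → not (R u v))) {xs = xs} p)

  prune-undominated : ∀ {u v} xs → v ∈ prune u xs → R u v ≡ false
  prune-undominated {u} {v} xs p
    with R u v | proj₂ (∈-filter⁻ (T? ∘ (λ v → not (R u v))) {xs = xs} p)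
  ... | false | _ = refl

  prune-complete : ∀ {u v} xs → v ∈ xs → R u v ≡ true ⊎ v ∈ prune u xs
  prune-complete {u} {v} xs p with R u v in eq
  ... | true  = inj₁ refl
  ... | false = inj₂ (∈-filter⁺ (T? ∘ (λ v → not (R u v))) p (subst (T ∘ not) (sym eq) _))

  prune-semicomplete : ∀ {u} xs → Semicomplete xs → Semicomplete (prune u xs)
  prune-semicomplete xs h p q = h (prune-⊆ xs p) (prune-⊆ xs q)

  length-dominators : ∀ m xs → length (dominators m xs) ≤ m
  length-dominators zero    xs         = z≤n
  length-dominators (suc m) []         = z≤n
  length-dominators (suc m) xs@(_ ∷ _) = s≤s (length-dominators m (prune _ xs))

  dominators-⊆ : ∀ m xs → Semicomplete xs → ∀ {u} → u ∈ dominators m xs → u ∈ xs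
  dominators-⊆ (suc m) (x ∷ xs) h (here refl) = proj₂ (choose-popular x xs h)
  dominators-⊆ (suc m) (x ∷ xs) h (there p)   = prune-⊆ (x ∷ xs)
    (dominators-⊆ m _ (prune-semicomplete (x ∷ xs) h) p)

  -- Semicompleteness at u = v makes each chosen vertex dominate itself, so pruning removes it from
  -- all later rounds.
  dominators-unique : ∀ m xs → Semicomplete xs → Unique (dominators m xs)
  dominators-unique zero    xs       h = []
  dominators-unique (suc m) []       h = []
  dominators-unique (suc m) (x ∷ xs) h =
    All.tabulate fresh ∷ dominators-unique m (prune u ys) h′
    where
    ys = x ∷ xs
    u = choose ys 0 ys
    h′ = prune-semicomplete ys h
    u∈ys = proj₂ (choose-popular x xs h)
    u→u : R u u ≡ true
    u→u with h u∈ys u∈ys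
    ... | inj₁ e = e
    ... | inj₂ e = e
    fresh : ∀ {v} → v ∈ dominators m (prune u ys) → u ≢ v
    fresh p refl = contradiction
      (trans (sym (prune-undominated ys (dominators-⊆ m _ h′ p))) u→u) (λ ())

  -- A vertex is either dominated by the current choice or survives into a list of at most half the
  -- length; fewer than 2^m vertices are exhausted after m halvings.
  dominators-dominate : ∀ m xs → Semicomplete xs → length xs < 2 ^ m →
    ∀ {v} → v ∈ xs → ∃[ u ] (u ∈ dominators m xs × R u v ≡ true)
  dominators-dominate zero    (x ∷ xs) h (s≤s ()) p
  dominators-dominate (suc m) (x ∷ xs) h l p with prune-complete {u} ys p
    where
    ys = x ∷ xs
    u = choose ys 0 ys
  ... | inj₁ e = _ , here refl , e
  ... | inj₂ q with dominators-dominate m (prune u ys) (prune-semicomplete ys h) small q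
    where
    ys = x ∷ xs
    u = choose ys 0 ys
    small : length (prune u ys) < 2 ^ m
    small = *-cancelˡ-< 2 _ _ (≤-<-trans
      (≤-trans (≤-reflexive (cong (length (prune u ys) +_) (+-identityʳ _)))
        (length-prune-popular ys u (proj₁ (choose-popular x xs h)))) l)
  ...   | w , w∈ , e = w , there w∈ , e

-- The dominating set

-- All that the combinatorial part uses of the distributions, phrased with numbers because the
-- program computes with numbers.
record CherryOracle (k : ℕ) (o : Oracle) : Set where
  field
    reflexive : ∀ {a b} → a < b → b < k → o a b a b ≡ true
    cherry    : ∀ {x i j} → x < i → i < j → j < k →
                (o x i x j ≡ true ⊎ o x j x i ≡ true) ⊎
                (o i j x i ≡ true ⊎ o i j x j ≡ true)

range : ℕ → ℕ → List ℕ
range s zero    = []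
range s (suc n) = s ∷ range (suc s) n

length-range : ∀ s n → length (range s n) ≡ n
length-range s zero    = refl
length-range s (suc n) = cong suc (length-range (suc s) n)

∈-range⁻ : ∀ s n {j} → j ∈ range s n → s ≤ j × j < s + n
∈-range⁻ s (suc n) (here refl) = ≤-refl , m<m+n s (s≤s z≤n)
∈-range⁻ s (suc n) {j} (there p) with ∈-range⁻ (suc s) n p
... | s<j , j< = <⇒≤ s<j , subst (j <_) (sym (+-suc s n)) j<

∈-range⁺ : ∀ s n {j} → s ≤ j → j < s + n → j ∈ range s n
∈-range⁺ s zero {j} s≤j j< = contradiction (subst (j <_) (+-identityʳ s) j<) (≤⇒≯ s≤j)
∈-range⁺ s (suc n) {j} s≤j j< with m≤n⇒m<n∨m≡n s≤j
... | inj₂ refl = here refl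
... | inj₁ s<j  = there (∈-range⁺ (suc s) n s<j (subst (j <_) (+-suc s n) j<))

range-unique : ∀ s n → Unique (range s n)
range-unique s zero    = []
range-unique s (suc n) =
  All.tabulate (λ p e → <⇒≢ (proj₁ (∈-range⁻ (suc s) n p)) e) ∷ range-unique (suc s) n

pairs : ℕ → List ℕ → List (ℕ × ℕ)
pairs x = map (x ,_)

module Blocks (o : Oracle) (k b t : ℕ) where

  module G (x : ℕ) = Greedy (λ u v → o x u x v)

  -- hit x j i tells whether {i,j} → {x,j}, for i ≠ j in either order.
  hit : ℕ → ℕ → ℕ → ℕ
  hit x j i = unless0 (j ∸ i) (bit (o i j x j)) (unless0 (i ∸ j) (bit (o j i x j)) 0)

  hits : ℕ → ℕ → List ℕ → ℕ
  hits x j []       = 0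
  hits x j (i ∷ is) = hit x j i + hits x j is

  -- The set `A` of the overview. The scanned list is an argument separate from `B`, which permits
  -- induction on the scan while hits are still counted over the whole block.
  candidates : ℕ → List ℕ → List ℕ → List ℕ
  candidates x B = filterᵇ (λ j → hits x j B ≡ᵇ 0)

  star : ℕ → List ℕ → List (ℕ × ℕ)
  star x B = pairs x (G.dominators x t (candidates x B B))

  stars : ℕ → ℕ → List ℕ → List (ℕ × ℕ)
  stars x zero    B = []
  stars x (suc n) B = star x B ++ stars (suc x) n B

  triangle : ℕ → ℕ → List (ℕ × ℕ)
  triangle x zero    = []
  triangle x (suc n) = pairs x (range (suc x) n) ++ triangle (suc x) n

  -- min b (k ∸ s), in terms of the machine operation ∸.
  blockSize : ℕ → ℕ
  blockSize s = b ∸ (b ∸ (k ∸ s))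

  block : ℕ → List (ℕ × ℕ)
  block s = stars 0 s (range s (blockSize s)) ++ triangle s (blockSize s)

  -- `m` counts iterations, not blocks. Past `k` an iteration contributes nothing, as in the
  -- program, which always performs `k` of them.
  blocks : ℕ → ℕ → List (ℕ × ℕ)
  blocks zero    s = []
  blocks (suc m) s = unless0 (k ∸ s) (block s ++ blocks m (s + b)) (blocks m s)

  ∈-pairs⁻ : ∀ x ys {a c} → (a , c) ∈ pairs x ys → a ≡ x × c ∈ ys
  ∈-pairs⁻ x ys p with ∈-map⁻ (x ,_) p
  ... | _ , q , refl = refl , q

  pairs-unique : ∀ x {ys} → Unique ys → Unique (pairs x ys)
  pairs-unique x = Unique.map⁺ (λ { refl → refl })

  ∈-triangle⁻ : ∀ x n {a c} → (a , c) ∈ triangle x n → x ≤ a × a < c × c < x + n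
  ∈-triangle⁻ x (suc n) {a} {c} p with ∈-++⁻ (pairs x (range (suc x) n)) p
  ... | inj₁ q with ∈-pairs⁻ x (range (suc x) n) q
  ...   | refl , r with ∈-range⁻ (suc x) n r
  ...     | lo , hi = ≤-refl , lo , subst (c <_) (sym (+-suc x n)) hi
  ∈-triangle⁻ x (suc n) {a} {c} p | inj₂ q with ∈-triangle⁻ (suc x) n q
  ...   | x<a , a<c , hi = <⇒≤ x<a , a<c , subst (c <_) (sym (+-suc x n)) hi

  ∈-triangle⁺ : ∀ x n {a c} → x ≤ a → a < c → c < x + n → (a , c) ∈ triangle x n
  ∈-triangle⁺ x zero {a} {c} x≤a a<c c< = contradiction (subst (c <_) (+-identityʳ x) c<)
    (≤⇒≯ (≤-trans x≤a (<⇒≤ a<c)))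
  ∈-triangle⁺ x (suc n) {a} {c} x≤a a<c c< with m≤n⇒m<n∨m≡n x≤a
  ... | inj₂ refl = ∈-++⁺ˡ (∈-map⁺ (x ,_) (∈-range⁺ (suc x) n a<c (subst (c <_) (+-suc x n) c<)))
  ... | inj₁ x<a  = ∈-++⁺ʳ (pairs x (range (suc x) n))
                      (∈-triangle⁺ (suc x) n x<a a<c (subst (c <_) (+-suc x n) c<))

  triangle-unique : ∀ x n → Unique (triangle x n)
  triangle-unique x zero    = []
  triangle-unique x (suc n) = Unique.++⁺ (pairs-unique x (range-unique (suc x) n))
    (triangle-unique (suc x) n) disjoint
    where
    disjoint : Disjoint (pairs x (range (suc x) n)) (triangle (suc x) n)
    disjoint (p , q) with ∈-pairs⁻ x (range (suc x) n) p | ∈-triangle⁻ (suc x) n q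
    ... | refl , _ | x<x , _ = <-irrefl refl x<x

  -- Every row has at most `σ` pairs. Halving this bound is unnecessary for the constant 4.
  length-triangle : ∀ σ x n → n ≤ suc σ → length (triangle x n) ≤ n * σ
  length-triangle σ x zero    h       = z≤n
  length-triangle σ x (suc n) (s≤s h) = begin
    length (pairs x r ++ triangle (suc x) n)       ≡⟨ length-++ (pairs x r) ⟩
    length (pairs x r) + length (triangle (suc x) n) ≤⟨ +-mono-≤ first (length-triangle σ (suc x) n (m≤n⇒m≤1+n h)) ⟩
    σ + n * σ                                      ∎
    where
    open ≤-Reasoning
    r = range (suc x) n
    first : length (pairs x r) ≤ σ
    first = ≤-trans (≤-reflexive (trans (length-map (x ,_) r) (length-range (suc x) n))) h

  blockSize≤b : ∀ s → blockSize s ≤ b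
  blockSize≤b s = m∸n≤m b (b ∸ (k ∸ s))

  blockSize-full : ∀ s → b ≤ k ∸ s → blockSize s ≡ b
  blockSize-full s h = cong (b ∸_) (m≤n⇒m∸n≡0 h)

  blockSize-last : ∀ s → k ∸ s ≤ b → blockSize s ≡ k ∸ s
  blockSize-last s h = m∸[m∸n]≡n h

  blockSize≤rest : ∀ s → blockSize s ≤ k ∸ s
  blockSize≤rest s with ≤-total b (k ∸ s)
  ... | inj₁ h = ≤-trans (blockSize≤b s) h
  ... | inj₂ h = ≤-reflexive (blockSize-last s h)

  block-bound : ∀ s {c} → s ≤ k → c < s + blockSize s → c < k
  block-bound s {c} s≤k h = <-≤-trans h
    (≤-trans (+-monoʳ-≤ s (blockSize≤rest s)) (≤-reflexive (m+[n∸m]≡n s≤k)))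

  length-stars : ∀ x n B → length (stars x n B) ≤ n * t
  length-stars x zero    B = z≤n
  length-stars x (suc n) B = begin
    length (star x B ++ stars (suc x) n B)       ≡⟨ length-++ (star x B) ⟩
    length (star x B) + length (stars (suc x) n B) ≤⟨ +-mono-≤
      (≤-trans (≤-reflexive (length-map (x ,_) ds)) (G.length-dominators x t cs))
      (length-stars (suc x) n B) ⟩
    t + n * t ∎
    where
    open ≤-Reasoning
    cs = candidates x B B
    ds = G.dominators x t cs

  length-block : ∀ σ s → b ≡ suc σ → length (block s) ≤ s * t + blockSize s * σ
  length-block σ s refl = ≤-trans (≤-reflexive (length-++ (stars 0 s _)))
    (+-mono-≤ (length-stars 0 s _) (length-triangle σ s _ (blockSize≤b s)))

  blocks-step : ∀ m s → s < k → blocks (suc m) s ≡ block s ++ blocks m (s + b)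
  blocks-step m s s<k with k ∸ s in eq
  ... | zero  = contradiction (m∸n≡0⇒m≤n eq) (<⇒≱ s<k)
  ... | suc _ rewrite sym eq = refl

  blocks-done : ∀ m s → k ≤ s → blocks m s ≡ []
  blocks-done zero    s h = refl
  blocks-done (suc m) s h rewrite m≤n⇒m∸n≡0 h = blocks-done m s h

  module _ (σ : ℕ) (b≡1+σ : b ≡ suc σ) (kt≤3σb : k * t ≤ 3 * σ * b) where

    length-last-block : ∀ m s → s < k → k ≤ s + b →
      length (blocks (suc m) s) ≤ s * t + (k ∸ s) * σ
    length-last-block m s s<k k≤s+b = begin
      length (blocks (suc m) s)                    ≡⟨ cong length (blocks-step m s s<k) ⟩
      length (block s ++ blocks m (s + b))         ≡⟨ length-++ (block s) ⟩
      length (block s) + length (blocks m (s + b)) ≡⟨ cong (λ l → length (block s) + length l) (blocks-done m (s + b) k≤s+b) ⟩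
      length (block s) + 0                         ≡⟨ +-identityʳ _ ⟩
      length (block s)                             ≤⟨ length-block σ s b≡1+σ ⟩
      s * t + blockSize s * σ                      ≤⟨ +-monoʳ-≤ (s * t) (*-monoˡ-≤ σ (blockSize≤rest s)) ⟩
      s * t + (k ∸ s) * σ                          ∎
      where open ≤-Reasoning

    -- The stars of a block are charged to the (full) block before it.
    length-later-blocks : ∀ m s → s ≤ k →
      length (blocks m s) ≤ 3 * σ * (k ∸ s + b) + (k ∸ s) * σ
    length-later-blocks zero    s h = z≤n
    length-later-blocks (suc m) s s≤k with m≤n⇒m<n∨m≡n s≤k
    ... | inj₂ refl = ≤-trans (≤-reflexive (cong length (blocks-done (suc m) s ≤-refl))) z≤n
    ... | inj₁ s<k with ≤-total (s + b) k
    ...   | inj₁ s+b≤k = begin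
      length (blocks (suc m) s)                         ≡⟨ cong length (blocks-step m s s<k) ⟩
      length (block s ++ blocks m (s + b))              ≡⟨ length-++ (block s) ⟩
      length (block s) + length (blocks m (s + b))      ≤⟨ +-mono-≤ here-block (length-later-blocks m (s + b) s+b≤k) ⟩
      (3 * σ * b + b * σ) + (3 * σ * (r + b) + r * σ)   ≡⟨ regroup (3 * σ) b σ r ⟩
      3 * σ * (r + b + b) + (r + b) * σ                 ≡⟨ cong (λ a → 3 * σ * (a + b) + a * σ) r+b≡ ⟩
      3 * σ * (k ∸ s + b) + (k ∸ s) * σ ∎
      where
      open ≤-Reasoning
      r = k ∸ (s + b)
      r+b≡ : r + b ≡ k ∸ s
      r+b≡ = trans (cong (_+ b) (sym (∸-+-assoc k s b)))
        (m∸n+n≡m (m+n≤o⇒m≤o∸n b (≤-trans (≤-reflexive (+-comm b s)) s+b≤k)))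
      here-block : length (block s) ≤ 3 * σ * b + b * σ
      here-block = ≤-trans (length-block σ s b≡1+σ) (+-mono-≤
        (≤-trans (*-monoˡ-≤ t s≤k) kt≤3σb) (*-monoˡ-≤ σ (blockSize≤b s)))
      regroup : ∀ c b σ r → (c * b + b * σ) + (c * (r + b) + r * σ) ≡ c * (r + b + b) + (r + b) * σ
      regroup = solve-∀
    ...   | inj₂ k≤s+b = ≤-trans (length-last-block m s s<k k≤s+b) (+-monoˡ-≤ _
      (≤-trans (*-monoˡ-≤ t s≤k) (≤-trans kt≤3σb (*-monoʳ-≤ (3 * σ) (m≤n+m b (k ∸ s))))))

    -- The first block has no stars, as no index lies to its left, so every star finds a full block
    -- to be charged to. Each index pays at most `3 * σ` for stars and `σ` for its triangle row.
    length-blocks : ∀ m → length (blocks m 0) ≤ 4 * k * σ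
    length-blocks zero    = z≤n
    length-blocks (suc m) with m≤n⇒m<n∨m≡n (z≤n {k})
    ... | inj₂ refl = ≤-trans (≤-reflexive (cong length (blocks-done (suc m) 0 z≤n))) z≤n
    ... | inj₁ 0<k with ≤-total b k
    ...   | inj₁ b≤k = begin
      length (blocks (suc m) 0)                   ≡⟨ cong length (blocks-step m 0 0<k) ⟩
      length (block 0 ++ blocks m b)              ≡⟨ length-++ (block 0) ⟩
      length (block 0) + length (blocks m b)      ≤⟨ +-mono-≤
        (≤-trans (length-block σ 0 b≡1+σ) (*-monoˡ-≤ σ (blockSize≤b 0)))
        (length-later-blocks m b b≤k) ⟩
      b * σ + (3 * σ * (k ∸ b + b) + (k ∸ b) * σ) ≡⟨ regroup b σ (k ∸ b) ⟩
      4 * (k ∸ b + b) * σ                         ≡⟨ cong (λ a → 4 * a * σ) (m∸n+n≡m b≤k) ⟩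
      4 * k * σ                                   ∎
      where
      open ≤-Reasoning
      regroup : ∀ b σ r → b * σ + (3 * σ * (r + b) + r * σ) ≡ 4 * (r + b) * σ
      regroup = solve-∀
    ...   | inj₂ k≤b = ≤-trans (length-last-block m 0 0<k k≤b) (*-monoˡ-≤ σ (m≤n*m k 4))

  module _ (valid : CherryOracle k o) where
    open CherryOracle valid

    hit-before : ∀ {x i j} → i < j → hit x j i ≡ bit (o i j x j)
    hit-before {i = i} {j} i<j with j ∸ i in eq
    ... | suc _ = refl
    ... | zero  = contradiction (m∸n≡0⇒m≤n eq) (<⇒≱ i<j)

    hit-after : ∀ {x i j} → j < i → hit x j i ≡ bit (o j i x j)
    hit-after {i = i} {j} j<i rewrite m≤n⇒m∸n≡0 (<⇒≤ j<i) with i ∸ j in eq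
    ... | suc _ = refl
    ... | zero  = contradiction (m∸n≡0⇒m≤n eq) (<⇒≱ j<i)

    hit-self : ∀ x j → hit x j j ≡ 0
    hit-self x j rewrite n∸n≡0 j = refl

    hits≡0 : ∀ {x j i} B → hits x j B ≡ 0 → i ∈ B → hit x j i ≡ 0
    hits≡0 {x} {j} (i ∷ B) h (here refl) = m+n≡0⇒m≡0 (hit x j i) h
    hits≡0 {x} {j} (i ∷ B) h (there p)   = hits≡0 B (m+n≡0⇒n≡0 (hit x j i) h) p

    hits≢0 : ∀ {x j} B → hits x j B ≢ 0 → ∃[ i ] (i ∈ B × hit x j i ≢ 0)
    hits≢0 [] h = contradiction refl h
    hits≢0 {x} {j} (i ∷ B) h with hit x j i in eq
    ... | suc _ = i , here refl , λ e → contradiction (trans (sym eq) e) (λ ())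
    ... | zero with hits≢0 B h
    ...   | i′ , p , q = i′ , there p , q

    bit≡0 : ∀ {c} → bit c ≡ 0 → c ≢ true
    bit≡0 {true} () refl

    bit≢0 : ∀ {c} → bit c ≢ 0 → c ≡ true
    bit≢0 {true}  h = refl
    bit≢0 {false} h = contradiction refl h

    module _ (x s n : ℕ) (x<s : x < s) (s+n≤k : s + n ≤ k) where
      private
        B  = range s n
        cs = candidates x B B

      ∈-candidates⁻ : ∀ {j} → j ∈ cs → j ∈ B × hits x j B ≡ 0
      ∈-candidates⁻ p with ∈-filter⁻ (T? ∘ (λ j → hits x j B ≡ᵇ 0)) {xs = B} p
      ... | q , r = q , ≡ᵇ⇒≡ _ 0 r

      -- For u ≠ v the cherry property offers an edge between {x,u} and {x,v}, or one from the pair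
      -- formed by u and v to one of them. The latter would be a hit from inside the block, which
      -- candidates do not have.
      candidates-semicomplete : G.Semicomplete x cs
      candidates-semicomplete {u} {v} p q
        with ∈-candidates⁻ p | ∈-candidates⁻ q
      ... | u∈B , hu | v∈B , hv with ∈-range⁻ s n u∈B | ∈-range⁻ s n v∈B | <-cmp u v
      ...   | s≤u , u< | s≤v , v< | tri≈ _ refl _ =
        inj₁ (reflexive (<-≤-trans x<s s≤u) (<-≤-trans u< s+n≤k))
      ...   | s≤u , u< | s≤v , v< | tri< u<v _ _
        with cherry (<-≤-trans x<s s≤u) u<v (<-≤-trans v< s+n≤k)
      ...     | inj₁ e = e
      ...     | inj₂ (inj₁ e) =
        contradiction e (bit≡0 (trans (sym (hit-after u<v)) (hits≡0 B hu v∈B)))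
      ...     | inj₂ (inj₂ e) =
        contradiction e (bit≡0 (trans (sym (hit-before u<v)) (hits≡0 B hv u∈B)))
      candidates-semicomplete {u} {v} p q | u∈B , hu | v∈B , hv
            | s≤u , u< | s≤v , v< | tri> _ _ v<u
        with cherry (<-≤-trans x<s s≤v) v<u (<-≤-trans u< s+n≤k)
      ...     | inj₁ (inj₁ e) = inj₂ e
      ...     | inj₁ (inj₂ e) = inj₁ e
      ...     | inj₂ (inj₁ e) =
        contradiction e (bit≡0 (trans (sym (hit-after v<u)) (hits≡0 B hv u∈B)))
      ...     | inj₂ (inj₂ e) =
        contradiction e (bit≡0 (trans (sym (hit-before v<u)) (hits≡0 B hu v∈B)))

      ∈-star⁻ : ∀ {a c} → (a , c) ∈ star x B → a ≡ x × c ∈ B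
      ∈-star⁻ p with ∈-pairs⁻ x _ p
      ... | e , q = e , proj₁ (∈-candidates⁻ (G.dominators-⊆ x t cs candidates-semicomplete q))

      star-unique : Unique (star x B)
      star-unique = pairs-unique x (G.dominators-unique x t cs candidates-semicomplete)

      length-candidates : length cs ≤ n
      length-candidates = ≤-trans
        (length-filter (T? ∘ (λ j → hits x j B ≡ᵇ 0)) B)
        (≤-reflexive (length-range s n))

      -- If `j` is hit from inside the block, the hitting pair lies in the triangle; otherwise `j`
      -- is a candidate, and the greedy rounds reach it.
      block-dominates : n < 2 ^ t → ∀ {j} → j ∈ B → ∃[ a ] ∃[ c ]
        (((a , c) ∈ star x B ⊎ (a , c) ∈ triangle s n) × o a c x j ≡ true)
      block-dominates n<2^t {j} j∈B with hits x j B ≟ 0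
      ... | yes h with G.dominators-dominate x t cs candidates-semicomplete
                       (≤-<-trans length-candidates n<2^t)
                       (∈-filter⁺ (T? ∘ (λ j → hits x j B ≡ᵇ 0)) j∈B (≡⇒≡ᵇ _ 0 h))
      ...   | u , u∈ , e = x , u , inj₁ (∈-map⁺ (x ,_) u∈) , e
      block-dominates n<2^t {j} j∈B | no h with hits≢0 B h
      ... | i , i∈B , hi with ∈-range⁻ s n i∈B | ∈-range⁻ s n j∈B | <-cmp i j
      ...   | s≤i , i< | s≤j , j< | tri≈ _ refl _ = contradiction (hit-self x i) hi
      ...   | s≤i , i< | s≤j , j< | tri< i<j _ _ =
        i , j , inj₂ (∈-triangle⁺ s n s≤i i<j j<) , bit≢0 (λ e → hi (trans (hit-before i<j) e))
      ...   | s≤i , i< | s≤j , j< | tri> _ _ j<i =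
        j , i , inj₂ (∈-triangle⁺ s n s≤j j<i i<) , bit≢0 (λ e → hi (trans (hit-after j<i) e))

    module _ (s n : ℕ) (s+n≤k : s + n ≤ k) where
      private B = range s n

      ∈-stars⁻ : ∀ x m → x + m ≤ s → ∀ {a c} → (a , c) ∈ stars x m B →
                 x ≤ a × a < s × c ∈ B
      ∈-stars⁻ x (suc m) x+m≤s p with ∈-++⁻ (star x B) p
      ... | inj₁ q with ∈-star⁻ x s n (<-≤-trans (m<m+n x (s≤s z≤n)) x+m≤s) s+n≤k q
      ...   | refl , r = ≤-refl , <-≤-trans (m<m+n x (s≤s z≤n)) x+m≤s , r
      ∈-stars⁻ x (suc m) x+m≤s p | inj₂ q
        with ∈-stars⁻ (suc x) m (≤-trans (≤-reflexive (sym (+-suc x m))) x+m≤s) q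
      ...   | x<a , r = <⇒≤ x<a , r

      ∈-stars⁺ : ∀ x m {y} → x ≤ y → y < x + m → ∀ {p} → p ∈ star y B → p ∈ stars x m B
      ∈-stars⁺ x zero {y} x≤y y< p = contradiction (subst (y <_) (+-identityʳ x) y<) (≤⇒≯ x≤y)
      ∈-stars⁺ x (suc m) {y} x≤y y< p with m≤n⇒m<n∨m≡n x≤y
      ... | inj₂ refl = ∈-++⁺ˡ p
      ... | inj₁ x<y  = ∈-++⁺ʳ (star x B) (∈-stars⁺ (suc x) m x<y (subst (y <_) (+-suc x m) y<) p)

      stars-unique : ∀ x m → x + m ≤ s → Unique (stars x m B)
      stars-unique x zero    h = []
      stars-unique x (suc m) h = Unique.++⁺ (star-unique x s n x<s s+n≤k) (stars-unique (suc x) m h′) disjoint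
        where
        x<s = <-≤-trans (m<m+n x (s≤s z≤n)) h
        h′ = ≤-trans (≤-reflexive (sym (+-suc x m))) h
        disjoint : Disjoint (star x B) (stars (suc x) m B)
        disjoint (p , q) with ∈-star⁻ x s n x<s s+n≤k p | ∈-stars⁻ (suc x) m h′ q
        ... | refl , _ | x<x , _ = <-irrefl refl x<x

    module _ (s : ℕ) (s≤k : s ≤ k) where
      private
        n = blockSize s
        s+n≤k : s + n ≤ k
        s+n≤k = ≤-trans (+-monoʳ-≤ s (blockSize≤rest s)) (≤-reflexive (m+[n∸m]≡n s≤k))

      ∈-block⁻ : ∀ {a c} → (a , c) ∈ block s → a < c × s ≤ c × c < s + n
      ∈-block⁻ p with ∈-++⁻ (stars 0 s (range s n)) p
      ... | inj₁ q with ∈-stars⁻ s n s+n≤k 0 s ≤-refl q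
      ...   | _ , a<s , r with ∈-range⁻ s n r
      ...     | s≤c , c< = <-≤-trans a<s s≤c , s≤c , c<
      ∈-block⁻ p | inj₂ q with ∈-triangle⁻ s n q
      ...   | s≤a , a<c , c< = a<c , ≤-trans s≤a (<⇒≤ a<c) , c<

      block-unique : Unique (block s)
      block-unique = Unique.++⁺ (stars-unique s n s+n≤k 0 s ≤-refl) (triangle-unique s n) disjoint
        where
        disjoint : Disjoint (stars 0 s (range s n)) (triangle s n)
        disjoint (p , q) with ∈-stars⁻ s n s+n≤k 0 s ≤-refl p | ∈-triangle⁻ s n q
        ... | _ , a<s , _ | s≤a , _ = ≤⇒≯ s≤a a<s

      block-dominating : k < 2 ^ t → ∀ {x j} → x < j → s ≤ j → j < s + n →
                         ∃[ a ] ∃[ c ] ((a , c) ∈ block s × o a c x j ≡ true)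
      block-dominating k<2^t {x} {j} x<j s≤j j< with s ≤? x
      ... | yes s≤x = x , j , ∈-++⁺ʳ (stars 0 s (range s n)) (∈-triangle⁺ s n s≤x x<j j<)
                    , reflexive x<j (<-≤-trans j< s+n≤k)
      ... | no s≰x with block-dominates x s n (≰⇒> s≰x) s+n≤k
                          (≤-<-trans (≤-trans (m≤n+m n s) s+n≤k) k<2^t) (∈-range⁺ s n s≤j j<)
      ...   | a , c , inj₁ p , e = a , c , ∈-++⁺ˡ (∈-stars⁺ s n s+n≤k 0 s z≤n (≰⇒> s≰x) p) , e
      ...   | a , c , inj₂ p , e = a , c , ∈-++⁺ʳ (stars 0 s (range s n)) p , e

    ∈-blocks⁻ : ∀ m s → ∀ {a c} → (a , c) ∈ blocks m s → a < c × s ≤ c × c < k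
    ∈-blocks⁻ (suc m) s p with <-≤-connex s k
    ... | inj₂ k≤s with () ← subst (_ ∈_) (blocks-done (suc m) s k≤s) p
    ... | inj₁ s<k with ∈-++⁻ (block s) (subst (_ ∈_) (blocks-step m s s<k) p)
    ...   | inj₁ q with ∈-block⁻ s (<⇒≤ s<k) q
    ...     | a<c , s≤c , c<     = a<c , s≤c , block-bound s (<⇒≤ s<k) c<
    ∈-blocks⁻ (suc m) s p | inj₁ s<k | inj₂ q with ∈-blocks⁻ m (s + b) q
    ...     | a<c , s+b≤c , c<k = a<c , ≤-trans (m≤m+n s b) s+b≤c , c<k

    -- The larger coordinate of a pair lies in the interval of its block and so separates different
    -- blocks.
    blocks-unique : ∀ m s → Unique (blocks m s)
    blocks-unique zero    s = []
    blocks-unique (suc m) s with <-≤-connex s k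
    ... | inj₂ k≤s = subst Unique (sym (blocks-done (suc m) s k≤s)) []
    ... | inj₁ s<k = subst Unique (sym (blocks-step m s s<k))
      (Unique.++⁺ (block-unique s s≤k) (blocks-unique m (s + b)) disjoint)
      where
      s≤k = <⇒≤ s<k
      disjoint : Disjoint (block s) (blocks m (s + b))
      disjoint (p , q) with ∈-block⁻ s s≤k p | ∈-blocks⁻ m (s + b) q
      ... | _ , _ , c< | _ , s+b≤c , _ =
        ≤⇒≯ s+b≤c (<-≤-trans c< (+-monoʳ-≤ s (blockSize≤b s)))

    blocks-dominating : k < 2 ^ t → ∀ m s {x j} → x < j → j < k → s ≤ j → j < s + m * b →
                        ∃[ a ] ∃[ c ] ((a , c) ∈ blocks m s × o a c x j ≡ true)
    blocks-dominating h zero s {j = j} x<j j<k s≤j j< =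
      contradiction (subst (j <_) (+-identityʳ s) j<) (≤⇒≯ s≤j)
    blocks-dominating h (suc m) s {x} {j} x<j j<k s≤j j<
      rewrite blocks-step m s (≤-<-trans s≤j j<k) with s + blockSize s ≤? j
    ... | no s+n≰j with block-dominating s (≤-trans s≤j (<⇒≤ j<k)) h x<j s≤j (≰⇒> s+n≰j)
    ...   | a , c , p , e = a , c , ∈-++⁺ˡ p , e
    blocks-dominating h (suc m) s {x} {j} x<j j<k s≤j j< | yes s+n≤j
      with blocks-dominating h m (s + b) x<j j<k s+b≤j
             (subst (j <_) (sym (+-assoc s b (m * b))) j<)
      where
      s≤k = ≤-trans s≤j (<⇒≤ j<k)
      -- A truncated block ends at `k`, so an index beyond the current block shows that this block
      -- is full.
      s+b≤j : s + b ≤ j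
      s+b≤j with ≤-total b (k ∸ s)
      ... | inj₁ b≤ = subst (λ n → s + n ≤ j) (blockSize-full s b≤) s+n≤j
      ... | inj₂ ≤b = contradiction
        (subst (_≤ j) (trans (cong (s +_) (blockSize-last s ≤b)) (m+[n∸m]≡n s≤k)) s+n≤j)
        (<⇒≱ j<k)
    ... | a , c , p , e = a , c , ∈-++⁺ʳ (block s) p , e

-- The program

-- A syntactic, conservative check. On concrete programs it evaluates, so the frame conditions below
-- are discharged by `refl`.
assigns : Reg → Cmd → Bool
assigns z skip         = false
assigns z (set x n)    = z ≡ᵇ x
assigns z (mov x y)    = z ≡ᵇ x
assigns z (plus x _ _) = z ≡ᵇ x
assigns z (minus x _ _) = z ≡ᵇ x
assigns z (fetch x _)  = z ≡ᵇ x
assigns z (put _ _)    = false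
assigns z (ask x _ _ _ _) = z ≡ᵇ x
assigns z (say _ _)    = false
assigns z (P ⨾ Q)      = assigns z P ∨ assigns z Q
assigns z (cond _ P Q) = assigns z P ∨ assigns z Q
assigns z (repeat _ P) = assigns z P

stores : Cmd → Bool
stores (put _ _)    = true
stores (P ⨾ Q)      = stores P ∨ stores Q
stores (cond _ P Q) = stores P ∨ stores Q
stores (repeat _ P) = stores P
stores _            = false

outputs : Cmd → Bool
outputs (say _ _)    = true
outputs (P ⨾ Q)      = outputs P ∨ outputs Q
outputs (cond _ P Q) = outputs P ∨ outputs Q
outputs (repeat _ P) = outputs P
outputs _            = false

∨-falseˡ : ∀ {a b} → a ∨ b ≡ false → a ≡ false
∨-falseˡ {false} _ = refl

∨-falseʳ : ∀ {a b} → a ∨ b ≡ false → b ≡ false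
∨-falseʳ {false} e = e

loop-fixes : ∀ {a b} {A : Set a} {B : Set b} (g : A → B) (f : A → A) →
             (∀ s → g (f s) ≡ g s) → ∀ n s → g (loop n f s) ≡ g s
loop-fixes g f h zero    s = refl
loop-fixes g f h (suc n) s = trans (loop-fixes g f h n (f s)) (h s)

unless0-fixes : ∀ {a b} {A : Set a} {B : Set b} (g : A → B) n {p q : A} {r} →
                g p ≡ r → g q ≡ r → g (unless0 n p q) ≡ r
unless0-fixes g zero    hp hq = hq
unless0-fixes g (suc _) hp hq = hp

unless0-map : ∀ {a b} {A : Set a} {B : Set b} (g : A → B) n {p q : A} →
              g (unless0 n p q) ≡ unless0 n (g p) (g q)
unless0-map g zero    = refl
unless0-map g (suc _) = refl

module Frame (o : Oracle) where

  reg-fixed : ∀ P z s → assigns z P ≡ false → reg (exec o P s) z ≡ reg s z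
  reg-fixed skip            z s h = refl
  reg-fixed (set x n)       z s h rewrite h = refl
  reg-fixed (mov x y)       z s h rewrite h = refl
  reg-fixed (plus x _ _)    z s h rewrite h = refl
  reg-fixed (minus x _ _)   z s h rewrite h = refl
  reg-fixed (fetch x _)     z s h rewrite h = refl
  reg-fixed (put _ _)       z s h = refl
  reg-fixed (ask x _ _ _ _) z s h rewrite h = refl
  reg-fixed (say _ _)       z s h = refl
  reg-fixed (P ⨾ Q)         z s h = trans (reg-fixed Q z (exec o P s) (∨-falseʳ {assigns z P} h))
                                          (reg-fixed P z s (∨-falseˡ h))
  reg-fixed (cond x P Q)    z s h = unless0-fixes (λ s → reg s z) (reg s x)
    (reg-fixed P z (tick 1 s) (∨-falseˡ h)) (reg-fixed Q z (tick 1 s) (∨-falseʳ {assigns z P} h))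
  reg-fixed (repeat x P)    z s h = loop-fixes (λ s → reg s z) _
    (λ s → reg-fixed P z (tick 3 s) h) (reg s x) (tick 1 s)

  heap-fixed : ∀ P s → stores P ≡ false → heap (exec o P s) ≡ heap s
  heap-fixed skip            s h = refl
  heap-fixed (set x n)       s h = refl
  heap-fixed (mov x y)       s h = refl
  heap-fixed (plus x _ _)    s h = refl
  heap-fixed (minus x _ _)   s h = refl
  heap-fixed (fetch x _)     s h = refl
  heap-fixed (ask x _ _ _ _) s h = refl
  heap-fixed (say _ _)       s h = refl
  heap-fixed (P ⨾ Q)         s h = trans (heap-fixed Q (exec o P s) (∨-falseʳ {stores P} h))
                                         (heap-fixed P s (∨-falseˡ h))
  heap-fixed (cond x P Q)    s h = unless0-fixes heap (reg s x)
    (heap-fixed P (tick 1 s) (∨-falseˡ h)) (heap-fixed Q (tick 1 s) (∨-falseʳ {stores P} h))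
  heap-fixed (repeat x P)    s h = loop-fixes heap _
    (λ s → heap-fixed P (tick 3 s) h) (reg s x) (tick 1 s)

  out-fixed : ∀ P s → outputs P ≡ false → out (exec o P s) ≡ out s
  out-fixed skip            s h = refl
  out-fixed (set x n)       s h = refl
  out-fixed (mov x y)       s h = refl
  out-fixed (plus x _ _)    s h = refl
  out-fixed (minus x _ _)   s h = refl
  out-fixed (fetch x _)     s h = refl
  out-fixed (put _ _)       s h = refl
  out-fixed (ask x _ _ _ _) s h = refl
  out-fixed (P ⨾ Q)         s h = trans (out-fixed Q (exec o P s) (∨-falseʳ {outputs P} h))
                                        (out-fixed P s (∨-falseˡ h))
  out-fixed (cond x P Q)    s h = unless0-fixes out (reg s x)
    (out-fixed P (tick 1 s) (∨-falseˡ h)) (out-fixed Q (tick 1 s) (∨-falseʳ {outputs P} h))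
  out-fixed (repeat x P)    s h = loop-fixes out _
    (λ s → out-fixed P (tick 3 s) h) (reg s x) (tick 1 s)

-- Lists stored in the heap

Segment : (ℕ → ℕ) → ℕ → List ℕ → Set
Segment h a []       = ⊤
Segment h a (v ∷ vs) = h a ≡ v × Segment h (suc a) vs

segment-update : ∀ {h} a {c} v xs → c < a → Segment h a xs → Segment (h [ c ≔ v ]) a xs
segment-update a v []       c<a _        = tt
segment-update {h} a {c} v (x ∷ xs) c<a (e , es) =
  trans (update-other h c v a (≢⇒≡ᵇ-false (≢-sym (<⇒≢ c<a)))) e ,
  segment-update (suc a) v xs (m≤n⇒m≤1+n c<a) es

segment-∷ʳ : ∀ {h} a xs v → Segment h a xs → Segment (h [ a + length xs ≔ v ]) a (xs ++ [ v ])
segment-∷ʳ {h} a [] v _ rewrite +-identityʳ a = update-same h a v , tt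
segment-∷ʳ {h} a (x ∷ xs) v (e , es) =
  trans (update-other h (a + suc (length xs)) v a (≢⇒≡ᵇ-false (<⇒≢ (m<m+n a (s≤s z≤n))))) e ,
  subst (λ c → Segment (h [ c ≔ v ]) (suc a) (xs ++ [ v ])) (sym (+-suc a (length xs)))
    (segment-∷ʳ (suc a) xs v es)

-- rB is the block size, rT the number of rounds, rA and rLen delimit the
-- current block, rX and rJ the current pair; the current candidates are the
-- first rN heap cells.
rK one rL rP rKL rS rSq rB rT rA rLen rX rJ rI rD rN rU rC rW rY tmp rR : Reg
rK = 0; one = 1; rL = 2; rP = 3; rKL = 4; rS = 5; rSq = 6; rB = 7; rT = 8; rA = 9
rLen = 10; rX = 11; rJ = 12; rI = 13; rD = 14; rN = 15; rU = 16; rC = 17; rW = 18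
rY = 19; tmp = 20; rR = 21

-- Code and analysis of the greedy rounds

countBody pickTest pickBody pruneTest pruneBody round : Cmd

countBody = fetch rY rW ⨾ ask tmp rX rJ rX rY ⨾ plus rC rC tmp ⨾ plus rW one rW

pickTest = (fetch rJ rI ⨾ set rC 0 ⨾ set rW 0) ⨾ repeat rN countBody
         ⨾ (plus tmp rC rC ⨾ minus tmp rN tmp) ⨾ cond tmp skip (mov rU rJ)

pickBody = pickTest ⨾ plus rI one rI

pruneTest = (fetch rJ rI ⨾ ask tmp rX rU rX rJ) ⨾ cond tmp skip (put rW rJ ⨾ plus rW one rW)

pruneBody = pruneTest ⨾ plus rI one rI

-- All rounds are run even after the candidates are exhausted; the test of `rN` keeps an empty round
-- from emitting a pair.
round = (set rU 0 ⨾ set rI 0) ⨾ repeat rN pickBody ⨾ cond rN (say rX rU) skip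
      ⨾ (set rI 0 ⨾ set rW 0) ⨾ repeat rN pruneBody ⨾ mov rN rW

-- A round on n vertices costs at most c n² + 14 and leaves l ≤ n / 2 of them.
geometric-step : ∀ c m l n r → l + l ≤ n →
  (c + c) * (l * l) + m * 14 + (c * (n * n) + 14 + r) ≤ (c + c) * (n * n) + suc m * 14 + r
geometric-step c m l n r 2l≤n = begin
  (c + c) * (l * l) + m * 14 + (c * (n * n) + 14 + r) ≤⟨ +-monoˡ-≤ _ (+-monoˡ-≤ (m * 14) halved) ⟩
  c * (n * n) + m * 14 + (c * (n * n) + 14 + r)       ≡⟨ collect c (n * n) m r ⟩
  (c + c) * (n * n) + suc m * 14 + r                  ∎
  where
  open ≤-Reasoning
  collect : ∀ c q m r → c * q + m * 14 + (c * q + 14 + r) ≡ (c + c) * q + suc m * 14 + r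
  collect = solve-∀
  square : ∀ c l → (c + c) * (l * l) + (c + c) * (l * l) ≡ c * ((l + l) * (l + l))
  square = solve-∀
  halved : (c + c) * (l * l) ≤ c * (n * n)
  halved = ≤-trans (m≤m+n _ ((c + c) * (l * l)))
    (≤-trans (≤-reflexive (square c l)) (*-monoʳ-≤ c (*-mono-≤ 2l≤n 2l≤n)))

module Rounds (o : Oracle) where
  open Frame o
  module G (x : ℕ) = Greedy (λ u v → o x u x v)

  body : Cmd → State → State
  body P s = exec o P (tick 3 s)

  -- The 11 steps per vertex are 5 for the fetch, 3 for the other commands and 3 for the loop.
  count-loop : ∀ m xs s → m ≡ length xs → reg s one ≡ 1 → Segment (heap s) (reg s rW) xs →
    let s′ = loop m (body countBody) s in
    reg s′ rC ≡ reg s rC + G.outdeg (reg s rX) (reg s rJ) xs ×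
    clock s′ ≡ 11 * length xs + clock s
  count-loop .0 [] s refl h1 seg = sym (+-identityʳ _) , refl
  count-loop .(suc (length xs)) (v ∷ xs) s refl h1 (e , seg)
    with count-loop (length xs) xs (body countBody s) refl h1
           (subst (λ a → Segment (heap s) (a + reg s rW) xs) (sym h1) seg)
  ... | c≡ , t≡ = trans c≡ (trans (+-assoc (reg s rC) _ _)
        (cong (λ v → reg s rC + (bit (o (reg s rX) (reg s rJ) (reg s rX) v) + rest)) e)) ,
      trans t≡ (shuffle (length xs) (clock s))
    where
    rest = G.outdeg (reg s rX) (reg s rJ) xs
    shuffle : ∀ n c → 11 * n + (11 + c) ≡ 11 * suc n + c
    shuffle = solve-∀

  unless0-≤ : ∀ {a} {A : Set a} (g : A → ℕ) n {p q : A} {r} → g p ≤ r → g q ≤ r → g (unless0 n p q) ≤ r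
  unless0-≤ g zero    hp hq = hq
  unless0-≤ g (suc _) hp hq = hp

  unless0-suc : ∀ {a} {A : Set a} {n m} {p q : A} → n ≡ suc m → unless0 n p q ≡ p
  unless0-suc refl = refl

  unless0-zero : ∀ {a} {A : Set a} {n} {p q : A} → n ≡ zero → unless0 n p q ≡ q
  unless0-zero refl = refl

  pick-step : ∀ xs {j} s → reg s one ≡ 1 → reg s rN ≡ length xs → Segment (heap s) 0 xs →
    heap s (reg s rI) ≡ j → let d = G.outdeg (reg s rX) j xs; s′ = body pickTest s in
    reg s′ rU ≡ unless0 (length xs ∸ (d + d)) (reg s rU) j ×
    clock s′ ≤ 16 + 11 * length xs + clock s
  pick-step xs {j} s h1 hn seg e = u≡ , t≤
    where
    sa = body (fetch rJ rI ⨾ set rC 0 ⨾ set rW 0) s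
    sb = exec o (repeat rN countBody) sa
    sc = exec o (plus tmp rC rC ⨾ minus tmp rN tmp) sb
    d = G.outdeg (reg s rX) j xs
    counted = count-loop (reg s rN) xs (tick 1 sa) hn h1 seg
    c≡ : reg sb rC ≡ d
    c≡ = trans (proj₁ counted) (cong (λ j → G.outdeg (reg s rX) j xs) e)
    fixed : ∀ z → assigns z (repeat rN countBody) ≡ false → reg sb z ≡ reg sa z
    fixed z h = reg-fixed (repeat rN countBody) z sa h
    tmp≡ : reg sc tmp ≡ length xs ∸ (d + d)
    tmp≡ = cong₂ _∸_ (trans (fixed rN refl) hn) (cong₂ _+_ c≡ c≡)
    u≡ : reg (body pickTest s) rU ≡ unless0 (length xs ∸ (d + d)) (reg s rU) j
    u≡ = trans (unless0-map (λ s → reg s rU) (reg sc tmp) {tick 1 sc} {exec o (mov rU rJ) (tick 1 sc)})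
      (trans (cong (λ n → unless0 n (reg sc rU) (reg sc rJ)) tmp≡)
        (cong₂ (unless0 (length xs ∸ (d + d))) (fixed rU refl) (trans (fixed rJ refl) e)))
    clock-sc : clock sc ≡ 14 + (11 * length xs + clock s)
    clock-sc = trans (cong (3 +_) (proj₂ counted)) (shuffle (length xs) (clock s))
      where
      shuffle : ∀ n c → 3 + (11 * n + (11 + c)) ≡ 14 + (11 * n + c)
      shuffle = solve-∀
    t≤ : clock (body pickTest s) ≤ 16 + 11 * length xs + clock s
    t≤ = ≤-trans (unless0-≤ clock (reg sc tmp) {tick 1 sc} {exec o (mov rU rJ) (tick 1 sc)}
                   (n≤1+n (1 + clock sc)) ≤-refl)
                 (≤-reflexive (cong (2 +_) clock-sc))

  pick-loop : ∀ m js xs s → m ≡ length js → reg s one ≡ 1 → reg s rN ≡ length xs →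
    Segment (heap s) 0 xs → Segment (heap s) (reg s rI) js →
    let s′ = loop m (body pickBody) s in
    reg s′ rU ≡ G.choose (reg s rX) xs (reg s rU) js ×
    clock s′ ≤ length js * (17 + 11 * length xs) + clock s
  pick-loop .0 [] xs s refl h1 hn seg segⱼ = refl , ≤-refl
  pick-loop .(suc (length js)) (j ∷ js) xs s refl h1 hn seg (e , segⱼ) =
    trans (proj₁ ih) (trans (cong (λ x → G.choose x xs (reg s₀ rU) js) (fixed rX refl))
      (cong (λ u → G.choose (reg s rX) xs u js) (proj₁ stepped))) ,
    ≤-trans (proj₂ ih) (≤-trans (+-monoʳ-≤ (length js * k) (s≤s (proj₂ stepped)))
      (≤-reflexive (shuffle (length js * k) (17 + 11 * length xs) (clock s))))
    where
    k = 17 + 11 * length xs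
    s₀ = body pickTest s
    s₁ = body pickBody s
    stepped = pick-step xs s h1 hn seg e
    fixed : ∀ z → assigns z pickTest ≡ false → reg s₀ z ≡ reg s z
    fixed z h = reg-fixed pickTest z (tick 3 s) h
    same-heap : heap s₁ ≡ heap s
    same-heap = heap-fixed pickTest (tick 3 s) refl
    i≡ : reg s₁ rI ≡ suc (reg s rI)
    i≡ = cong₂ _+_ (trans (fixed one refl) h1) (fixed rI refl)
    ih = pick-loop (length js) js xs s₁ refl (trans (fixed one refl) h1) (trans (fixed rN refl) hn)
      (subst (λ h → Segment h 0 xs) (sym same-heap) seg)
      (subst₂ (λ h a → Segment h a js) (sym same-heap) (sym i≡) segⱼ)
    shuffle : ∀ a k c → a + (k + c) ≡ (k + a) + c
    shuffle = solve-∀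

  prune-∷-true : ∀ {x u v} vs → o x u x v ≡ true → G.prune x u (v ∷ vs) ≡ G.prune x u vs
  prune-∷-true vs e rewrite e = refl

  prune-∷-false : ∀ {x u v} vs → o x u x v ≡ false → G.prune x u (v ∷ vs) ≡ v ∷ G.prune x u vs
  prune-∷-false vs e rewrite e = refl

  Pruned : State → List ℕ → List ℕ → ℕ → State → Set
  Pruned s zs js c s′ = let ys = zs ++ G.prune (reg s rX) (reg s rU) js in
    Segment (heap s′) 0 ys × reg s′ rW ≡ length ys × clock s′ ≤ length js * 17 + c

  -- Compaction in place: `zs` holds the survivors so far and `js` the vertices still to be read. As
  -- `length zs ≤ reg s rI`, the write position never passes the read position, and a `put` leaves
  -- the unread part intact.
  prune-loop : ∀ m js zs s → m ≡ length js → reg s one ≡ 1 →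
    Segment (heap s) (reg s rI) js → Segment (heap s) 0 zs →
    reg s rW ≡ length zs → length zs ≤ reg s rI →
    Pruned s zs js (clock s) (loop m (body pruneBody) s)
  prune-loop .0 [] zs s refl h1 segⱼ seg hw le rewrite ++-identityʳ zs = seg , hw , ≤-refl
  prune-loop .(suc (length js)) (v ∷ js) zs s refl h1 (e , segⱼ) seg hw le
    = by-cases (o (reg s rX) (reg s rU) (reg s rX) v) refl
    where
    by-cases : ∀ r → o (reg s rX) (reg s rU) (reg s rX) v ≡ r → Pruned s zs (v ∷ js) (clock s) (loop (suc (length js)) (body pruneBody) s)
    by-cases true eq = subst (λ s₀ → Pruned s zs (v ∷ js) (clock s) (loop (length js) (body pruneBody) (exec o (plus rI one rI) s₀)))
          (sym (unless0-suc {n = reg sa tmp} (cong bit (trans (cong (o _ _ _) e) eq)))) post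
      where
      sa = body (fetch rJ rI ⨾ ask tmp rX rU rX rJ) s
      s₁ = exec o (plus rI one rI) (tick 1 sa)
      ih = prune-loop (length js) js zs s₁ refl h1
        (subst (λ a → Segment (heap s) (a + reg s rI) js) (sym h1) segⱼ) seg hw
        (≤-trans le (m≤n+m (reg s rI) (reg s one)))
      post : Pruned s zs (v ∷ js) (clock s) (loop (length js) (body pruneBody) s₁)
      post = subst (λ ys → Segment (heap (loop (length js) (body pruneBody) s₁)) 0 (zs ++ ys)) (sym p≡) (proj₁ ih) ,
        trans (proj₁ (proj₂ ih)) (cong (λ ys → length (zs ++ ys)) (sym p≡)) ,
        ≤-trans (proj₂ (proj₂ ih)) (≤-trans (+-monoʳ-≤ (length js * 17) (m≤n+m (11 + clock s) 6))
          (≤-reflexive (shuffle (length js) (clock s))))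
        where
        p≡ = prune-∷-true {reg s rX} {reg s rU} {v} js eq
        shuffle : ∀ l c → l * 17 + (6 + (11 + c)) ≡ suc l * 17 + c
        shuffle = solve-∀
    by-cases false eq = subst (λ s₀ → Pruned s zs (v ∷ js) (clock s) (loop (length js) (body pruneBody) (exec o (plus rI one rI) s₀)))
          (sym (unless0-zero {n = reg sa tmp} (cong bit (trans (cong (o _ _ _) e) eq)))) post
      where
      sa = body (fetch rJ rI ⨾ ask tmp rX rU rX rJ) s
      s₀ = exec o (put rW rJ ⨾ plus rW one rW) (tick 1 sa)
      s₁ = exec o (plus rI one rI) s₀
      len+1 : length (zs ++ [ v ]) ≡ suc (length zs)
      len+1 = trans (length-++ zs) (+-comm (length zs) 1)
      heap≡ : heap s₁ ≡ heap s [ length zs ≔ v ]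
      heap≡ = cong₂ (λ a b → heap s [ a ≔ b ]) hw e
      ih = prune-loop (length js) js (zs ++ [ v ]) s₁ refl h1
        (subst₂ (λ h a → Segment h (a + reg s rI) js) (sym heap≡) (sym h1)
          (segment-update (suc (reg s rI)) v js (s≤s le) segⱼ))
        (subst (λ h → Segment h 0 (zs ++ [ v ])) (sym heap≡) (segment-∷ʳ 0 zs v seg))
        (trans (cong₂ _+_ h1 hw) (sym len+1))
        (≤-trans (≤-reflexive len+1) (≤-trans (s≤s le) (≤-reflexive (cong (_+ reg s rI) (sym h1)))))
      post : Pruned s zs (v ∷ js) (clock s) (loop (length js) (body pruneBody) s₁)
      post = subst (Segment (heap (loop (length js) (body pruneBody) s₁)) 0) (sym p≡) (proj₁ ih) ,
        trans (proj₁ (proj₂ ih)) (cong length (sym p≡)) ,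
        ≤-trans (proj₂ (proj₂ ih)) (≤-reflexive (shuffle (length js) (clock s)))
        where
        p≡ = trans (cong (zs ++_) (prune-∷-false {reg s rX} {reg s rU} {v} js eq))
                   (sym (++-assoc zs [ v ] _))
        shuffle : ∀ l c → l * 17 + (17 + c) ≡ suc l * 17 + c
        shuffle = solve-∀

  chosen : ℕ → List ℕ → List ℕ
  chosen x []         = []
  chosen x xs@(_ ∷ _) = [ G.choose x xs 0 xs ]

  -- Choosing takes 17 + 11n steps for each vertex and pruning at most 17. The linear terms are
  -- absorbed by n ≤ n², whence 45 = 11 + 17 + 17.
  round-spec : ∀ xs s → reg s one ≡ 1 → reg s rN ≡ length xs → Segment (heap s) 0 xs →
    let s′ = exec o round s
        x = reg s rX
        ys = G.prune x (G.choose x xs 0 xs) xs in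
    Segment (heap s′) 0 ys × reg s′ rN ≡ length ys ×
    out s′ ≡ out s ++ pairs x (chosen x xs) ×
    clock s′ ≤ 45 * (length xs * length xs) + 11 + clock s
  round-spec xs s h1 hn seg =
    subst (λ u → Segment (heap s₆) 0 (G.prune x u xs)) u≡ seg₆ ,
    trans w₆ (cong (λ u → length (G.prune x u xs)) u≡) ,
    trans (out-fixed (repeat rN pruneBody) s₄ refl) (trans (out₃ xs hn refl)
      (cong (_++ pairs x (chosen x xs)) (out-fixed (repeat rN pickBody) s₁ refl))) ,
    t≤
    where
    x = reg s rX
    n = length xs
    s₁ = exec o (set rU 0 ⨾ set rI 0) s
    s₂ = exec o (repeat rN pickBody) s₁
    s₃ = exec o (cond rN (say rX rU) skip) s₂
    s₄ = exec o (set rI 0 ⨾ set rW 0) s₃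
    s₅ = exec o (repeat rN pruneBody) s₄
    s₆ = exec o (mov rN rW) s₅
    picked = pick-loop (reg s₁ rN) xs xs (tick 1 s₁) hn h1 hn seg seg
    fixed : ∀ z → assigns z (repeat rN pickBody) ≡ false →
            assigns z (cond rN (say rX rU) skip) ≡ false → reg s₃ z ≡ reg s₁ z
    fixed z h h′ = trans (reg-fixed (cond rN (say rX rU) skip) z s₂ h′)
                         (reg-fixed (repeat rN pickBody) z s₁ h)
    u₃ : reg s₃ rU ≡ reg s₂ rU
    u₃ = reg-fixed (cond rN (say rX rU) skip) rU s₂ refl
    u≡ : reg s₄ rU ≡ G.choose x xs 0 xs
    u≡ = trans u₃ (proj₁ picked)
    x₃ : reg s₃ rX ≡ x
    x₃ = fixed rX refl refl
    heap₃ : heap s₃ ≡ heap s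
    heap₃ = trans (heap-fixed (cond rN (say rX rU) skip) s₂ refl)
                  (heap-fixed (repeat rN pickBody) s₁ refl)
    pruned = prune-loop (reg s₄ rN) xs [] (tick 1 s₄) (trans (fixed rN refl refl) hn)
      (trans (fixed one refl refl) h1) (subst (λ h → Segment h 0 xs) (sym heap₃) seg) tt refl z≤n
    seg₆ : Segment (heap s₆) 0 (G.prune x (reg s₄ rU) xs)
    seg₆ = subst (λ x → Segment (heap s₆) 0 (G.prune x (reg s₄ rU) xs)) x₃ (proj₁ pruned)
    w₆ : reg s₆ rN ≡ length (G.prune x (reg s₄ rU) xs)
    w₆ = trans (proj₁ (proj₂ pruned)) (cong (λ x → length (G.prune x (reg s₄ rU) xs)) x₃)
    out₃ : ∀ ys → reg s rN ≡ length ys → ys ≡ xs → out s₃ ≡ out s₂ ++ pairs x (chosen x ys)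
    out₃ [] hn refl = trans (cong out (unless0-zero {n = reg s₂ rN}
      (trans (reg-fixed (repeat rN pickBody) rN s₁ refl) hn))) (sym (++-identityʳ (out s₂)))
    out₃ (y ∷ ys) hn refl = trans (cong out (unless0-suc {n = reg s₂ rN}
      (trans (reg-fixed (repeat rN pickBody) rN s₁ refl) hn)))
      (cong₂ (λ a b → out s₂ ++ [ a , b ]) (reg-fixed (repeat rN pickBody) rX s₁ refl) (proj₁ picked))
    t≤ : clock s₆ ≤ 45 * (n * n) + 11 + clock s
    t≤ = begin
      clock s₆                                      ≤⟨ s≤s (s≤s (proj₂ (proj₂ pruned))) ⟩
      2 + (n * 17 + (3 + clock s₃))                 ≤⟨ +-monoʳ-≤ 2 (+-monoʳ-≤ (n * 17) (+-monoʳ-≤ 3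
                                                         (unless0-≤ clock (reg s₂ rN) {exec o (say rX rU) (tick 1 s₂)} {tick 1 s₂} ≤-refl (n≤1+n _)))) ⟩
      2 + (n * 17 + (5 + clock s₂))                 ≤⟨ +-monoʳ-≤ 2 (+-monoʳ-≤ (n * 17) (+-monoʳ-≤ 6 (proj₂ picked))) ⟩
      2 + (n * 17 + (6 + (n * (17 + 11 * n) + (3 + clock s)))) ≡⟨ shuffle₁ n (clock s) ⟩
      34 * n + (11 * (n * n) + 11 + clock s)        ≤⟨ +-monoˡ-≤ _ (*-monoʳ-≤ 34 (n≤n*n n)) ⟩
      34 * (n * n) + (11 * (n * n) + 11 + clock s)  ≡⟨ shuffle₂ (n * n) (clock s) ⟩
      45 * (n * n) + 11 + clock s                   ∎
      where
      open ≤-Reasoning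
      n≤n*n : ∀ n → n ≤ n * n
      n≤n*n zero    = z≤n
      n≤n*n (suc n) = m≤m*n (suc n) (suc n)
      shuffle₁ : ∀ n c → 2 + (n * 17 + (6 + (n * (17 + 11 * n) + (3 + c)))) ≡ 34 * n + (11 * (n * n) + 11 + c)
      shuffle₁ = solve-∀
      shuffle₂ : ∀ n c → 34 * n + (11 * n + 11 + c) ≡ 45 * n + 11 + c
      shuffle₂ = solve-∀

  dominators-step : ∀ x m xs → G.dominators x (suc m) xs ≡
    chosen x xs ++ G.dominators x m (G.prune x (G.choose x xs 0 xs) xs)
  dominators-step x zero    []       = refl
  dominators-step x (suc m) []       = refl
  dominators-step x m       (_ ∷ _)  = refl

  prune-halves : ∀ x xs → G.Semicomplete x xs →
    let ys = G.prune x (G.choose x xs 0 xs) xs in length ys + length ys ≤ length xs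
  prune-halves x []       h = z≤n
  prune-halves x (y ∷ ys) h =
    G.length-prune-popular x (y ∷ ys) _ (proj₁ (G.choose-popular x y ys h))

  RoundResult : List ℕ → State → State → Set
  RoundResult xs s s′ = let x = reg s rX; ys = G.prune x (G.choose x xs 0 xs) xs in
    Segment (heap s′) 0 ys × reg s′ rN ≡ length ys ×
    out s′ ≡ out s ++ pairs x (chosen x xs) ×
    clock s′ ≤ 45 * (length xs * length xs) + 14 + clock s ×
    reg s′ rX ≡ x × reg s′ one ≡ 1

  round-result : ∀ xs s → reg s one ≡ 1 → reg s rN ≡ length xs → Segment (heap s) 0 xs →
                 RoundResult xs s (body round s)
  round-result xs s h1 hn seg =
    let seg₁ , n₁ , out₁ , t₁ = round-spec xs (tick 3 s) h1 hn seg in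
    seg₁ , n₁ , out₁ ,
    ≤-trans t₁ (≤-reflexive (shuffle (45 * (length xs * length xs)) (clock s))) ,
    reg-fixed round rX (tick 3 s) refl , trans (reg-fixed round one (tick 3 s) refl) h1
    where
    shuffle : ∀ a c → a + 11 + (3 + c) ≡ a + 14 + c
    shuffle = solve-∀

  -- The lists halve, so the quadratic costs form a geometric series, and 90 is twice the 45 of one
  -- round. Abstracting over `f` exposes only the specification of a round to the induction.
  rounds-spec : ∀ (f : State → State) →
    (∀ xs s → reg s one ≡ 1 → reg s rN ≡ length xs → Segment (heap s) 0 xs → RoundResult xs s (f s)) →
    ∀ m xs s → G.Semicomplete (reg s rX) xs →
    reg s one ≡ 1 → reg s rN ≡ length xs → Segment (heap s) 0 xs →
    let s′ = loop m f s in
    out s′ ≡ out s ++ pairs (reg s rX) (G.dominators (reg s rX) m xs) ×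
    clock s′ ≤ 90 * (length xs * length xs) + m * 14 + clock s
  rounds-spec f spec zero    xs s semi h1 hn seg = sym (++-identityʳ (out s)) , m≤n+m (clock s) _
  rounds-spec f spec (suc m) xs s semi h1 hn seg with spec xs s h1 hn seg
  ... | seg₁ , n₁ , out₁ , t₁ , x₁ , one₁ = out≡ , t≤
    where
    x = reg s rX
    s₁ = f s
    n = length xs
    ys = G.prune x (G.choose x xs 0 xs) xs
    l = length ys
    ih = rounds-spec f spec m ys s₁
      (subst (λ x → G.Semicomplete x ys) (sym x₁) (G.prune-semicomplete x xs semi)) one₁ n₁ seg₁
    out≡ : out (loop m f s₁) ≡ out s ++ pairs x (G.dominators x (suc m) xs)
    out≡ = begin
      out (loop m f s₁)  ≡⟨ proj₁ ih ⟩
      out s₁ ++ pairs (reg s₁ rX) (G.dominators (reg s₁ rX) m ys) ≡⟨ cong (λ x → out s₁ ++ pairs x (G.dominators x m ys)) x₁ ⟩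
      out s₁ ++ pairs x ds          ≡⟨ cong (_++ pairs x ds) out₁ ⟩
      (out s ++ pairs x (chosen x xs)) ++ pairs x ds ≡⟨ ++-assoc (out s) _ _ ⟩
      out s ++ (pairs x (chosen x xs) ++ pairs x ds) ≡⟨ cong (out s ++_) (sym (map-++ (x ,_) (chosen x xs) ds)) ⟩
      out s ++ pairs x (chosen x xs ++ ds) ≡⟨ cong (λ zs → out s ++ pairs x zs) (sym (dominators-step x m xs)) ⟩
      out s ++ pairs x (G.dominators x (suc m) xs) ∎
      where
      open ≡-Reasoning
      ds = G.dominators x m ys
    t≤ : clock (loop m f s₁) ≤ 90 * (n * n) + suc m * 14 + clock s
    t≤ = ≤-trans (proj₂ ih) (≤-trans (+-monoʳ-≤ (90 * (l * l) + m * 14) t₁)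
      (geometric-step 45 m l n (clock s) (prune-halves x xs semi)))

-- Code and analysis of stars, triangles and blocks

hitTest hitBody candTest candBody starBody rowBody triBody blockCmd blocksBody : Cmd

-- The truncated differences decide the order of the two indices. Queries must name the smaller
-- index first, since ill-formed ones have arbitrary answers; equal indices ask nothing.
hitTest = minus tmp rJ rI ⨾ cond tmp
  (ask tmp rI rJ rX rJ ⨾ plus rD rD tmp)
  (minus tmp rI rJ ⨾ cond tmp (ask tmp rJ rI rX rJ ⨾ plus rD rD tmp) skip)

hitBody = hitTest ⨾ plus rI one rI

candTest = (set rD 0 ⨾ mov rI rA) ⨾ repeat rLen hitBody ⨾ cond rD skip (put rN rJ ⨾ plus rN one rN)

candBody = candTest ⨾ plus rJ one rJ

starBody = (set rN 0 ⨾ mov rJ rA) ⨾ repeat rLen candBody ⨾ repeat rT round ⨾ plus rX one rX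

rowBody = plus rJ one rJ ⨾ say rX rJ

triBody = (minus rC rC one ⨾ mov rJ rX) ⨾ repeat rC rowBody ⨾ plus rX one rX

blockCmd = (minus tmp rB rR ⨾ minus rLen rB tmp ⨾ set rX 0) ⨾ repeat rA starBody
         ⨾ (mov rX rA ⨾ mov rC rLen) ⨾ repeat rLen triBody ⨾ plus rA rA rB

blocksBody = minus rR rK rA ⨾ cond rR blockCmd skip

-- E i m is what the iteration with counter i outputs when m more follow.
loop-emits : (Inv : ℕ → ℕ → State → Set) (E L : ℕ → ℕ → List (ℕ × ℕ)) (W : ℕ) (f : State → State) →
  (∀ i → L i 0 ≡ []) → (∀ i m → L i (suc m) ≡ E i m ++ L (suc i) m) →
  (∀ i m s → Inv i (suc m) s →
    Inv (suc i) m (f s) × out (f s) ≡ out s ++ E i m × clock (f s) ≤ W + clock s) →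
  ∀ i m s → Inv i m s →
  out (loop m f s) ≡ out s ++ L i m × clock (loop m f s) ≤ m * W + clock s
loop-emits Inv E L W f L0 LS h i zero s inv rewrite L0 i = sym (++-identityʳ (out s)) , ≤-refl
loop-emits Inv E L W f L0 LS h i (suc m) s inv with h i m s inv
... | inv₁ , out₁ , t₁ with loop-emits Inv E L W f L0 LS h (suc i) m (f s) inv₁
...   | out₂ , t₂ =
  trans out₂ (trans (cong (_++ L (suc i) m) out₁) (trans (++-assoc (out s) _ _)
    (cong (out s ++_) (sym (LS i m))))) ,
  ≤-trans t₂ (≤-trans (+-monoʳ-≤ (m * W) t₁) (≤-reflexive (shuffle (m * W) W (clock s))))
  where
  shuffle : ∀ a b c → a + (b + c) ≡ b + a + c
  shuffle = solve-∀

module BlockProgram (o : Oracle) (k b t : ℕ) where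
  open Frame o
  open Rounds o using (body; unless0-≤; unless0-suc; unless0-zero; round-result; rounds-spec)
  open Blocks o k b t

  hit-step : ∀ s → let i = reg s rI; j = reg s rJ; x = reg s rX in
    reg (body hitTest s) rD ≡ reg s rD + hit x j i × clock (body hitTest s) ≤ 9 + clock s
  hit-step s =
    trans (unless0-map (λ s → reg s rD) (j ∸ i) {s₁} {s₂})
      (trans (cong (unless0 (j ∸ i) (d + p)) (unless0-map (λ s → reg s rD) (i ∸ j) {s₃} {s₄}))
        (distribute (j ∸ i) (i ∸ j) p q d)) ,
    unless0-≤ clock (j ∸ i) {s₁} {s₂} (+-monoˡ-≤ (clock s) (s≤s (s≤s (s≤s (s≤s (s≤s (s≤s (s≤s z≤n))))))))
      (unless0-≤ clock (i ∸ j) {s₃} {s₄} ≤-refl (+-monoˡ-≤ (clock s) (s≤s (s≤s (s≤s (s≤s (s≤s (s≤s (s≤s z≤n)))))))))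
    where
    i = reg s rI
    j = reg s rJ
    x = reg s rX
    d = reg s rD
    p = bit (o i j x j)
    q = bit (o j i x j)
    s₀ = body (minus tmp rJ rI) s
    s₁ = exec o (ask tmp rI rJ rX rJ ⨾ plus rD rD tmp) (tick 1 s₀)
    s₂ = exec o (minus tmp rI rJ ⨾ cond tmp (ask tmp rJ rI rX rJ ⨾ plus rD rD tmp) skip) (tick 1 s₀)
    s₃ = exec o (ask tmp rJ rI rX rJ ⨾ plus rD rD tmp) (tick 1 (exec o (minus tmp rI rJ) (tick 1 s₀)))
    s₄ = tick 1 (exec o (minus tmp rI rJ) (tick 1 s₀))
    distribute : ∀ v w p q d → unless0 v (d + p) (unless0 w (d + q) d) ≡ d + unless0 v p (unless0 w q 0)
    distribute (suc _) w       p q d = refl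
    distribute zero    (suc _) p q d = refl
    distribute zero    zero    p q d = sym (+-identityʳ d)

  hit-loop : ∀ m s {x j i} → reg s one ≡ 1 → reg s rX ≡ x → reg s rJ ≡ j → reg s rI ≡ i →
    let s′ = loop m (body hitBody) s in
    reg s′ rD ≡ reg s rD + hits x j (range i m) × clock s′ ≤ m * 10 + clock s
  hit-loop zero s h1 refl refl refl = sym (+-identityʳ _) , ≤-refl
  hit-loop (suc m) s {x} {j} {i} h1 refl refl refl =
    trans (proj₁ ih) (trans (cong (_+ hits x j (range (suc i) m)) (proj₁ stepped)) (+-assoc (reg s rD) _ _)) ,
    ≤-trans (proj₂ ih) (≤-trans (+-monoʳ-≤ (m * 10) (s≤s (proj₂ stepped)))
      (≤-reflexive (shuffle m (clock s))))
    where
    stepped = hit-step s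
    fixed : ∀ z → assigns z hitTest ≡ false → reg (body hitTest s) z ≡ reg s z
    fixed z h = reg-fixed hitTest z (tick 3 s) h
    ih = hit-loop m (body hitBody s) {x} {j} {suc i} (trans (fixed one refl) h1)
      (fixed rX refl) (fixed rJ refl) (cong₂ _+_ (trans (fixed one refl) h1) (fixed rI refl))
    shuffle : ∀ m c → m * 10 + (10 + c) ≡ suc m * 10 + c
    shuffle = solve-∀

  candidates-∷-hit : ∀ {x j h} B js → hits x j B ≡ suc h → candidates x B (j ∷ js) ≡ candidates x B js
  candidates-∷-hit B js e rewrite e = refl

  candidates-∷-free : ∀ {x j} B js → hits x j B ≡ 0 → candidates x B (j ∷ js) ≡ j ∷ candidates x B js
  candidates-∷-free B js e rewrite e = refl

  record CandState (x a n : ℕ) (s : State) : Set where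
    constructor candState
    field
      one≡ : reg s one ≡ 1
      x≡   : reg s rX ≡ x
      a≡   : reg s rA ≡ a
      n≡   : reg s rLen ≡ n

  Collected : ℕ → ℕ → ℕ → List ℕ → ℕ → ℕ → ℕ → State → Set
  Collected x a n zs j m c s′ = let ys = zs ++ candidates x (range a n) (range j m) in
    Segment (heap s′) 0 ys × reg s′ rN ≡ length ys × clock s′ ≤ m * (15 + n * 10) + c

  -- `zs` are the candidates already written to the first heap cells, with `rN` serving both as
  -- their number and as the next free address.
  cand-loop : ∀ m zs s {x a n j} → CandState x a n s → reg s rJ ≡ j →
    Segment (heap s) 0 zs → reg s rN ≡ length zs →
    Collected x a n zs j m (clock s) (loop m (body candBody) s)
  cand-loop zero zs s cs hj seg hn rewrite ++-identityʳ zs = seg , hn , ≤-refl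
  cand-loop (suc m) zs s {x} {a} {n} {j} (candState h1 refl refl hl) refl seg hn =
    by-cases (hits x j B) refl
    where
    B = range a n
    Goal = Collected x a n zs j (suc m) (clock s)
    sa = body (set rD 0 ⨾ mov rI rA) s
    sb = exec o (repeat rLen hitBody) sa
    hit-all = hit-loop (reg s rLen) (tick 1 sa) {x} {j} {a} h1 refl refl refl
    d≡ : reg sb rD ≡ hits x j B
    d≡ = trans (proj₁ hit-all) (cong (λ n → hits x j (range a n)) hl)
    fixed : ∀ z → assigns z (repeat rLen hitBody) ≡ false → reg sb z ≡ reg sa z
    fixed z h = reg-fixed (repeat rLen hitBody) z sa h
    heap-sb : heap sb ≡ heap s
    heap-sb = heap-fixed (repeat rLen hitBody) sa refl
    clock-sb : clock sb ≤ 7 + n * 10 + clock s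
    clock-sb = ≤-trans (s≤s (proj₂ hit-all)) (≤-reflexive
      (trans (shuffle (reg s rLen) (clock s)) (cong (λ n → 7 + n * 10 + clock s) hl)))
      where
      shuffle : ∀ n c → 1 + (n * 10 + (6 + c)) ≡ 7 + n * 10 + c
      shuffle = solve-∀
    finish : State → State
    finish s₀ = loop m (body candBody) (exec o (plus rJ one rJ) s₀)
    one≡ = trans (fixed one refl) h1
    total : ∀ {c c′} → c ≤ m * (15 + n * 10) + c′ → c′ ≤ 15 + n * 10 + clock s →
            c ≤ suc m * (15 + n * 10) + clock s
    total p q = ≤-trans p (≤-trans (+-monoʳ-≤ (m * (15 + n * 10)) q)
      (≤-reflexive (shuffle m (15 + n * 10) (clock s))))
      where
      shuffle : ∀ m w c → m * w + (w + c) ≡ suc m * w + c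
      shuffle = solve-∀
    by-cases : ∀ h → hits x j B ≡ h → Goal (loop (suc m) (body candBody) s)
    by-cases (suc h) eq = subst (λ s₀ → Goal (finish s₀))
      (sym (unless0-suc {n = reg sb rD} (trans d≡ eq))) post
      where
      s₀ = tick 1 sb
      ih = cand-loop m zs (exec o (plus rJ one rJ) s₀) {x} {a} {n} {suc j}
        (candState one≡ (fixed rX refl) (fixed rA refl) (trans (fixed rLen refl) hl))
        (cong₂ _+_ one≡ (fixed rJ refl))
        (subst (λ h → Segment h 0 zs) (sym heap-sb) seg) (trans (fixed rN refl) hn)
      p≡ = sym (candidates-∷-hit {x} {j} B (range (suc j) m) eq)
      post : Goal (finish s₀)
      post = subst (λ ys → Segment (heap (finish s₀)) 0 (zs ++ ys)) p≡ (proj₁ ih) ,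
        trans (proj₁ (proj₂ ih)) (cong (λ ys → length (zs ++ ys)) p≡) ,
        total (proj₂ (proj₂ ih)) (+-mono-≤ {2} {8} (s≤s (s≤s z≤n)) clock-sb)
    by-cases zero eq = subst (λ s₀ → Goal (finish s₀))
      (sym (unless0-zero {n = reg sb rD} (trans d≡ eq))) post
      where
      s₀ = exec o (put rN rJ ⨾ plus rN one rN) (tick 1 sb)
      heap≡ : heap s₀ ≡ heap s [ length zs ≔ j ]
      heap≡ = trans (cong (λ h → h [ reg sb rN ≔ reg sb rJ ]) heap-sb)
        (cong₂ (λ a b → heap s [ a ≔ b ]) (trans (fixed rN refl) hn) (fixed rJ refl))
      ih = cand-loop m (zs ++ [ j ]) (exec o (plus rJ one rJ) s₀) {x} {a} {n} {suc j}
        (candState one≡ (fixed rX refl) (fixed rA refl) (trans (fixed rLen refl) hl))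
        (cong₂ _+_ one≡ (fixed rJ refl))
        (subst (λ h → Segment h 0 (zs ++ [ j ])) (sym heap≡) (segment-∷ʳ 0 zs j seg))
        (trans (cong₂ _+_ one≡ (trans (fixed rN refl) hn))
               (sym (trans (length-++ zs) (+-comm (length zs) 1))))
      p≡ = trans (++-assoc zs [ j ] _)
             (cong (zs ++_) (sym (candidates-∷-free {x} {j} B (range (suc j) m) eq)))
      post : Goal (finish s₀)
      post = subst (Segment (heap (finish s₀)) 0) p≡ (proj₁ ih) ,
        trans (proj₁ (proj₂ ih)) (cong length p≡) ,
        total (proj₂ (proj₂ ih)) (+-monoʳ-≤ 8 clock-sb)

  -- The summands are the quadratic part of the rounds, the overhead of the `t` rounds, and the
  -- collection of candidates, with up to `n` hit tests for each index.
  starCost : ℕ → ℕ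
  starCost n = 90 * (n * n) + t * 14 + (n * (15 + n * 10) + 10)

  module _ (valid : CherryOracle k o) where

    -- The validity of the oracle already matters for the time: semicompleteness makes the rounds
    -- shrink geometrically.
    star-spec : ∀ s {x a n} → CandState x a n s → reg s rT ≡ t → x < a → a + n ≤ k →
      out (body starBody s) ≡ out s ++ star x (range a n) ×
      clock (body starBody s) ≤ starCost n + clock s
    star-spec s {x} {a} {n} (candState h1 refl refl hl) ht x<a a+n≤k = out≡ , t≤
      where
      cs = candidates x (range a n) (range a n)
      s₁ = body (set rN 0 ⨾ mov rJ rA) s
      s₂ = exec o (repeat rLen candBody) s₁
      s₃ = exec o (repeat rT round) s₂
      collected : Collected x a n [] a (reg s rLen) (clock (tick 1 s₁)) (loop (reg s rLen) (body candBody) (tick 1 s₁))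
      collected = cand-loop (reg s rLen) [] (tick 1 s₁) {x} {a} {n} {a} (candState h1 refl refl hl) refl tt refl
      collected′ : Collected x a n [] a n (clock (tick 1 s₁)) (loop (reg s rLen) (body candBody) (tick 1 s₁))
      collected′ = subst (λ l → Collected x a n [] a l (clock (tick 1 s₁)) (loop (reg s rLen) (body candBody) (tick 1 s₁))) hl collected
      fixed : ∀ z → assigns z (repeat rLen candBody) ≡ false → reg s₂ z ≡ reg s₁ z
      fixed z h = reg-fixed (repeat rLen candBody) z s₁ h
      semi = candidates-semicomplete valid x a n x<a a+n≤k
      rounds = rounds-spec (body round) round-result (reg s₂ rT) cs (tick 1 s₂)
        (subst (λ x → G.Semicomplete x cs) (sym (fixed rX refl)) semi)
        (trans (fixed one refl) h1) (proj₁ (proj₂ collected′)) (proj₁ collected′)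
      out≡ : out (body starBody s) ≡ out s ++ star x (range a n)
      out≡ = trans (proj₁ rounds) (cong₂ _++_ (out-fixed (repeat rLen candBody) s₁ refl)
        (cong₂ (λ x t → pairs x (G.dominators x t cs)) (fixed rX refl) (trans (fixed rT refl) ht)))
      t≤ : clock (body starBody s) ≤ starCost n + clock s
      t≤ = begin
        2 + clock (loop (reg s₂ rT) (body round) (tick 1 s₂)) ≤⟨ +-monoʳ-≤ 2 (proj₂ rounds) ⟩
        2 + (90 * (length cs * length cs) + reg s₂ rT * 14 + (1 + clock s₂)) ≤⟨ +-monoʳ-≤ 2 (+-mono-≤
          (+-mono-≤ (*-monoʳ-≤ 90 (*-mono-≤ short short)) (≤-reflexive (cong (_* 14) (trans (fixed rT refl) ht))))
          (+-monoʳ-≤ 2 (proj₂ (proj₂ collected′)))) ⟩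
        2 + (90 * (n * n) + t * 14 + (2 + (n * (15 + n * 10) + (6 + clock s)))) ≡⟨ shuffle (90 * (n * n)) (t * 14) (n * (15 + n * 10)) (clock s) ⟩
        starCost n + clock s ∎
        where
        open ≤-Reasoning
        short : length cs ≤ n
        short = length-candidates valid x a n x<a a+n≤k
        shuffle : ∀ p q r c → 2 + (p + q + (2 + (r + (6 + c)))) ≡ p + q + (r + 10) + c
        shuffle = solve-∀

    StarInv : ℕ → ℕ → ℕ → ℕ → State → Set
    StarInv a n x m s = CandState x a n s × reg s rT ≡ t × x + m ≤ a

    stars-loop : ∀ s {a n} → CandState 0 a n s → reg s rT ≡ t → a + n ≤ k →
      let s′ = loop a (body starBody) s in
      out s′ ≡ out s ++ stars 0 a (range a n) × clock s′ ≤ a * starCost n + clock s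
    stars-loop s {a} {n} cs ht a+n≤k = loop-emits (StarInv a n) (λ x _ → star x (range a n))
      (λ x m → stars x m (range a n)) (starCost n) (body starBody) (λ _ → refl) (λ _ _ → refl)
      iteration 0 a s (cs , ht , ≤-refl)
      where
      iteration : ∀ x m s → StarInv a n x (suc m) s → StarInv a n (suc x) m (body starBody s) ×
        out (body starBody s) ≡ out s ++ star x (range a n) ×
        clock (body starBody s) ≤ starCost n + clock s
      iteration x m s (cs@(candState h1 hx ha hl) , ht , le) =
        (candState (trans (fixed one refl) h1)
                   (cong₂ _+_ (trans (fixed′ one refl) h1) (trans (fixed′ rX refl) hx))
                   (trans (fixed rA refl) ha) (trans (fixed rLen refl) hl) ,
         trans (fixed rT refl) ht , ≤-trans (≤-reflexive (sym (+-suc x m))) le) ,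
        star-spec s cs ht (<-≤-trans (m<m+n x (s≤s z≤n)) le) a+n≤k
        where
        fixed : ∀ z → assigns z starBody ≡ false → reg (body starBody s) z ≡ reg s z
        fixed z h = reg-fixed starBody z (tick 3 s) h
        front = (set rN 0 ⨾ mov rJ rA) ⨾ repeat rLen candBody ⨾ repeat rT round
        fixed′ : ∀ z → assigns z front ≡ false → reg (body front s) z ≡ reg s z
        fixed′ z h = reg-fixed front z (tick 3 s) h

  RowInv : ℕ → ℕ → ℕ → State → Set
  RowInv x j m s = reg s one ≡ 1 × reg s rX ≡ x × reg s rJ ≡ j

  row-loop : ∀ m s {x j} → RowInv x j m s →
    let s′ = loop m (body rowBody) s in
    out s′ ≡ out s ++ pairs x (range (suc j) m) × clock s′ ≤ m * 5 + clock s
  row-loop m s {x} {j} inv = loop-emits (RowInv x) (λ j _ → [ x , suc j ])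
    (λ j m → pairs x (range (suc j) m)) 5 (body rowBody) (λ _ → refl) (λ _ _ → refl)
    (λ { j m s (h1 , hx , hj) → (h1 , hx , cong₂ _+_ h1 hj) ,
         cong₂ (λ a b → out s ++ [ a , b ]) hx (cong₂ _+_ h1 hj) , ≤-refl }) j m s inv

  -- `rC` falls with the number of rows left and supplies the row lengths; `m ≤ n` lets every row be
  -- charged as a longest one.
  TriInv : ℕ → ℕ → ℕ → State → Set
  TriInv n x m s = reg s one ≡ 1 × reg s rX ≡ x × reg s rC ≡ m × m ≤ n

  triangle-loop : ∀ n s {x} → TriInv n x n s →
    let s′ = loop n (body triBody) s in
    out s′ ≡ out s ++ triangle x n × clock s′ ≤ n * (8 + n * 5) + clock s
  triangle-loop n s {x} inv = loop-emits (TriInv n) (λ x m → pairs x (range (suc x) m))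
    triangle (8 + n * 5) (body triBody) (λ _ → refl) (λ _ _ → refl) iteration x n s inv
    where
    iteration : ∀ x m s → TriInv n x (suc m) s → TriInv n (suc x) m (body triBody s) ×
      out (body triBody s) ≡ out s ++ pairs x (range (suc x) m) ×
      clock (body triBody s) ≤ 8 + n * 5 + clock s
    iteration x m s (h1 , refl , hc , m<n) =
      (trans (fixed one refl) h1 , cong₂ _+_ (trans (fixed one refl) h1) (fixed rX refl) ,
       trans (fixed rC refl) c≡ , <⇒≤ m<n) ,
      trans (proj₁ row) (cong (λ m → out s ++ pairs x (range (suc x) m)) c≡) ,
      ≤-trans (+-monoʳ-≤ 2 (proj₂ row)) (≤-trans (≤-reflexive (shuffle (reg s₁ rC) (clock s)))
        (+-monoˡ-≤ (clock s) (+-monoʳ-≤ 8 (*-monoˡ-≤ 5 (≤-trans (≤-reflexive c≡) (<⇒≤ m<n))))))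
      where
      s₁ = body (minus rC rC one ⨾ mov rJ rX) s
      c≡ : reg s₁ rC ≡ m
      c≡ = cong₂ _∸_ hc h1
      fixed : ∀ z → assigns z (repeat rC rowBody) ≡ false →
              reg (exec o (repeat rC rowBody) s₁) z ≡ reg s₁ z
      fixed z h = reg-fixed (repeat rC rowBody) z s₁ h
      row = row-loop (reg s₁ rC) (tick 1 s₁) {x} {x} (h1 , refl , refl)
      shuffle : ∀ m c → 2 + (m * 5 + (6 + c)) ≡ 8 + m * 5 + c
      shuffle = solve-∀

module BlocksProgram (o : Oracle) (k b t : ℕ) (valid : CherryOracle k o) where
  open Frame o
  open Rounds o using (body; unless0-≤; unless0-suc; unless0-zero)
  open BlockProgram o k b t
  open Blocks o k b t

  BlocksInv : ℕ → State → Set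
  BlocksInv a s = reg s one ≡ 1 × reg s rK ≡ k × reg s rB ≡ b × reg s rT ≡ t × reg s rA ≡ a

  blockCost : ℕ → ℕ
  blockCost a = 10 + (a * starCost (blockSize a) + blockSize a * (8 + blockSize a * 5))

  block-spec : ∀ s {a} → BlocksInv a s → reg s rR ≡ k ∸ a → a ≤ k →
    let s′ = exec o blockCmd s in
    out s′ ≡ out s ++ block a × BlocksInv (a + b) s′ × clock s′ ≤ blockCost a + clock s
  block-spec s {a} (h1 , hk , hb , ht , refl) hr a≤k = out≡ ,
    (trans (fixed one refl) h1 , trans (fixed rK refl) hk , trans (fixed rB refl) hb ,
     trans (fixed rT refl) ht , cong₂ _+_ (fixed rA refl) (trans (fixed rB refl) hb)) , t≤
    where
    n = blockSize a
    s₁ = exec o (minus tmp rB rR ⨾ minus rLen rB tmp ⨾ set rX 0) s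
    s₂ = exec o (repeat rA starBody) s₁
    s₃ = exec o (mov rX rA ⨾ mov rC rLen) s₂
    s₄ = exec o (repeat rLen triBody) s₃
    len : reg s₁ rLen ≡ n
    len = cong₂ _∸_ hb (cong₂ _∸_ hb hr)
    stars-result = stars-loop valid (tick 1 s₁) (candState h1 refl refl len) ht
      (≤-trans (+-monoʳ-≤ a (blockSize≤rest a)) (≤-reflexive (m+[n∸m]≡n a≤k)))
    fixed₂ : ∀ z → assigns z (repeat rA starBody) ≡ false → reg s₂ z ≡ reg s₁ z
    fixed₂ z h = reg-fixed (repeat rA starBody) z s₁ h
    len₂ : reg s₃ rLen ≡ n
    len₂ = trans (fixed₂ rLen refl) len
    triangle-result = triangle-loop n (tick 1 s₃) {a}
      (trans (fixed₂ one refl) h1 , fixed₂ rA refl , len₂ , ≤-refl)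
    s₄≡ : s₄ ≡ tick 1 (loop n (body triBody) (tick 1 s₃))
    s₄≡ = cong (λ n → tick 1 (loop n (body triBody) (tick 1 s₃))) len₂
    front = (minus tmp rB rR ⨾ minus rLen rB tmp ⨾ set rX 0) ⨾ repeat rA starBody
          ⨾ (mov rX rA ⨾ mov rC rLen) ⨾ repeat rLen triBody
    fixed : ∀ z → assigns z front ≡ false → reg s₄ z ≡ reg s z
    fixed z h = reg-fixed front z s h
    out≡ : out s₄ ≡ out s ++ block a
    out≡ = trans (cong out s₄≡) (trans (proj₁ triangle-result)
      (trans (cong (_++ triangle a n) (proj₁ stars-result)) (++-assoc (out s) _ _)))
    t≤ : 1 + clock s₄ ≤ blockCost a + clock s
    t≤ = begin
      1 + clock s₄                                     ≡⟨ cong (λ s → 1 + clock s) s₄≡ ⟩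
      2 + clock (loop n (body triBody) (tick 1 s₃))    ≤⟨ +-monoʳ-≤ 2 (proj₂ triangle-result) ⟩
      2 + (n * (8 + n * 5) + (4 + clock (loop a (body starBody) (tick 1 s₁)))) ≤⟨ +-monoʳ-≤ 2
        (+-monoʳ-≤ (n * (8 + n * 5)) (+-monoʳ-≤ 4 (proj₂ stars-result))) ⟩
      2 + (n * (8 + n * 5) + (4 + (a * starCost n + (4 + clock s)))) ≡⟨ shuffle (n * (8 + n * 5)) (a * starCost n) (clock s) ⟩
      blockCost a + clock s                            ∎
      where
      open ≤-Reasoning
      shuffle : ∀ p q c → 2 + (p + (4 + (q + (4 + c)))) ≡ 10 + (q + p) + c
      shuffle = solve-∀

  BlocksStep : ℕ → State → State → Set
  BlocksStep a s s′ =
    (a < k → out s′ ≡ out s ++ block a × BlocksInv (a + b) s′ × clock s′ ≤ 5 + blockCost a + clock s) ×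
    (k ≤ a → out s′ ≡ out s × BlocksInv a s′ × clock s′ ≤ 5 + clock s)

  blocks-step-spec : ∀ s {a} → BlocksInv a s → BlocksStep a s (body blocksBody s)
  blocks-step-spec s {a} (h1 , hk , hb , ht , refl) = active , idle
    where
    a′ = reg s rA
    s₁ = body (minus rR rK rA) s
    r≡ : reg s₁ rR ≡ k ∸ a′
    r≡ = cong (_∸ a′) hk
    active : a′ < k → out (body blocksBody s) ≡ out s ++ block a′ × BlocksInv (a′ + b) (body blocksBody s) ×
             clock (body blocksBody s) ≤ 5 + blockCost a′ + clock s
    active a<k = subst (λ s′ → out s′ ≡ out s ++ block a′ × BlocksInv (a′ + b) s′ ×
                                clock s′ ≤ 5 + blockCost a′ + clock s)
      (sym (unless0-suc {n = reg s₁ rR} (trans r≡ (sym (suc-pred (k ∸ a′) {{>-nonZero (m<n⇒0<n∸m a<k)}})))))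
      (let r = block-spec (tick 1 s₁) {a′} (h1 , hk , hb , ht , refl) r≡ (<⇒≤ a<k) in
       proj₁ r , proj₁ (proj₂ r) ,
       ≤-trans (proj₂ (proj₂ r)) (≤-reflexive (shuffle (blockCost a′) (clock s))))
      where
      shuffle : ∀ p c → p + (5 + c) ≡ 5 + p + c
      shuffle = solve-∀
    idle : k ≤ a′ → out (body blocksBody s) ≡ out s × BlocksInv a′ (body blocksBody s) ×
           clock (body blocksBody s) ≤ 5 + clock s
    idle k≤a = subst (λ s′ → out s′ ≡ out s × BlocksInv a′ s′ × clock s′ ≤ 5 + clock s)
      (sym (unless0-zero {n = reg s₁ rR} (trans r≡ (m≤n⇒m∸n≡0 k≤a))))
      (refl , (h1 , hk , hb , ht , refl) , ≤-refl)

  blocks-loop-idle : (f : State → State) → (∀ s {a} → BlocksInv a s → BlocksStep a s (f s)) →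
    ∀ m s {a} → BlocksInv a s → k ≤ a →
    out (loop m f s) ≡ out s × clock (loop m f s) ≤ m * 5 + clock s
  blocks-loop-idle f spec zero    s inv k≤a = refl , ≤-refl
  blocks-loop-idle f spec (suc m) s inv k≤a with proj₂ (spec s inv) k≤a
  ... | out₁ , inv₁ , t₁ with blocks-loop-idle f spec m (f s) inv₁ k≤a
  ...   | out₂ , t₂ = trans out₂ out₁ ,
    ≤-trans t₂ (≤-trans (+-monoʳ-≤ (m * 5) t₁) (≤-reflexive (shuffle m (clock s))))
    where
    shuffle : ∀ m c → m * 5 + (5 + c) ≡ suc m * 5 + c
    shuffle = solve-∀

  module _ (W : ℕ) (cost≤ : ∀ a → a ≤ k → blockCost a ≤ b * W) where

    -- A block may cost `b * W`, that is `W` for each index of a full block. The additional `b` in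
    -- the bound pays for the last block, which may be shorter.
    blocks-loop : (f : State → State) → (∀ s {a} → BlocksInv a s → BlocksStep a s (f s)) →
      ∀ m s {a} → BlocksInv a s → a ≤ k →
      out (loop m f s) ≡ out s ++ blocks m a ×
      clock (loop m f s) ≤ m * 5 + (k ∸ a + b) * W + clock s
    blocks-loop f spec zero s inv a≤k = sym (++-identityʳ (out s)) , m≤n+m (clock s) _
    blocks-loop f spec (suc m) s {a} inv a≤k with m≤n⇒m<n∨m≡n a≤k
    ... | inj₂ refl with blocks-loop-idle f spec (suc m) s inv ≤-refl
    ...   | out₁ , t₁ =
      trans out₁ (trans (sym (++-identityʳ (out s))) (cong (out s ++_) (sym (blocks-done (suc m) a ≤-refl)))) ,
      ≤-trans t₁ (+-monoˡ-≤ (clock s) (m≤m+n (suc m * 5) _))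
    blocks-loop f spec (suc m) s {a} inv a≤k | inj₁ a<k with proj₁ (spec s inv) a<k
    ... | out₁ , inv₁ , t₁ with ≤-total (a + b) k
    ...   | inj₁ a+b≤k with blocks-loop f spec m (f s) inv₁ a+b≤k
    ...     | out₂ , t₂ =
      trans out₂ (trans (cong (_++ blocks m (a + b)) out₁) (trans (++-assoc (out s) _ _)
        (cong (out s ++_) (sym (blocks-step m a a<k))))) ,
      (begin
        clock (loop m f (f s))                         ≤⟨ t₂ ⟩
        m * 5 + (r + b) * W + clock (f s)              ≤⟨ +-monoʳ-≤ (m * 5 + (r + b) * W) t₁ ⟩
        m * 5 + (r + b) * W + (5 + blockCost a + clock s) ≤⟨ +-monoʳ-≤ (m * 5 + (r + b) * W)
          (+-monoˡ-≤ (clock s) (+-monoʳ-≤ 5 (cost≤ a a≤k))) ⟩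
        m * 5 + (r + b) * W + (5 + b * W + clock s)    ≡⟨ shuffle m r b W (clock s) ⟩
        suc m * 5 + (r + b + b) * W + clock s          ≡⟨ cong (λ r → suc m * 5 + (r + b) * W + clock s) r+b≡ ⟩
        suc m * 5 + (k ∸ a + b) * W + clock s          ∎)
      where
      open ≤-Reasoning
      r = k ∸ (a + b)
      r+b≡ : r + b ≡ k ∸ a
      r+b≡ = trans (cong (_+ b) (sym (∸-+-assoc k a b)))
        (m∸n+n≡m (m+n≤o⇒m≤o∸n b (≤-trans (≤-reflexive (+-comm b a)) a+b≤k)))
      shuffle : ∀ m r b w c → m * 5 + (r + b) * w + (5 + b * w + c) ≡ suc m * 5 + (r + b + b) * w + c
      shuffle = solve-∀
    blocks-loop f spec (suc m) s {a} inv a≤k | inj₁ a<k | out₁ , inv₁ , t₁ | inj₂ k≤a+b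
      with blocks-loop-idle f spec m (f s) inv₁ k≤a+b
    ... | out₂ , t₂ =
      trans out₂ (trans out₁ (cong (out s ++_) (sym (trans (blocks-step m a a<k)
        (trans (cong (block a ++_) (blocks-done m (a + b) k≤a+b)) (++-identityʳ (block a))))))) ,
      (begin
        clock (loop m f (f s))                  ≤⟨ t₂ ⟩
        m * 5 + clock (f s)                     ≤⟨ +-monoʳ-≤ (m * 5) t₁ ⟩
        m * 5 + (5 + blockCost a + clock s)     ≤⟨ +-monoʳ-≤ (m * 5) (+-monoˡ-≤ (clock s) (+-monoʳ-≤ 5
          (≤-trans (cost≤ a a≤k) (*-monoˡ-≤ W (m≤n+m b (k ∸ a)))))) ⟩
        m * 5 + (5 + (k ∸ a + b) * W + clock s) ≡⟨ shuffle m ((k ∸ a + b) * W) (clock s) ⟩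
        suc m * 5 + (k ∸ a + b) * W + clock s   ∎)
      where
      open ≤-Reasoning
      shuffle : ∀ m q c → m * 5 + (5 + q + c) ≡ suc m * 5 + q + c
      shuffle = solve-∀

-- Integer logarithm and square root

logBody sqrtBody setup main : Cmd

-- The instruction set has no multiplication: the product L k is accumulated by adding k whenever L
-- grows.
logBody = (plus tmp rP rP ⨾ minus rY tmp rK) ⨾ cond rY skip (mov rP tmp ⨾ plus rL one rL ⨾ plus rKL rK rKL)

-- The next square is obtained as σ² + 2σ + 1.
sqrtBody = (plus tmp rSq rS ⨾ plus tmp tmp rS ⨾ plus tmp one tmp ⨾ minus rY tmp rKL)
         ⨾ cond rY skip (mov rSq tmp ⨾ plus rS one rS)

setup = (set one 1 ⨾ set rP 1) ⨾ repeat rK logBody ⨾ repeat rK sqrtBody ⨾ (plus rB one rS ⨾ plus rT one rL)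

main = setup ⨾ repeat rK blocksBody

loop-invariant : (Inv : ℕ → State → Set) (W : ℕ) (f : State → State) →
  (∀ i s → Inv i s → Inv (suc i) (f s) × clock (f s) ≤ W + clock s) →
  ∀ m i s → Inv i s → Inv (m + i) (loop m f s) × clock (loop m f s) ≤ m * W + clock s
loop-invariant Inv W f h zero    i s inv = inv , ≤-refl
loop-invariant Inv W f h (suc m) i s inv with h i s inv
... | inv₁ , t₁ with loop-invariant Inv W f h m (suc i) (f s) inv₁
...   | inv₂ , t₂ = subst (λ n → Inv n (loop m f (f s))) (+-suc m i) inv₂ ,
  ≤-trans t₂ (≤-trans (+-monoʳ-≤ (m * W) t₁) (≤-reflexive (shuffle (m * W) W (clock s))))
  where
  shuffle : ∀ a b c → a + (b + c) ≡ b + a + c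
  shuffle = solve-∀

unless0-elim : ∀ {a p} {A : Set a} (P : A → Set p) n {x y : A} →
               (n ≢ 0 → P x) → (n ≡ 0 → P y) → P (unless0 n x y)
unless0-elim P zero    hx hy = hy refl
unless0-elim P (suc _) hx hy = hx (λ ())

n<2^n : ∀ n → n < 2 ^ n
n<2^n zero    = s≤s z≤n
n<2^n (suc n) = ≤-trans (+-mono-≤ (m^n>0 2 n) (n<2^n n))
  (≤-reflexive (cong (2 ^ n +_) (sym (+-identityʳ (2 ^ n)))))

module Setup (o : Oracle) (k : ℕ) (1≤k : 1 ≤ k) where
  open Frame o
  open Rounds o using (body; unless0-≤; unless0-suc; unless0-zero)

  -- The last component replaces an early exit: either doubling has overshot `k` for good, or all
  -- `m` iterations so far have advanced. After `k` iterations the second is impossible, because L <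
  -- 2^L ≤ k.
  LogInv : ℕ → State → Set
  LogInv m s = reg s one ≡ 1 × reg s rK ≡ k × reg s rP ≡ 2 ^ reg s rL × reg s rP ≤ k ×
    reg s rKL ≡ reg s rL * k × (k < reg s rP + reg s rP ⊎ m ≤ reg s rL)

  log-step : ∀ m s → LogInv m s → LogInv (suc m) (body logBody s) × clock (body logBody s) ≤ 9 + clock s
  log-step m s (h1 , hk , hp , p≤k , hkl , progress) =
    unless0-elim (λ s′ → LogInv (suc m) s′ × clock s′ ≤ 9 + clock s) (2p ∸ reg s rK)
      (λ ≢0 → (h1 , hk , hp , p≤k , hkl ,
               inj₁ (subst (_< 2p) hk (m∸n≢0⇒n<m ≢0))) , +-monoˡ-≤ (clock s) {6} {9} (s≤s (s≤s (s≤s (s≤s (s≤s (s≤s z≤n)))))))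
      (λ ≡0 → let 2p≤k = subst (2p ≤_) hk (m∸n≡0⇒m≤n ≡0) in
        (h1 , hk ,
         trans (cong₂ _+_ hp (trans hp (sym (+-identityʳ _)))) (cong (2 ^_) (cong (_+ reg s rL) (sym h1))) ,
         2p≤k ,
         trans (cong₂ _+_ hk hkl) (cong (λ a → (a + reg s rL) * k) (sym h1)) ,
         inj₂ (subst (λ a → suc m ≤ a + reg s rL) (sym h1) (s≤s (advance progress 2p≤k)))) , ≤-refl)
    where
    2p = reg s rP + reg s rP
    advance : k < 2p ⊎ m ≤ reg s rL → 2p ≤ k → m ≤ reg s rL
    advance (inj₁ k<2p) 2p≤k = contradiction 2p≤k (<⇒≱ k<2p)
    advance (inj₂ m≤L)  _    = m≤L

  -- The same dichotomy as in `LogInv`. Here `k` advances would give k² ≤ σ² ≤ L k < k².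
  SqrtInv : ℕ → ℕ → State → Set
  SqrtInv q m s = reg s one ≡ 1 × reg s rKL ≡ q × reg s rSq ≡ reg s rS * reg s rS ×
    reg s rSq ≤ q × (q < suc (reg s rS) * suc (reg s rS) ⊎ m ≤ reg s rS)

  sqrt-step : ∀ q m s → SqrtInv q m s →
              SqrtInv q (suc m) (body sqrtBody s) × clock (body sqrtBody s) ≤ 10 + clock s
  sqrt-step q m s (h1 , hq , hsq , sq≤q , progress) =
    unless0-elim (λ s′ → SqrtInv q (suc m) s′ × clock s′ ≤ 10 + clock s) (v ∸ reg s rKL)
      (λ ≢0 → (h1 , hq , hsq , sq≤q ,
               inj₁ (subst₂ _<_ hq v≡ (m∸n≢0⇒n<m ≢0))) , +-monoˡ-≤ (clock s) {8} {10} (m≤n+m 8 2))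
      (λ ≡0 → let v≤q = subst (v ≤_) hq (m∸n≡0⇒m≤n ≡0) in
        (h1 , hq , trans v≡ (cong₂ (λ a b → (a + σ) * (b + σ)) (sym h1) (sym h1)) , v≤q ,
         inj₂ (subst (λ a → suc m ≤ a + σ) (sym h1) (s≤s (advance progress v≤q)))) , ≤-refl)
    where
    σ = reg s rS
    v = reg s one + ((reg s rSq + σ) + σ)
    v≡ : v ≡ suc σ * suc σ
    v≡ = trans (cong₂ (λ a b → a + ((b + σ) + σ)) h1 hsq) (square σ)
      where
      square : ∀ σ → 1 + ((σ * σ + σ) + σ) ≡ suc σ * suc σ
      square = solve-∀
    advance : q < suc σ * suc σ ⊎ m ≤ σ → v ≤ q → m ≤ σ
    advance (inj₁ q<) v≤q = contradiction (subst (_≤ q) v≡ v≤q) (<⇒≱ q<)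
    advance (inj₂ m≤) _   = m≤

  -- The inequalities that characterise `l` as ⌊log₂ k⌋ and `σ` as ⌊√(l k)⌋.
  record Parameters (l σ : ℕ) : Set where
    field
      2^l≤k     : 2 ^ l ≤ k
      k<2^1+l   : k < 2 ^ suc l
      σ²≤lk     : σ * σ ≤ l * k
      lk<[1+σ]² : l * k < suc σ * suc σ

  private
    s₀ = exec o (set one 1 ⨾ set rP 1) (initial k)
    s₁ = exec o (repeat rK logBody) s₀
    s₂ = exec o (repeat rK sqrtBody) s₁
    s₃ = exec o setup (initial k)

    log-result = loop-invariant LogInv 9 (body logBody) log-step k 0 (tick 1 s₀)
      (refl , refl , refl , 1≤k , refl , inj₂ z≤n)

    fixed₁ : ∀ z → assigns z (repeat rK logBody) ≡ false → reg s₁ z ≡ reg s₀ z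
    fixed₁ z h = reg-fixed (repeat rK logBody) z s₀ h

    sqrt-result = loop-invariant (SqrtInv (reg s₁ rKL)) 10 (body sqrtBody) (sqrt-step (reg s₁ rKL)) (reg s₁ rK) 0 (tick 1 s₁)
      (fixed₁ one refl , refl ,
       trans (fixed₁ rSq refl) (sym (cong (λ a → a * a) (fixed₁ rS refl))) ,
       ≤-trans (≤-reflexive (fixed₁ rSq refl)) z≤n , inj₂ z≤n)

  L σ : ℕ
  L = reg s₁ rL
  σ = reg s₂ rS

  private
    2^L≤k : 2 ^ L ≤ k
    2^L≤k = let _ , _ , p≡ , p≤k , _ = proj₁ log-result in subst (_≤ k) p≡ p≤k

    L<k : L < k
    L<k = <-≤-trans (n<2^n L) 2^L≤k

    kl≡ : reg s₁ rKL ≡ L * k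
    kl≡ = let _ , _ , _ , _ , kl , _ = proj₁ log-result in kl

    k<2^1+L : k < 2 ^ suc L
    k<2^1+L = let _ , _ , p≡ , _ , _ , progress = proj₁ log-result in finish p≡ progress
      where
      finish : reg s₁ rP ≡ 2 ^ L → k < reg s₁ rP + reg s₁ rP ⊎ k + 0 ≤ L → k < 2 ^ suc L
      finish e (inj₁ k<2p) = subst (k <_) (cong₂ _+_ e (trans e (sym (+-identityʳ _)))) k<2p
      finish e (inj₂ k≤L)  = contradiction (subst (_≤ L) (+-identityʳ k) k≤L) (<⇒≱ L<k)

    lk<[1+σ]²′ : L * k < suc σ * suc σ
    lk<[1+σ]²′ = let _ , _ , sq≡ , sq≤ , progress = proj₁ sqrt-result in finish sq≡ sq≤ progress
      where
      finish : reg s₂ rSq ≡ σ * σ → reg s₂ rSq ≤ reg s₁ rKL →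
               reg s₁ rKL < suc σ * suc σ ⊎ reg s₁ rK + 0 ≤ σ → L * k < suc σ * suc σ
      finish e le (inj₁ lt)  = subst (_< suc σ * suc σ) kl≡ lt
      finish e le (inj₂ k≤σ) = contradiction
        (≤-trans (*-mono-≤ k≤σ′ k≤σ′) (≤-trans (≤-reflexive (sym e)) (≤-trans le (≤-reflexive kl≡))))
        (<⇒≱ (*-monoˡ-< k {{>-nonZero 1≤k}} L<k))
        where
        k≤σ′ : k ≤ σ
        k≤σ′ = subst (_≤ σ) (trans (+-identityʳ _) (fixed₁ rK refl)) k≤σ

  parameters : Parameters L σ
  parameters = record
    { 2^l≤k = 2^L≤k ; k<2^1+l = k<2^1+L ; lk<[1+σ]² = lk<[1+σ]²′
    ; σ²≤lk = let _ , _ , sq≡ , sq≤ , _ = proj₁ sqrt-result in subst₂ _≤_ sq≡ kl≡ sq≤ }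

  private
    fixed₂ : ∀ z → assigns z (repeat rK sqrtBody) ≡ false → reg s₂ z ≡ reg s₁ z
    fixed₂ z h = reg-fixed (repeat rK sqrtBody) z s₁ h

    one₂ : reg s₂ one ≡ 1
    one₂ = trans (fixed₂ one refl) (fixed₁ one refl)

  setup-spec : reg s₃ one ≡ 1 × reg s₃ rK ≡ k × reg s₃ rB ≡ suc σ × reg s₃ rT ≡ suc L ×
               reg s₃ rA ≡ 0 × out s₃ ≡ [] × clock s₃ ≤ 8 + k * 19
  setup-spec = one₂ , trans (fixed₂ rK refl) (fixed₁ rK refl) , cong (_+ σ) one₂ ,
    cong₂ _+_ one₂ (fixed₂ rL refl) , trans (fixed₂ rA refl) (fixed₁ rA refl) ,
    trans (out-fixed (repeat rK sqrtBody) s₁ refl) (out-fixed (repeat rK logBody) s₀ refl) ,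
    (begin
      3 + clock (loop (reg s₁ rK) (body sqrtBody) (tick 1 s₁)) ≤⟨ +-monoʳ-≤ 3 (proj₂ sqrt-result) ⟩
      3 + (reg s₁ rK * 10 + (1 + clock s₁))                   ≡⟨ cong (λ k → 3 + (k * 10 + (1 + clock s₁))) (fixed₁ rK refl) ⟩
      3 + (k * 10 + (1 + clock s₁))                           ≤⟨ +-monoʳ-≤ 3 (+-monoʳ-≤ (k * 10) (+-monoʳ-≤ 2 (proj₂ log-result))) ⟩
      3 + (k * 10 + (2 + (k * 9 + 3)))                        ≡⟨ shuffle k ⟩
      8 + k * 19                                              ∎)
    where
    open ≤-Reasoning
    shuffle : ∀ k → 3 + (k * 10 + (2 + (k * 9 + 3))) ≡ 8 + k * 19
    shuffle = solve-∀

module Main (o : Oracle) (k : ℕ) (1≤k : 1 ≤ k) (valid : CherryOracle k o) where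
  open Setup o k 1≤k public
  open Rounds o using (body)
  open BlocksProgram o k (suc σ) (suc L) valid
  open Blocks o k (suc σ) (suc L) using (blocks)

  main-spec : ∀ W → (∀ a → a ≤ k → blockCost a ≤ suc σ * W) →
    let s′ = exec o main (initial k) in
    out s′ ≡ blocks k 0 × clock s′ ≤ k * 5 + (k + suc σ) * W + (1 + (9 + k * 19))
  main-spec W cost≤ =
    let s₃ = exec o setup (initial k)
        one₃ , k₃ , b₃ , rounds₃ , a₃ , out₃ , t₃ = setup-spec
        out₄ , t₄ = blocks-loop W cost≤ (body blocksBody) blocks-step-spec k (tick 1 s₃) {0}
                      (one₃ , k₃ , b₃ , rounds₃ , a₃) z≤n
        main≡ = cong (λ n → tick 1 (loop n (body blocksBody) (tick 1 s₃))) k₃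
        W′ = k * 5 + (k + suc σ) * W
    in trans (cong out main≡) (trans out₄ (cong (_++ blocks k 0) out₃)) ,
       ≤-trans (≤-reflexive (cong clock main≡)) (≤-trans (s≤s t₄)
         (≤-trans (≤-reflexive (sym (+-suc W′ (1 + clock s₃)))) (+-monoʳ-≤ W′ (+-monoʳ-≤ 2 t₃))))

-- Arithmetic of the parameters

module Bounds (o : Oracle) (k L σ : ℕ) (1≤k : 1 ≤ k) (parameters : Setup.Parameters o k 1≤k L σ) where
  open Setup.Parameters parameters

  b : ℕ
  b = suc σ

  L<k : L < k
  L<k = <-≤-trans (n<2^n L) 2^l≤k

  -- From k ≤ σ would follow k² ≤ σ² ≤ L k < k².
  b≤k : b ≤ k
  b≤k = ≰⇒> λ k≤σ → <⇒≱ (*-monoˡ-< k {{>-nonZero 1≤k}} L<k) (≤-trans (*-mono-≤ k≤σ k≤σ) σ²≤lk)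

  module _ (2≤k : 2 ≤ k) where

    1≤L : 1 ≤ L
    1≤L = n≢0⇒n>0 λ { refl → <⇒≱ k<2^1+l 2≤k }

    1≤σ : 1 ≤ σ
    1≤σ = n≢0⇒n>0 λ { refl → <⇒≱ lk<[1+σ]² (*-mono-≤ 1≤L 1≤k) }

    σ≤σ² : σ ≤ σ * σ
    σ≤σ² = m≤m*n σ σ {{>-nonZero 1≤σ}}

    -- Since L ≥ 1, the left side is at most 2Lk, and Lk < (σ + 1)² gives 2Lk ≤ 2σ² + 4σ. As σ ≤ σ²,
    -- this is at most 3σ² + 3σ.
    kt≤3σb : k * suc L ≤ 3 * σ * b
    kt≤3σb = begin
      k * suc L                                 ≡⟨ expand k L ⟩
      k + L * k                                 ≤⟨ +-mono-≤ (≤-trans (m≤n*m k L {{>-nonZero 1≤L}}) Lk≤) Lk≤ ⟩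
      (σ * σ + 2 * σ) + (σ * σ + 2 * σ)         ≡⟨ regroup σ (σ * σ) ⟩
      2 * (σ * σ) + 3 * σ + σ                   ≤⟨ +-monoʳ-≤ (2 * (σ * σ) + 3 * σ) σ≤σ² ⟩
      2 * (σ * σ) + 3 * σ + σ * σ               ≡⟨ collect σ ⟩
      3 * σ * b                                 ∎
      where
      open ≤-Reasoning
      expand : ∀ k l → k * suc l ≡ k + l * k
      expand = solve-∀
      square : ∀ σ → suc σ * suc σ ≡ suc (σ * σ + 2 * σ)
      square = solve-∀
      regroup : ∀ σ q → (q + 2 * σ) + (q + 2 * σ) ≡ 2 * q + 3 * σ + σ
      regroup = solve-∀
      collect : ∀ σ → 2 * (σ * σ) + 3 * σ + σ * σ ≡ 3 * σ * suc σ
      collect = solve-∀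
      Lk≤ : L * k ≤ σ * σ + 2 * σ
      Lk≤ = s≤s⁻¹ (≤-trans lk<[1+σ]² (≤-reflexive (square σ)))

  -- Squaring and σ² ≤ L k contribute one more factor k, hence the odd exponent: m = 1 serves the
  -- size and m = 2 the time.
  square-bound : ∀ {n} c m → n ≤ c * (k ^ m * σ) → n * n ≤ c ^ 2 * k ^ suc (m + m) * L
  square-bound {n} c m n≤ = begin
    n * n                                   ≤⟨ *-mono-≤ n≤ n≤ ⟩
    (c * (k ^ m * σ)) * (c * (k ^ m * σ))   ≡⟨ regroup₁ c (k ^ m) σ ⟩
    (c * (c * 1)) * (k ^ m * k ^ m) * (σ * σ) ≤⟨ *-monoʳ-≤ ((c * (c * 1)) * (k ^ m * k ^ m)) σ²≤lk ⟩
    (c * (c * 1)) * (k ^ m * k ^ m) * (L * k) ≡⟨ regroup₂ (c * (c * 1)) (k ^ m * k ^ m) L k ⟩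
    (c * (c * 1)) * (k * (k ^ m * k ^ m)) * L ≡⟨ cong (λ x → (c * (c * 1)) * (k * x) * L) (sym (^-distribˡ-+-* k m m)) ⟩
    c ^ 2 * k ^ suc (m + m) * L             ∎
    where
    open ≤-Reasoning
    regroup₁ : ∀ c k σ → (c * (k * σ)) * (c * (k * σ)) ≡ (c * (c * 1)) * (k * k) * (σ * σ)
    regroup₁ = solve-∀
    regroup₂ : ∀ c q l k → c * q * (l * k) ≡ c * (k * q) * l
    regroup₂ = solve-∀

  -- The allowance per index, chosen so that b W = 162 k b²: 139 k b² for the stars of a block and
  -- 23 k b² for its triangle and overhead.
  W : ℕ
  W = 162 * (k * b)

  module _ (valid : CherryOracle k o) where
    open Blocks o k b (suc L) using (blockSize; blockSize≤b)
    open BlockProgram o k b (suc L) using (starCost)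
    open BlocksProgram o k b (suc L) valid using (blockCost)

    private
      q = b * b
      b≤q : b ≤ q
      b≤q = m≤m*n b b
      1≤q : 1 ≤ q
      1≤q = s≤s z≤n
      t≤q : suc L ≤ q
      t≤q = ≤-trans (s≤s (m≤m*n L k {{>-nonZero 1≤k}})) lk<[1+σ]²

    starCost≤ : ∀ n → n ≤ b → starCost n ≤ 139 * q
    starCost≤ n n≤b = begin
      90 * (n * n) + suc L * 14 + (n * (15 + n * 10) + 10) ≤⟨ +-mono-≤
        (+-mono-≤ (*-monoʳ-≤ 90 (*-mono-≤ n≤b n≤b)) (*-monoˡ-≤ 14 t≤q))
        (+-monoˡ-≤ 10 (*-mono-≤ n≤b (+-monoʳ-≤ 15 (*-monoˡ-≤ 10 n≤b)))) ⟩
      90 * q + q * 14 + (b * (15 + b * 10) + 10)      ≡⟨ regroup b q ⟩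
      104 * q + (15 * b + 10 * (b * b) + 10 * 1)      ≤⟨ +-monoʳ-≤ (104 * q) (+-mono-≤
        (+-monoˡ-≤ (10 * q) (*-monoʳ-≤ 15 b≤q)) (*-monoʳ-≤ 10 1≤q)) ⟩
      104 * q + (15 * q + 10 * q + 10 * q)            ≡⟨ collect q ⟩
      139 * q                                         ∎
      where
      open ≤-Reasoning
      regroup : ∀ b q → 90 * q + q * 14 + (b * (15 + b * 10) + 10) ≡ 104 * q + (15 * b + 10 * (b * b) + 10 * 1)
      regroup = solve-∀
      collect : ∀ q → 104 * q + (15 * q + 10 * q + 10 * q) ≡ 139 * q
      collect = solve-∀

    blockCost≤ : ∀ a → a ≤ k → blockCost a ≤ b * W
    blockCost≤ a a≤k = begin
      10 + (a * starCost n + n * (8 + n * 5))       ≤⟨ +-monoʳ-≤ 10 (+-mono-≤ (*-mono-≤ a≤k (starCost≤ n n≤b))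
                                                         (*-mono-≤ n≤b (+-monoʳ-≤ 8 (*-monoˡ-≤ 5 n≤b)))) ⟩
      10 + (k * (139 * q) + b * (8 + b * 5))        ≡⟨ regroup k b q ⟩
      k * (139 * q) + (10 * 1 + 8 * b + 5 * q)      ≤⟨ +-monoʳ-≤ (k * (139 * q)) (+-monoˡ-≤ (5 * q)
                                                         (+-mono-≤ (*-monoʳ-≤ 10 1≤q) (*-monoʳ-≤ 8 b≤q))) ⟩
      k * (139 * q) + (10 * q + 8 * q + 5 * q)      ≡⟨ cong (k * (139 * q) +_) (collect q) ⟩
      k * (139 * q) + 23 * q                        ≤⟨ +-monoʳ-≤ (k * (139 * q)) (m≤n*m (23 * q) k {{>-nonZero 1≤k}}) ⟩
      k * (139 * q) + k * (23 * q)                  ≡⟨ finish k b ⟩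
      b * W                                         ∎
      where
      open ≤-Reasoning
      n = blockSize a
      n≤b = blockSize≤b a
      regroup : ∀ k b q → 10 + (k * (139 * q) + b * (8 + b * 5)) ≡ k * (139 * q) + (10 * 1 + 8 * b + 5 * (b * b))
      regroup = solve-∀
      collect : ∀ q → 10 * q + 8 * q + 5 * q ≡ 23 * q
      collect = solve-∀
      finish : ∀ k b → k * (139 * (b * b)) + k * (23 * (b * b)) ≡ b * (162 * (k * b))
      finish = solve-∀

  -- k + b ≤ 2k makes the blocks cost at most 324 k² b, and the linear terms at most 34 k² b. Then b
  -- ≤ 2σ doubles 358 to 716.
  time-bound : 2 ≤ k → k * 5 + (k + b) * W + (1 + (9 + k * 19)) ≤ 716 * (k ^ 2 * σ)
  time-bound 2≤k = begin
    k * 5 + (k + b) * W + (1 + (9 + k * 19)) ≡⟨ regroup k ((k + b) * W) ⟩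
    (k + b) * W + (24 * k + 10 * 1)          ≤⟨ +-mono-≤ (*-monoˡ-≤ W (+-monoʳ-≤ k b≤k))
                                                  (+-monoʳ-≤ (24 * k) (*-monoʳ-≤ 10 1≤k)) ⟩
    (k + k) * W + (24 * k + 10 * k)          ≡⟨ cong ((k + k) * W +_) (collect k) ⟩
    (k + k) * W + 34 * k                     ≤⟨ +-monoʳ-≤ ((k + k) * W) (*-monoʳ-≤ 34 k≤k²b) ⟩
    (k + k) * W + 34 * (k * k * b)           ≡⟨ finish k b ⟩
    358 * (k * k * b)                        ≤⟨ *-monoʳ-≤ 358 (*-monoʳ-≤ (k * k) b≤2σ) ⟩
    358 * (k * k * (σ + σ))                  ≡⟨ double k σ ⟩
    716 * (k ^ 2 * σ)                        ∎
    where
    open ≤-Reasoning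
    k≤k²b : k ≤ k * k * b
    k≤k²b = ≤-trans (m≤m*n k k {{>-nonZero 1≤k}}) (m≤m*n (k * k) b)
    b≤2σ : b ≤ σ + σ
    b≤2σ = +-monoˡ-≤ σ (1≤σ 2≤k)
    regroup : ∀ k w → k * 5 + w + (1 + (9 + k * 19)) ≡ w + (24 * k + 10 * 1)
    regroup = solve-∀
    collect : ∀ k → 24 * k + 10 * k ≡ 34 * k
    collect = solve-∀
    finish : ∀ k b → (k + k) * (162 * (k * b)) + 34 * (k * k * b) ≡ 358 * (k * k * b)
    finish = solve-∀
    double : ∀ k σ → 358 * (k * k * (σ + σ)) ≡ 716 * (k * (k * 1) * σ)
    double = solve-∀

-- Domination numbers of finite digraphs

least : ∀ {ℓ} {P : ℕ → Set ℓ} → (∀ n → Dec (P n)) → ∀ {n} → P n →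
        ∃[ m ] (m ≤ n × P m × (∀ j → P j → m ≤ j))
least {P = P} P? {n} pn = search n 0 (+-identityʳ n) (λ _ _ → z≤n)
  where
  search : ∀ fuel m → fuel + m ≡ n → (∀ j → P j → m ≤ j) →
           ∃[ m ] (m ≤ n × P m × (∀ j → P j → m ≤ j))
  search fuel m eq below with P? m
  ... | yes pm = m , subst (m ≤_) eq (m≤n+m m fuel) , pm , below
  search zero       m refl below | no ¬pm = contradiction pn ¬pm
  search (suc fuel) m eq   below | no ¬pm = search fuel (suc m) (trans (+-suc fuel m) eq)
    (λ j pj → ≤∧≢⇒< (below j pj) (λ { refl → ¬pm pj }))

module FiniteDigraph {v e} (G : Digraph v e) (vertices : List (Digraph.V G))
         (complete : ∀ u → u ∈ vertices) (_≟_ : DecidableEquality (Digraph.V G))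
         (_⟶?_ : Decidable (Digraph._⟶_ G)) where
  open Digraph G using (V)
  open DecMembership _≟_ using (_∈?_)
  open DecUnique _≟_ using (unique?)

  listsOfLength : ℕ → List (List V)
  listsOfLength zero    = [] ∷ []
  listsOfLength (suc n) = cartesianProductWith _∷_ vertices (listsOfLength n)

  ∈-listsOfLength⁺ : ∀ D → D ∈ listsOfLength (length D)
  ∈-listsOfLength⁺ []      = here refl
  ∈-listsOfLength⁺ (u ∷ D) = ∈-cartesianProductWith⁺ _∷_ (complete u) (∈-listsOfLength⁺ D)

  ∈-listsOfLength⁻ : ∀ n {D} → D ∈ listsOfLength n → length D ≡ n
  ∈-listsOfLength⁻ zero    (here refl) = refl
  ∈-listsOfLength⁻ (suc n) p with ∈-cartesianProductWith⁻ _∷_ vertices (listsOfLength n) p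
  ... | _ , _ , _ , q , refl = cong suc (∈-listsOfLength⁻ n q)

  isDominatingSet? : ∀ D → Dec (IsDominatingSet G D)
  isDominatingSet? D = unique? D ×-dec map′
    (λ h w → All.lookup h (complete w)) (λ h → All.tabulate (λ {w} _ → h w))
    (All.all? (λ w → (w ∈? D) ⊎-dec map′ find (λ (u , u∈D , u⟶w) → lose u∈D u⟶w)
                                         (Any.any? (_⟶? w) D)) vertices)

  dominatingSetOfSize? : ∀ n → Dec (∃[ D ] (IsDominatingSet G D × length D ≡ n))
  dominatingSetOfSize? n = map′
    (λ h → let D , D∈ , dom = find h in D , dom , ∈-listsOfLength⁻ n D∈)
    (λ { (D , dom , refl) → lose (∈-listsOfLength⁺ D) dom })
    (Any.any? isDominatingSet? (listsOfLength n))

  -- A minimum exists constructively because each size can be decided by enumerating all lists of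
  -- that length over the finite vertex set.
  dominationNumber : ∀ D → IsDominatingSet G D → ∃[ n ] (IsDominationNumber G n × n ≤ length D)
  dominationNumber D dom with least dominatingSetOfSize? (D , dom , refl)
  ... | n , n≤ , exists , minimal = n , (exists , λ D′ dom′ → minimal _ (D′ , dom′ , refl)) , n≤

-- Vertices as pairs of numbers, and the assembled algorithm

module Pairs (k : ℕ) where
  open Pair

  code-injective : ∀ {u v : Pair k} → code u ≡ code v → u ≡ v
  code-injective {pair a b a<b} {pair c d c<d} eq
    with refl ← toℕ-injective (cong proj₁ eq) | refl ← toℕ-injective (cong proj₂ eq)
    = cong (pair a b) (≤-irrelevant a<b c<d)

  infix 4 _≟ₚ_

  _≟ₚ_ : DecidableEquality (Pair k)
  u ≟ₚ v = map′ code-injective (cong code) (×-≡-dec _≟_ _≟_ (code u) (code v))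

  index : ∀ {a} → a < k → ∃[ i ] toℕ {k} i ≡ a
  index a<k = fromℕ< a<k , toℕ-fromℕ< a<k

  decode : ∀ l → (∀ {a c} → (a , c) ∈ l → a < c × c < k) → ∃[ D ] l ≡ map (code {k}) D
  decode []            h = [] , refl
  decode ((a , c) ∷ l) h with h (here refl)
  ... | a<c , c<k with index (<-trans a<c c<k) | index c<k | decode l (h ∘ there)
  ...   | i , refl | j , refl | D , refl = pair i j a<c ∷ D , refl

module Algorithm (o : Oracle) (k : ℕ) (1≤k : 1 ≤ k) (valid : CherryOracle k o) where
  open Main o k 1≤k valid public
  open Setup.Parameters parameters public
  open Bounds o k L σ 1≤k parameters hiding (b; L<k)
  open Blocks o k (suc σ) (suc L)
  open Execution o
  open Pairs k

  final : State
  final = exec o main (initial k)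

  out-final : out final ≡ blocks k 0
  out-final = proj₁ (main-spec W (blockCost≤ valid))

  clock-final : 2 ≤ k → clock final ≤ 716 * (k ^ 2 * σ)
  clock-final 2≤k = ≤-trans (proj₂ (main-spec W (blockCost≤ valid))) (time-bound 2≤k)

  private
    decoded = decode (blocks k 0) (λ p → let a<c , _ , c<k = ∈-blocks⁻ valid k 0 p in a<c , c<k)

  D : List (Pair k)
  D = proj₁ decoded

  code-D : blocks k 0 ≡ map Pair.code D
  code-D = proj₂ decoded

  length-D : length D * length D ≤ 4 ^ 2 * k ^ 3 * L
  length-D with m≤n⇒m<n∨m≡n 1≤k
  ... | inj₁ 2≤k = square-bound 4 1 (begin
    length D              ≡⟨ sym (length-map Pair.code D) ⟩
    length (map Pair.code D) ≡⟨ cong length (sym code-D) ⟩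
    length (blocks k 0)   ≤⟨ length-blocks σ refl (kt≤3σb 2≤k) k ⟩
    4 * k * σ             ≡⟨ trans (*-assoc 4 k σ) (cong (λ x → 4 * (x * σ)) (sym (*-identityʳ k))) ⟩
    4 * (k ^ 1 * σ)       ∎)
    where open ≤-Reasoning
  -- For `k` = 1 both `L` and `σ` are 0 and the claim is that `D` is empty; indeed there is no pair
  -- of distinct indices.
  ... | inj₂ refl with D
  ...   | []    = z≤n
  ...   | pair i j i<j ∷ _ = contradiction i<j (≤⇒≯ (≤-trans (s≤s⁻¹ (toℕ<n j)) z≤n))

  size-bound : ∀ {n} → n ≤ length D → fromNat n ≤ 4 ·√[ k ^ 3 ·log₂ k ]
  size-bound {n} n≤ = ≤-·√log₂ 4 k 3 L {n} (0≤fromNat n) ℚₚ.≤-refl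
    (≤-trans (*-mono-≤ n≤ n≤) length-D) 2^l≤k

  dominates : ∀ (w : Pair k) → ∃[ u ] (u ∈ D ×
    o (toℕ (Pair.lo u)) (toℕ (Pair.hi u)) (toℕ (Pair.lo w)) (toℕ (Pair.hi w)) ≡ true)
  dominates w with blocks-dominating valid k<2^1+l k 0 (Pair.lo<hi w) (toℕ<n (Pair.hi w)) z≤n
                     (<-≤-trans (toℕ<n (Pair.hi w)) (m≤m*n k (suc σ)))
  ... | a , c , p , e with ∈-map⁻ Pair.code (subst (_ ∈_) code-D p)
  ...   | u , u∈D , refl = u , u∈D , e

  -- Even a member of `D` gets an in-neighbour in `D` from `dominates`, so the second alternative of
  -- domination always applies.
  dominating : ∀ {e} (_⟶_ : Rel (Pair k) e) → Answers _⟶_ o →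
               IsDominatingSet (record { V = Pair k ; _⟶_ = _⟶_ }) D
  dominating _⟶_ answers = Unique.map⁻ (subst Unique code-D (blocks-unique valid k 0)) ,
    λ w → let u , u∈D , e = dominates w in inj₂ (u , u∈D , edge u w e)
    where
    edge : ∀ u w → o (toℕ (Pair.lo u)) (toℕ (Pair.hi u)) (toℕ (Pair.lo w)) (toℕ (Pair.hi w)) ≡ true → u ⟶ w
    edge u w e with ofʸ u⟶w ← subst (Reflects (u ⟶ w)) e (answers u w) = u⟶w

  private
    M = proj₁ (compile-correct o main k)
    halts : start (compile 0 main) k ⟶[ clock final ] config [] M (out final)
    halts = proj₂ (compile-correct o main k)

  outputs-D : ∀ {ℓ} {Good : List (Pair k) → Set ℓ} → Good D → Outputs o (compile 0 main) k Good
  outputs-D good coins halted = D ,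
    trans (cong output (run-unique halts refl coins halted)) (trans out-final code-D) , good

  -- A finite bound for every `k` ≥ 1, including `k` = 1, where the bound with log₂ k is zero.
  terminates : ExpectedTime o (compile 0 main) k (_≤ℚ fromNat (clock final))
  terminates N = truncatedTime≤steps o halts refl N

  expected-time : 2 ≤ k → ExpectedTime o (compile 0 main) k (_≤ 716 ·√[ k ^ 5 ·log₂ k ])
  expected-time 2≤k N = ≤-·√log₂ 716 k 5 L (truncatedTime≥0 o N _) (terminates N)
    (square-bound 716 2 (clock-final 2≤k)) 2^l≤k

-- From distributions to oracles

module _ {c ℓ₁ ℓ₂} {F : OrderedField c ℓ₁ ℓ₂}
         {x p} {X : Set x} (I : Integration F X p) {k} (q : Fin k → Distribution I) where
  open OrderedField F using (1/6)
  open Digraph (scheffé-graph I q 1/6) using (_⟶_)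
  open ScheffeGraphProperties I q
  open Pair
  open Pairs k

  -- The answers being Booleans, three of the four edges can be tested; if all are denied, `cherry`
  -- supplies the fourth.
  cherryOracle : ∀ {o} → Answers _⟶_ o → CherryOracle k o
  cherryOracle {o} answers = record { reflexive = reflexive ; cherry = cherry-true }
    where
    yes⇒ : ∀ u v → u ⟶ v → o (toℕ (lo u)) (toℕ (hi u)) (toℕ (lo v)) (toℕ (hi v)) ≡ true
    yes⇒ u v u⟶v with o (toℕ (lo u)) (toℕ (hi u)) (toℕ (lo v)) (toℕ (hi v)) | answers u v
    ... | true  | _        = refl
    ... | false | ofⁿ u↛v = contradiction u⟶v u↛v

    reflexive : ∀ {a b} → a < b → b < k → o a b a b ≡ true
    reflexive a<b b<k with index (<-trans a<b b<k) | index b<k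
    ... | i , refl | j , refl = yes⇒ (pair i j a<b) (pair i j a<b) (⟶-refl (pair i j a<b))

    cherry-true : ∀ {x i j} → x < i → i < j → j < k →
      (o x i x j ≡ true ⊎ o x j x i ≡ true) ⊎ (o i j x i ≡ true ⊎ o i j x j ≡ true)
    cherry-true x<i i<j j<k
      with index (<-trans x<i (<-trans i<j j<k)) | index (<-trans i<j j<k) | index j<k
    ... | a , refl | b , refl | c , refl
      with o (toℕ a) (toℕ b) (toℕ a) (toℕ c) ≟ᵇ true | o (toℕ a) (toℕ c) (toℕ a) (toℕ b) ≟ᵇ true
         | o (toℕ b) (toℕ c) (toℕ a) (toℕ b) ≟ᵇ true
    ... | yes e | _     | _     = inj₁ (inj₁ e)
    ... | no _  | yes e | _     = inj₁ (inj₂ e)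
    ... | no _  | no _  | yes e = inj₂ (inj₁ e)
    ... | no n₁ | no n₂ | no n₃ = inj₂ (inj₂ (yes⇒ w v
      (cherry x<i (<-trans x<i i<j) i<j (n₁ ∘ yes⇒ u v) (n₂ ∘ yes⇒ v u) (n₃ ∘ yes⇒ w u))))
      where
      u = pair a b x<i
      v = pair a c (<-trans x<i i<j)
      w = pair b c i<j

  _⟶?_ : Decidable _⟶_
  v ⟶? w = OrderedField._≤?_ F _ _

  private
    -- All vertices form the triangle over the whole index range, so its membership lemmas also give
    -- their enumeration.
    allPairs = decode (Blocks.triangle (λ _ _ _ _ → false) k 0 0 0 k)
      (λ p → proj₂ (Blocks.∈-triangle⁻ (λ _ _ _ _ → false) k 0 0 0 k p))

  vertices : List (Pair k)
  vertices = proj₁ allPairs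

  vertices-complete : ∀ u → u ∈ vertices
  vertices-complete u
    with ∈-map⁻ code (subst (code u ∈_) (proj₂ allPairs)
           (Blocks.∈-triangle⁺ (λ _ _ _ _ → false) k 0 0 0 k z≤n (lo<hi u) (toℕ<n (hi u))))
  ... | v , v∈ , eq with refl ← code-injective {u} {v} eq = v∈

  Coded : ℕ → ℕ → ℕ → ℕ → Pair k → Pair k → Set ℓ₂
  Coded a b c d v w = (code v ≡ (a , b) × code w ≡ (c , d)) × v ⟶ w

  coded? : ∀ a b c d → Dec (Any (λ v → Any (Coded a b c d v) vertices) vertices)
  coded? a b c d = Any.any? (λ v → Any.any? (λ w →
    (×-≡-dec _≟_ _≟_ (code v) (a , b) ×-dec ×-≡-dec _≟_ _≟_ (code w) (c , d)) ×-dec (v ⟶? w))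
    vertices) vertices

  -- Decidability of the order decides edges. A query about four numbers is answered by searching
  -- the vertices for these codes, so an ill-formed query receives `false`.
  oracle : Oracle
  oracle a b c d = does (coded? a b c d)

  oracle-answers : Answers _⟶_ oracle
  oracle-answers v w = proof (map′ to from (coded? (toℕ (lo v)) (toℕ (hi v)) (toℕ (lo w)) (toℕ (hi w))))
    where
    from : v ⟶ w → Any (λ v′ → Any (Coded _ _ _ _ v′) vertices) vertices
    from v⟶w = lose (vertices-complete v) (lose (vertices-complete w) ((refl , refl) , v⟶w))
    to : Any (λ v′ → Any (Coded _ _ _ _ v′) vertices) vertices → v ⟶ w
    to h with find h
    ... | v′ , _ , h′ with find h′
    ...   | w′ , _ , (ev , ew) , v′⟶w′
      with refl ← code-injective {v′} {v} ev | refl ← code-injective {w′} {w} ew = v′⟶w′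

theorem14 : ∀ {c ℓ₁ ℓ₂ x p : Level} (F : OrderedField c ℓ₁ ℓ₂) →
    (∀ {X : Set x} (I : Integration F X p) (k : ℕ) → 1 ≤ k →
    (q : Fin k → Distribution I) →
    ∃[ n ] (IsDominationNumber (scheffé-graph I q (OrderedField.1/6 F)) n ×
    fromNat n ≤ 4 ·√[ k ^ 3 ·log₂ k ]))
    ×
    (∃[ P ] ∃[ C ]
    (∀ {X : Set x} (I : Integration F X p) (k : ℕ) → 1 ≤ k →
    (q : Fin k → Distribution I) (o : Oracle) →
    Answers (Digraph._⟶_ (scheffé-graph I q (OrderedField.1/6 F))) o →
    Outputs o P k (λ D →
    IsDominatingSet (scheffé-graph I q (OrderedField.1/6 F)) D ×
    fromNat (length D) ≤ 4 ·√[ k ^ 3 ·log₂ k ]) ×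
    (∃[ t ] ExpectedTime o P k (_≤ℚ fromNat t)) ×
    (2 ≤ k → ExpectedTime o P k (_≤ C ·√[ k ^ 5 ·log₂ k ]))))
theorem14 F =
  (λ I k 1≤k q →
    let module A = Algorithm (oracle I q) k 1≤k (cherryOracle I q (oracle-answers I q))
        G = scheffé-graph I q (OrderedField.1/6 F)
        n , number , n≤ = FiniteDigraph.dominationNumber G (vertices I q) (vertices-complete I q)
          (Pairs._≟ₚ_ k) (_⟶?_ I q) A.D (A.dominating (Digraph._⟶_ G) (oracle-answers I q))
    in n , number , A.size-bound n≤) ,
  compile 0 main , 716 ,
  (λ I k 1≤k q o answers →
    let module A = Algorithm o k 1≤k (cherryOracle I q answers)
    in A.outputs-D (A.dominating _ answers , A.size-bound ≤-refl) ,
       (clock A.final , A.terminates) , A.expected-time)
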